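{- Let $n\ge1$ be an integer and $q$ a prime power. For every function $f:\mathbb{F}_q^n\to\mathbb{C}$, $$\sum_{x\in\mathbb{F}_q^n}|f(x)|^n\ \ge\ \frac{1}{(2-1/q)^n}\,\frac{1}{|\mathbb{P}\mathbb{F}_q^{n-1}|}\sum_{u\in\mathbb{P}\mathbb{F}_q^{n-1}}|f^*(u)|^n .$$
   Context: $\mathbb{P}\mathbb{F}_q^{n-1}$ is the set of nonzero vectors of $\mathbb{F}_q^n$ up to multiplication by $\mathbb{F}_q^\times$ (the set of directions of lines in $\mathbb{F}_q^n$), with one representative in $\mathbb{F}_q^n$ fixed for each element. The maximal function of $f$ is $f^*(u)=\sup_{a\in\mathbb{F}_q^n}\sum_{t\in\mathbb{F}_q}|f(a+tu)|$ for $u\in\mathbb{P}\mathbb{F}_q^{n-1}$. -}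

module Defs where

open import Algebra.Structures using (IsCommutativeRing)
open import Data.Empty using (⊥-elim)
open import Data.Fin.Base using (Fin)
open import Data.Fin.Properties using (nonZeroIndex)
open import Data.Integer.Base as ℤ using (+_; -[1+_])
import Data.Integer.Properties as ℤ
open import Data.Integer.Solver as ℤSolver using ()
open import Data.List.Base
  using (List; []; _∷_; map; foldr; allFin; cartesianProductWith)
open import Data.Nat.Base as ℕ using (ℕ; zero; suc)
open import Data.Nat.Primality using (Prime)
import Data.Nat.Properties as ℕ
open import Data.Product.Base using (∃-syntax; _×_; _,_; proj₁; proj₂)
open import Data.Rational.Base as ℚ using (ℚ; mkℚ; 0ℚ; 1ℚ; ½)
import Data.Rational.Properties as ℚ
open import Data.Rational.Solver as ℚSolver using ()
open import Data.Rational.Unnormalised.Base as ℚᵘ using (mkℚᵘ; *≡*; *<*)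
import Data.Rational.Unnormalised.Properties as ℚᵘ
open import Data.Sum.Base using (inj₁; inj₂)
open import Data.Vec.Base as Vec using (Vec; []; _∷_; replicate; zipWith)
open import Function.Bundles using (_↔_; Inverse)
open import Level using (0ℓ)
open import Relation.Binary.Bundles using (Setoid)
open import Relation.Binary.PropositionalEquality as ≡
  using (_≡_; _≢_; refl; sym; trans; cong; cong₂; subst)
open import Relation.Nullary using (¬_; Dec; yes; no)

private
  module RationalLemmas where
    open ℚ.≤-Reasoning
    open ℚSolver.+-*-Solver

    half-pos : ∀ {ε} → 0ℚ ℚ.< ε → 0ℚ ℚ.< ½ ℚ.* ε
    half-pos {ε} 0<ε = begin-strict
      0ℚ        ≡⟨ ℚ.*-zeroʳ ½ ⟨
      ½ ℚ.* 0ℚ  <⟨ ℚ.*-monoʳ-<-pos ½ 0<ε ⟩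
      ½ ℚ.* ε   ∎

    halves : ∀ ε → ½ ℚ.* ε ℚ.+ ½ ℚ.* ε ≡ ε
    halves ε = trans (sym (ℚ.*-distribʳ-+ ε ½ ½)) (ℚ.*-identityˡ ε)

    *-pos : ∀ {a b} → 0ℚ ℚ.< a → 0ℚ ℚ.< b → 0ℚ ℚ.< a ℚ.* b
    *-pos {a} {b} 0<a 0<b =
      ℚ.positive⁻¹ _ {{ℚ.pos*pos⇒pos a {{ℚ.positive 0<a}} b {{ℚ.positive 0<b}}}}

    *-nonNeg : ∀ {a b} → 0ℚ ℚ.≤ a → 0ℚ ℚ.≤ b → 0ℚ ℚ.≤ a ℚ.* b
    *-nonNeg {a} {b} 0≤a 0≤b =
      ℚ.nonNegative⁻¹ _
        {{ℚ.nonNeg*nonNeg⇒nonNeg a {{ℚ.nonNegative 0≤a}} b {{ℚ.nonNegative 0≤b}}}}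

    *-mono : ∀ {a b c d} → 0ℚ ℚ.≤ c → 0ℚ ℚ.≤ b →
             a ℚ.≤ b → c ℚ.≤ d → a ℚ.* c ℚ.≤ b ℚ.* d
    *-mono {a} {b} {c} {d} 0≤c 0≤b a≤b c≤d = begin
      a ℚ.* c  ≤⟨ ℚ.*-monoʳ-≤-nonNeg c {{ℚ.nonNegative 0≤c}} a≤b ⟩
      b ℚ.* c  ≤⟨ ℚ.*-monoˡ-≤-nonNeg b {{ℚ.nonNegative 0≤b}} c≤d ⟩
      b ℚ.* d  ∎

    p≤∣p∣ : ∀ p → p ℚ.≤ ℚ.∣ p ∣
    p≤∣p∣ p with ℚ.≤-total 0ℚ p
    ... | inj₁ 0≤p = ℚ.≤-reflexive (sym (ℚ.0≤p⇒∣p∣≡p 0≤p))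
    ... | inj₂ p≤0 = ℚ.≤-trans p≤0 (ℚ.0≤∣p∣ p)

    ∣p∣<⇐ : ∀ {p r} → p ℚ.< r → ℚ.- p ℚ.< r → ℚ.∣ p ∣ ℚ.< r
    ∣p∣<⇐ {p} {r} p<r -p<r with ℚ.∣p∣≡p∨∣p∣≡-p p
    ... | inj₁ eq = subst (ℚ._< r) (sym eq) p<r
    ... | inj₂ eq = subst (ℚ._< r) (sym eq) -p<r

    dist⇒< : ∀ a b {ε} → ℚ.∣ a ℚ.- b ∣ ℚ.< ε → a ℚ.< b ℚ.+ ε
    dist⇒< a b {ε} d = begin-strict
      a                      ≡⟨ solve 2 (λ x y → x := y :+ (x :- y)) refl a b ⟩
      b ℚ.+ (a ℚ.- b)        ≤⟨ ℚ.+-monoʳ-≤ b (p≤∣p∣ (a ℚ.- b)) ⟩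
      b ℚ.+ ℚ.∣ a ℚ.- b ∣    <⟨ ℚ.+-monoʳ-< b d ⟩
      b ℚ.+ ε                ∎

    <⇒-< : ∀ a b {ε} → a ℚ.< b ℚ.+ ε → a ℚ.- b ℚ.< ε
    <⇒-< a b {ε} a<b+ε = begin-strict
      a ℚ.- b          <⟨ ℚ.+-monoˡ-< (ℚ.- b) a<b+ε ⟩
      b ℚ.+ ε ℚ.- b    ≡⟨ solve 2 (λ y e → y :+ e :- y := e) refl b ε ⟩
      ε                ∎

    <⇒dist : ∀ a b {ε} → a ℚ.< b ℚ.+ ε → b ℚ.< a ℚ.+ ε → ℚ.∣ a ℚ.- b ∣ ℚ.< ε
    <⇒dist a b {ε} p r =
      ∣p∣<⇐ (<⇒-< a b p)
        (subst (ℚ._< ε) (solve 2 (λ x y → y :- x := :- (x :- y)) refl a b) (<⇒-< b a r))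

    module _ where
      private
        +-*ℤ : ∀ m k → (m ℤ.* k ℤ.+ ℤ.1ℤ ℤ.* k) ℤ.* k ≡ (ℤ.1ℤ ℤ.+ m) ℤ.* (k ℤ.* k)
        +-*ℤ = ℤSolver.+-*-Solver.solve 2
          (λ m k → (m Z.:* k Z.:+ Z.con ℤ.1ℤ Z.:* k) Z.:* k
                   Z.:= (Z.con ℤ.1ℤ Z.:+ m) Z.:* (k Z.:* k)) refl
          where module Z = ℤSolver.+-*-Solver

      ᵘ-step : ∀ m k → mkℚᵘ (+ m) k ℚᵘ.+ mkℚᵘ (+ 1) k ℚᵘ.≃ mkℚᵘ (+ suc m) k
      ᵘ-step m k = *≡* (+-*ℤ (+ m) (+ suc k))

    recip-pos : ∀ k → 0ℚ ℚ.< + 1 ℚ./ suc k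
    recip-pos k = ℚ.positive⁻¹ _ {{ℚ.normalize-pos 1 (suc k)}}

    archimedean : ∀ {h} → 0ℚ ℚ.< h → ∃[ N ] ∀ n → N ℕ.≤ n → + 1 ℚ./ suc n ℚ.< h
    archimedean {h@(mkℚ (+ suc p) d _)} 0<h = suc d , λ n d<n →
      ℚ.toℚᵘ-cancel-<
        (ℚᵘ.<-respˡ-≃ (ℚᵘ.≃-sym (ℚ.toℚᵘ-fromℚᵘ (mkℚᵘ (+ 1) n)))
          (*<* (ℤ.+<+ (ℕ.<-≤-trans
            (subst (ℕ._< suc n) (sym (ℕ.*-identityˡ (suc d))) (ℕ.s≤s d<n))
            (ℕ.m≤m+n (suc n) (p ℕ.* suc n))))))
    archimedean {mkℚ (+ 0)    d _} (ℚ.*<* (ℤ.+<+ ()))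
    archimedean {mkℚ -[1+ p ] d _} (ℚ.*<* ())

    grid : ℕ → ℕ → ℚ
    grid k zero    = 0ℚ
    grid k (suc m) = grid k m ℚ.+ + 1 ℚ./ suc k

    grid-ᵘ : ∀ k m → ℚ.toℚᵘ (grid k m) ℚᵘ.≃ mkℚᵘ (+ m) k
    grid-ᵘ k zero    = *≡* refl
    grid-ᵘ k (suc m) =
      ℚᵘ.≃-trans (ℚ.toℚᵘ-homo-+ (grid k m) (+ 1 ℚ./ suc k))
        (ℚᵘ.≃-trans (ℚᵘ.+-cong (grid-ᵘ k m) (ℚ.toℚᵘ-fromℚᵘ (mkℚᵘ (+ 1) k)))
          (ᵘ-step m k))

    grid-nonNeg : ∀ k m → 0ℚ ℚ.≤ grid k m
    grid-nonNeg k zero    = ℚ.≤-refl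
    grid-nonNeg k (suc m) = ℚ.+-mono-≤ (grid-nonNeg k m) (ℚ.<⇒≤ (recip-pos k))

    grid-unbounded : ∀ k a → 0ℚ ℚ.≤ a → ∃[ m ] a ℚ.< grid k m
    grid-unbounded k (mkℚ -[1+ p ] d _) (ℚ.*≤* ())
    grid-unbounded k (mkℚ (+ p) d _) 0≤a = m ,
      ℚ.toℚᵘ-cancel-< (ℚᵘ.<-respʳ-≃ (ℚᵘ.≃-sym (grid-ᵘ k m))
        (*<* (≡.subst₂ ℤ._<_ (ℤ.pos-* p (suc k)) (ℤ.pos-* m (suc d)) (ℤ.+<+ bound))))
      where
      m = suc p ℕ.* suc k
      bound : p ℕ.* suc k ℕ.< m ℕ.* suc d
      bound = ℕ.<-≤-trans (ℕ.*-monoˡ-< (suc k) (ℕ.n<1+n p)) (ℕ.m≤m*n m (suc d))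

    lastBefore : (P : ℕ → Set) → (∀ m → Dec (P m)) → P 0 →
                 ∀ b → ¬ P b → ∃[ m ] P m × ¬ P (suc m)
    lastBefore P P? p0 zero    ¬pb = ⊥-elim (¬pb p0)
    lastBefore P P? p0 (suc b) ¬pb with P? b
    ... | yes pb = b , pb , ¬pb
    ... | no ¬pb′ = lastBefore P P? p0 b ¬pb′

  open RationalLemmas

approxSqrt : ∀ k a → 0ℚ ℚ.≤ a →
  ∃[ s ] 0ℚ ℚ.≤ s × s ℚ.* s ℚ.≤ a ×
         a ℚ.< (s ℚ.+ + 1 ℚ./ suc k) ℚ.* (s ℚ.+ + 1 ℚ./ suc k)
approxSqrt k a 0≤a =
  let m , m²≤a , ¬m′ = lastBefore P (λ m → _ ℚ.≤? a) 0≤a b ¬Pb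
  in grid k m , grid-nonNeg k m , m²≤a , ℚ.≰⇒> ¬m′
  where
  open ℚ.≤-Reasoning
  P : ℕ → Set
  P m = grid k m ℚ.* grid k m ℚ.≤ a

  unbounded : ∃[ m ] a ℚ.+ 1ℚ ℚ.< grid k m
  unbounded = grid-unbounded k (a ℚ.+ 1ℚ) (ℚ.+-mono-≤ 0≤a (ℚ.nonNegative⁻¹ 1ℚ))

  b = proj₁ unbounded
  g = grid k b

  a<g : a ℚ.< g
  a<g = begin-strict
    a          ≡⟨ ℚ.+-identityʳ a ⟨
    a ℚ.+ 0ℚ   ≤⟨ ℚ.+-monoʳ-≤ a (ℚ.nonNegative⁻¹ 1ℚ) ⟩
    a ℚ.+ 1ℚ   <⟨ proj₂ unbounded ⟩
    g          ∎

  1≤g : 1ℚ ℚ.≤ g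
  1≤g = begin
    1ℚ         ≡⟨ ℚ.+-identityˡ 1ℚ ⟨
    0ℚ ℚ.+ 1ℚ  ≤⟨ ℚ.+-monoˡ-≤ 1ℚ 0≤a ⟩
    a ℚ.+ 1ℚ   <⟨ proj₂ unbounded ⟩
    g          ∎

  ¬Pb : ¬ P b
  ¬Pb g²≤a = ℚ.<-irrefl refl (begin-strict
    a          <⟨ a<g ⟩
    g          ≡⟨ ℚ.*-identityʳ g ⟨
    g ℚ.* 1ℚ   ≤⟨ *-mono (ℚ.nonNegative⁻¹ 1ℚ) (grid-nonNeg k b) ℚ.≤-refl 1≤g ⟩
    g ℚ.* g    ≤⟨ g²≤a ⟩
    a          ∎)

infixr 8 _^ℚ_

_^ℚ_ : ℚ → ℕ → ℚ
x ^ℚ zero  = 1ℚ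
x ^ℚ suc n = x ℚ.* x ^ℚ n

-- Cauchy sequences of rationals, not quotiented: x and y denote the same real
-- number when x ≤ y and y ≤ x.
record ℝ : Set where
  field
    seq    : ℕ → ℚ
    cauchy : ∀ ε → 0ℚ ℚ.< ε →
             ∃[ N ] ∀ m n → N ℕ.≤ m → N ℕ.≤ n → ℚ.∣ seq m ℚ.- seq n ∣ ℚ.< ε

open ℝ public

infix  4 _≤_ _≥_
infixl 6 _+_ _⊔_
infixl 7 _*_
infixr 8 _^_

_≤_ : ℝ → ℝ → Set
x ≤ y = ∀ ε → 0ℚ ℚ.< ε → ∃[ N ] ∀ n → N ℕ.≤ n → seq x n ℚ.≤ seq y n ℚ.+ ε

_≥_ : ℝ → ℝ → Set
x ≥ y = y ≤ x

private
  fromOneSided : (s : ℕ → ℚ) →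
    (∀ ε → 0ℚ ℚ.< ε → ∃[ N ] ∀ m n → N ℕ.≤ m → N ℕ.≤ n → s m ℚ.< s n ℚ.+ ε) → ℝ
  fromOneSided s c = record
    { seq    = s
    ; cauchy = λ ε 0<ε → let N , h = c ε 0<ε in
        N , λ m n N≤m N≤n → <⇒dist (s m) (s n) (h m n N≤m N≤n) (h n m N≤n N≤m)
    }

fromℚ : ℚ → ℝ
fromℚ a = record
  { seq    = λ _ → a
  ; cauchy = λ ε 0<ε → 0 , λ _ _ _ _ →
      subst (λ d → ℚ.∣ d ∣ ℚ.< ε) (sym (ℚ.+-inverseʳ a)) 0<ε
  }

0ℝ 1ℝ : ℝ
0ℝ = fromℚ 0ℚ
1ℝ = fromℚ 1ℚ

_+_ : ℝ → ℝ → ℝ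
x + y = record
  { seq    = λ n → seq x n ℚ.+ seq y n
  ; cauchy = λ ε 0<ε →
      let N₁ , h₁ = cauchy x (½ ℚ.* ε) (half-pos 0<ε)
          N₂ , h₂ = cauchy y (½ ℚ.* ε) (half-pos 0<ε)
      in N₁ ℕ.⊔ N₂ , λ m n N≤m N≤n → begin-strict
        ℚ.∣ (seq x m ℚ.+ seq y m) ℚ.- (seq x n ℚ.+ seq y n) ∣
          ≡⟨ cong ℚ.∣_∣ (solve 4 (λ a b c d → (a :+ b) :- (c :+ d) := (a :- c) :+ (b :- d))
               refl (seq x m) (seq y m) (seq x n) (seq y n)) ⟩
        ℚ.∣ (seq x m ℚ.- seq x n) ℚ.+ (seq y m ℚ.- seq y n) ∣
          ≤⟨ ℚ.∣p+q∣≤∣p∣+∣q∣ (seq x m ℚ.- seq x n) (seq y m ℚ.- seq y n) ⟩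
        ℚ.∣ seq x m ℚ.- seq x n ∣ ℚ.+ ℚ.∣ seq y m ℚ.- seq y n ∣
          <⟨ ℚ.+-mono-< (h₁ m n (ℕ.m⊔n≤o⇒m≤o N₁ N₂ N≤m) (ℕ.m⊔n≤o⇒m≤o N₁ N₂ N≤n))
                        (h₂ m n (ℕ.m⊔n≤o⇒n≤o N₁ N₂ N≤m) (ℕ.m⊔n≤o⇒n≤o N₁ N₂ N≤n)) ⟩
        ½ ℚ.* ε ℚ.+ ½ ℚ.* ε
          ≡⟨ halves ε ⟩
        ε ∎
  }
  where
  open ℚ.≤-Reasoning
  open ℚSolver.+-*-Solver

private
  eventuallyBounded : (x : ℝ) →
    ∃[ B ] 0ℚ ℚ.< B × ∃[ N ] ∀ n → N ℕ.≤ n → ℚ.∣ seq x n ∣ ℚ.≤ B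
  eventuallyBounded x =
    let N , h = cauchy x 1ℚ (ℚ.positive⁻¹ 1ℚ)
        xN = seq x N
    in ℚ.∣ xN ∣ ℚ.+ 1ℚ ,
       ℚ.+-mono-≤-< (ℚ.0≤∣p∣ xN) (ℚ.positive⁻¹ 1ℚ) ,
       N , λ n N≤n → begin
         ℚ.∣ seq x n ∣
           ≡⟨ cong ℚ.∣_∣ (solve 2 (λ a b → a := b :+ (a :- b)) refl (seq x n) xN) ⟩
         ℚ.∣ xN ℚ.+ (seq x n ℚ.- xN) ∣
           ≤⟨ ℚ.∣p+q∣≤∣p∣+∣q∣ xN (seq x n ℚ.- xN) ⟩
         ℚ.∣ xN ∣ ℚ.+ ℚ.∣ seq x n ℚ.- xN ∣
           ≤⟨ ℚ.+-monoʳ-≤ ℚ.∣ xN ∣ (ℚ.<⇒≤ (h n N N≤n ℕ.≤-refl)) ⟩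
         ℚ.∣ xN ∣ ℚ.+ 1ℚ ∎
    where
    open ℚ.≤-Reasoning
    open ℚSolver.+-*-Solver

  recipMul : ∀ {ε B} → 0ℚ ℚ.< ε → 0ℚ ℚ.< B → ∃[ δ ] 0ℚ ℚ.< δ × B ℚ.* δ ≡ ε
  recipMul {ε} {B} 0<ε 0<B =
    r ℚ.* ε , *-pos 0<r 0<ε ,
    trans (sym (ℚ.*-assoc B r ε))
      (trans (cong (ℚ._* ε) (ℚ.*-inverseʳ B {{B≢0}})) (ℚ.*-identityˡ ε))
    where
    B≢0 : ℚ.NonZero B
    B≢0 = ℚ.pos⇒nonZero B {{ℚ.positive 0<B}}
    r = (ℚ.1/ B) {{B≢0}}
    0<r : 0ℚ ℚ.< r
    0<r = ℚ.positive⁻¹ r {{ℚ.1/pos⇒pos B {{ℚ.positive 0<B}}}}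

_*_ : ℝ → ℝ → ℝ
x * y = record
  { seq    = λ n → seq x n ℚ.* seq y n
  ; cauchy = λ ε 0<ε →
      let Bx , 0<Bx , Mx , bx = eventuallyBounded x
          By , 0<By , My , by = eventuallyBounded y
          δy , 0<δy , eqy = recipMul (half-pos 0<ε) 0<Bx
          δx , 0<δx , eqx = recipMul (half-pos 0<ε) 0<By
          Nx , hx = cauchy x δx 0<δx
          Ny , hy = cauchy y δy 0<δy
          M = Mx ℕ.⊔ My
          K = Nx ℕ.⊔ Ny
          term : ∀ {u v B δ} → 0ℚ ℚ.< B → ℚ.∣ u ∣ ℚ.≤ B → ℚ.∣ v ∣ ℚ.< δ →
                 ℚ.∣ u ℚ.* v ∣ ℚ.< B ℚ.* δ
          term {u} {v} {B} {δ} 0<B u≤B v<δ = begin-strict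
            ℚ.∣ u ℚ.* v ∣          ≡⟨ ℚ.∣p*q∣≡∣p∣*∣q∣ u v ⟩
            ℚ.∣ u ∣ ℚ.* ℚ.∣ v ∣    ≤⟨ *-mono (ℚ.0≤∣p∣ v) (ℚ.<⇒≤ 0<B) u≤B ℚ.≤-refl ⟩
            B ℚ.* ℚ.∣ v ∣          <⟨ ℚ.*-monoʳ-<-pos B {{ℚ.positive 0<B}} v<δ ⟩
            B ℚ.* δ                ∎
      in M ℕ.⊔ K , λ m n N≤m N≤n →
        let M≤m = ℕ.m⊔n≤o⇒m≤o M K N≤m
            K≤m = ℕ.m⊔n≤o⇒n≤o M K N≤m
            M≤n = ℕ.m⊔n≤o⇒m≤o M K N≤n
            K≤n = ℕ.m⊔n≤o⇒n≤o M K N≤n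
        in begin-strict
        ℚ.∣ seq x m ℚ.* seq y m ℚ.- seq x n ℚ.* seq y n ∣
          ≡⟨ cong ℚ.∣_∣ (solve 4 (λ a b c d → a :* b :- c :* d
                                    := a :* (b :- d) :+ d :* (a :- c))
               refl (seq x m) (seq y m) (seq x n) (seq y n)) ⟩
        ℚ.∣ seq x m ℚ.* (seq y m ℚ.- seq y n) ℚ.+ seq y n ℚ.* (seq x m ℚ.- seq x n) ∣
          ≤⟨ ℚ.∣p+q∣≤∣p∣+∣q∣ (seq x m ℚ.* (seq y m ℚ.- seq y n))
                             (seq y n ℚ.* (seq x m ℚ.- seq x n)) ⟩
        ℚ.∣ seq x m ℚ.* (seq y m ℚ.- seq y n) ∣ ℚ.+ ℚ.∣ seq y n ℚ.* (seq x m ℚ.- seq x n) ∣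
          <⟨ ℚ.+-mono-<
               (term {seq x m} {seq y m ℚ.- seq y n} 0<Bx (bx m (ℕ.m⊔n≤o⇒m≤o Mx My M≤m))
                 (hy m n (ℕ.m⊔n≤o⇒n≤o Nx Ny K≤m) (ℕ.m⊔n≤o⇒n≤o Nx Ny K≤n)))
               (term {seq y n} {seq x m ℚ.- seq x n} 0<By (by n (ℕ.m⊔n≤o⇒n≤o Mx My M≤n))
                 (hx m n (ℕ.m⊔n≤o⇒m≤o Nx Ny K≤m) (ℕ.m⊔n≤o⇒m≤o Nx Ny K≤n))) ⟩
        Bx ℚ.* δy ℚ.+ By ℚ.* δx
          ≡⟨ cong₂ ℚ._+_ eqy eqx ⟩
        ½ ℚ.* ε ℚ.+ ½ ℚ.* ε
          ≡⟨ halves ε ⟩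
        ε ∎
  }
  where
  open ℚ.≤-Reasoning
  open ℚSolver.+-*-Solver

_^_ : ℝ → ℕ → ℝ
x ^ zero  = 1ℝ
x ^ suc n = x * x ^ n

private
  ⊔-close : ∀ a b c d {ε} → a ℚ.< c ℚ.+ ε → b ℚ.< d ℚ.+ ε →
            a ℚ.⊔ b ℚ.< (c ℚ.⊔ d) ℚ.+ ε
  ⊔-close a b c d {ε} a<c b<d with ℚ.≤-total a b
  ... | inj₁ a≤b = subst (ℚ._< _) (sym (ℚ.p≤q⇒p⊔q≡q a≤b))
                     (ℚ.<-≤-trans b<d (ℚ.+-monoˡ-≤ ε (ℚ.p≤q⊔p c d)))
  ... | inj₂ b≤a = subst (ℚ._< _) (sym (ℚ.p≥q⇒p⊔q≡p b≤a))
                     (ℚ.<-≤-trans a<c (ℚ.+-monoˡ-≤ ε (ℚ.p≤p⊔q c d)))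

_⊔_ : ℝ → ℝ → ℝ
x ⊔ y = fromOneSided (λ n → seq x n ℚ.⊔ seq y n) λ ε 0<ε →
  let N₁ , h₁ = cauchy x ε 0<ε
      N₂ , h₂ = cauchy y ε 0<ε
  in N₁ ℕ.⊔ N₂ , λ m n N≤m N≤n →
    ⊔-close (seq x m) (seq y m) (seq x n) (seq y n)
      (dist⇒< (seq x m) (seq x n)
        (h₁ m n (ℕ.m⊔n≤o⇒m≤o N₁ N₂ N≤m) (ℕ.m⊔n≤o⇒m≤o N₁ N₂ N≤n)))
      (dist⇒< (seq y m) (seq y n)
        (h₂ m n (ℕ.m⊔n≤o⇒n≤o N₁ N₂ N≤m) (ℕ.m⊔n≤o⇒n≤o N₁ N₂ N≤n)))

∣_∣ : ℝ → ℝ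
∣ x ∣ = fromOneSided (λ n → ℚ.∣ seq x n ∣) λ ε 0<ε →
  let N , h = cauchy x ε 0<ε
  in N , λ m n N≤m N≤n → begin-strict
    ℚ.∣ seq x m ∣
      ≡⟨ cong ℚ.∣_∣ (solve 2 (λ a b → a := b :+ (a :- b)) refl (seq x m) (seq x n)) ⟩
    ℚ.∣ seq x n ℚ.+ (seq x m ℚ.- seq x n) ∣
      ≤⟨ ℚ.∣p+q∣≤∣p∣+∣q∣ (seq x n) (seq x m ℚ.- seq x n) ⟩
    ℚ.∣ seq x n ∣ ℚ.+ ℚ.∣ seq x m ℚ.- seq x n ∣
      <⟨ ℚ.+-monoʳ-< ℚ.∣ seq x n ∣ (h m n N≤m N≤n) ⟩
    ℚ.∣ seq x n ∣ ℚ.+ ε ∎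
  where
  open ℚ.≤-Reasoning
  open ℚSolver.+-*-Solver

private
  sqrt-separated : ∀ {ε s t δ a b} → 0ℚ ℚ.< ε → 0ℚ ℚ.≤ s → 0ℚ ℚ.≤ t → 0ℚ ℚ.< δ →
    s ℚ.* s ℚ.≤ a → b ℚ.< (t ℚ.+ δ) ℚ.* (t ℚ.+ δ) →
    δ ℚ.< ½ ℚ.* ε → a ℚ.< b ℚ.+ ½ ℚ.* ε ℚ.* (½ ℚ.* ε) →
    ¬ (t ℚ.+ ε ℚ.≤ s)
  sqrt-separated {ε} {s} {t} {δ} {a} {b} 0<ε 0≤s 0≤t 0<δ s²≤a b<u² δ<h a<b t+ε≤s =
    ℚ.<-irrefl refl (begin-strict
    u ℚ.* u ℚ.+ h ℚ.* h
      ≡⟨ ℚ.+-identityʳ _ ⟨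
    u ℚ.* u ℚ.+ h ℚ.* h ℚ.+ 0ℚ
      ≤⟨ ℚ.+-monoʳ-≤ (u ℚ.* u ℚ.+ h ℚ.* h) (ℚ.+-mono-≤ 0≤uh 0≤uh) ⟩
    u ℚ.* u ℚ.+ h ℚ.* h ℚ.+ (u ℚ.* h ℚ.+ u ℚ.* h)
      ≡⟨ solve 2 (λ u h → u :* u :+ h :* h :+ (u :* h :+ u :* h) := (u :+ h) :* (u :+ h))
           refl u h ⟩
    (u ℚ.+ h) ℚ.* (u ℚ.+ h)
      ≤⟨ *-mono (ℚ.+-mono-≤ 0≤u 0≤h) 0≤s u+h≤s u+h≤s ⟩
    s ℚ.* s
      ≤⟨ s²≤a ⟩
    a
      <⟨ a<b ⟩
    b ℚ.+ h ℚ.* h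
      <⟨ ℚ.+-monoˡ-< (h ℚ.* h) b<u² ⟩
    u ℚ.* u ℚ.+ h ℚ.* h ∎)
    where
    open ℚ.≤-Reasoning
    open ℚSolver.+-*-Solver
    h = ½ ℚ.* ε
    u = t ℚ.+ δ
    0≤h : 0ℚ ℚ.≤ h
    0≤h = ℚ.<⇒≤ (half-pos 0<ε)
    0≤u : 0ℚ ℚ.≤ u
    0≤u = ℚ.+-mono-≤ 0≤t (ℚ.<⇒≤ 0<δ)
    0≤uh : 0ℚ ℚ.≤ u ℚ.* h
    0≤uh = *-nonNeg 0≤u 0≤h
    u+h≤s : u ℚ.+ h ℚ.≤ s
    u+h≤s = begin
      u ℚ.+ h            ≤⟨ ℚ.+-monoˡ-≤ h (ℚ.+-monoʳ-≤ t (ℚ.<⇒≤ δ<h)) ⟩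
      t ℚ.+ h ℚ.+ h      ≡⟨ ℚ.+-assoc t h h ⟩
      t ℚ.+ (h ℚ.+ h)    ≡⟨ cong (t ℚ.+_) (halves ε) ⟩
      t ℚ.+ ε            ≤⟨ t+ε≤s ⟩
      s                  ∎

-- The square root of max(x, 0): its k-th term is within 1/(k+1) of the
-- square root of the k-th term of max(x, 0).
√_ : ℝ → ℝ
√ x = fromOneSided (λ k → proj₁ (approx k)) λ ε 0<ε →
  let 0<h = half-pos 0<ε
      N₁ , small = archimedean 0<h
      N₂ , close = cauchy (x ⊔ 0ℝ) (½ ℚ.* ε ℚ.* (½ ℚ.* ε)) (*-pos 0<h 0<h)
  in N₁ ℕ.⊔ N₂ , λ m n N≤m N≤n → ℚ.≰⇒>
    (let _ , 0≤s , s²≤a , _ = approx m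
         _ , 0≤t , _ , b<u² = approx n
     in sqrt-separated 0<ε 0≤s 0≤t (recip-pos n) s²≤a b<u²
          (small n (ℕ.m⊔n≤o⇒m≤o N₁ N₂ N≤n))
          (dist⇒< (seq (x ⊔ 0ℝ) m) (seq (x ⊔ 0ℝ) n)
            (close m n (ℕ.m⊔n≤o⇒n≤o N₁ N₂ N≤m) (ℕ.m⊔n≤o⇒n≤o N₁ N₂ N≤n))))
  where
  approx : ∀ k → _
  approx k = approxSqrt k (seq (x ⊔ 0ℝ) k) (ℚ.p≤q⊔p (seq x k) 0ℚ)

record ℂ : Set where
  constructor _+i_
  field
    re im : ℝ

open ℂ public

∣_∣ℂ : ℂ → ℝ
∣ z ∣ℂ = √ (re z * re z + im z * im z)

sumOver : {A : Set} → List A → (A → ℝ) → ℝ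
sumOver xs g = foldr (λ x s → g x + s) 0ℝ xs

IsPrimePower : ℕ → Set
IsPrimePower q = ∃[ p ] ∃[ k ] Prime p × 1 ℕ.≤ k × q ≡ p ℕ.^ k

record FiniteField (q : ℕ) : Set₁ where
  infixl 6 _⊕_
  infixl 7 _⊗_
  field
    Carrier           : Set
    _⊕_ _⊗_           : Carrier → Carrier → Carrier
    ⊖_                : Carrier → Carrier
    0# 1#             : Carrier
    isCommutativeRing : IsCommutativeRing _≡_ _⊕_ _⊗_ ⊖_ 0# 1#
    1≢0               : 1# ≢ 0#
    inverse           : ∀ x → x ≢ 0# → ∃[ y ] x ⊗ y ≡ 1#
    enumeration       : Fin q ↔ Carrier

  open IsCommutativeRing isCommutativeRing public
    using (*-assoc; *-comm; *-identityˡ; zeroˡ; zeroʳ)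

module _ {q : ℕ} (F : FiniteField q) where
  open FiniteField F

  elements : List Carrier
  elements = map (Inverse.to enumeration) (allFin q)

  Vector : ℕ → Set
  Vector n = Vec Carrier n

  vectors : ∀ n → List (Vector n)
  vectors zero    = [] ∷ []
  vectors (suc n) = cartesianProductWith _∷_ elements (vectors n)

  0ᵥ : ∀ {n} → Vector n
  0ᵥ {n} = replicate n 0#

  addᵥ : ∀ {n} → Vector n → Vector n → Vector n
  addᵥ = zipWith _⊕_

  scale : ∀ {n} → Carrier → Vector n → Vector n
  scale c = Vec.map (c ⊗_)

  private
    scale-1 : ∀ {n} (v : Vector n) → scale 1# v ≡ v
    scale-1 []      = refl
    scale-1 (x ∷ v) = cong₂ _∷_ (*-identityˡ x) (scale-1 v)

    scale-⊗ : ∀ {n} c d (v : Vector n) → scale c (scale d v) ≡ scale (c ⊗ d) v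
    scale-⊗ c d []      = refl
    scale-⊗ c d (x ∷ v) = cong₂ _∷_ (sym (*-assoc c d x)) (scale-⊗ c d v)

    unitˡ : ∀ {c d} → c ⊗ d ≡ 1# → c ≢ 0#
    unitˡ {c} {d} cd≡1 c≡0 =
      1≢0 (trans (sym cd≡1) (trans (cong (_⊗ d) c≡0) (zeroˡ d)))

    ⊗-≢0 : ∀ {c d} → c ≢ 0# → d ≢ 0# → c ⊗ d ≢ 0#
    ⊗-≢0 {c} {d} c≢0 d≢0 cd≡0 =
      let c′ , cc′≡1 = inverse c c≢0 in
      d≢0 (trans (sym (*-identityˡ d))
          (trans (cong (_⊗ d) (trans (sym cc′≡1) (*-comm c c′)))
          (trans (*-assoc c′ c d) (trans (cong (c′ ⊗_) cd≡0) (zeroʳ c′)))))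

  ℙ : ℕ → Setoid 0ℓ 0ℓ
  ℙ n = record
    { Carrier       = ∃[ v ] v ≢ 0ᵥ {n}
    ; _≈_           = λ (v , _) (w , _) → ∃[ c ] c ≢ 0# × w ≡ scale c v
    ; isEquivalence = record
      { refl  = λ {(v , _)} → 1# , 1≢0 , sym (scale-1 v)
      ; sym   = λ {(v , _)} {(w , _)} (c , c≢0 , w≡cv) →
          let c′ , cc′≡1 = inverse c c≢0
              c′c≡1 = trans (*-comm c′ c) cc′≡1
          in c′ , unitˡ c′c≡1 ,
             sym (trans (cong (scale c′) w≡cv)
                 (trans (scale-⊗ c′ c v) (trans (cong (λ d → scale d v) c′c≡1) (scale-1 v))))
      ; trans = λ {(u , _)} (c , c≢0 , v≡cu) (d , d≢0 , w≡dv) →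
          d ⊗ c , ⊗-≢0 d≢0 c≢0 ,
          trans w≡dv (trans (cong (scale d) v≡cu) (scale-⊗ d c u))
      }
    }

  -- `to bijection` picks one representative vector for each point of ℙ n.
  record Representatives (n : ℕ) : Set where
    field
      size      : ℕ
      bijection : Inverse (≡.setoid (Fin size)) (ℙ n)

    rep : Fin size → Vector n
    rep i = proj₁ (Inverse.to bijection i)

    size-nonZero : .{{_ : ℕ.NonZero n}} → ℕ.NonZero size
    size-nonZero = nonZeroIndex (Inverse.from bijection (point n))
      where
      point : ∀ m → .{{_ : ℕ.NonZero m}} → Setoid.Carrier (ℙ m)
      point (suc m) = 1# ∷ 0ᵥ , λ eq → 1≢0 (cong Vec.head eq)

    1/size : .{{_ : ℕ.NonZero n}} → ℚ
    1/size = (+ 1 ℚ./ size) {{size-nonZero}}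

  -- The seed g 0ᵥ is itself one of the values, so this is the supremum
  -- with no convention about a supremum of the empty set.
  sup : ∀ {n} → (Vector n → ℝ) → ℝ
  sup {n} g = foldr (λ a s → g a ⊔ s) (g 0ᵥ) (vectors n)

  maximal : ∀ {n} → (Vector n → ℂ) → Vector n → ℝ
  maximal f u = sup λ a → sumOver elements λ t → ∣ f (addᵥ a (scale t u)) ∣ℂ

2-1/_ : ∀ q → .{{_ : ℕ.NonZero q}} → ℚ
2-1/ q = + 2 ℚ./ 1 ℚ.- + 1 ℚ./ q

private
  2-1/q-pos : ∀ q → .{{_ : ℕ.NonZero q}} → ℚ.Positive (2-1/ q)
  2-1/q-pos (suc k) = ℚ.positive (begin-strict
    0ℚ                              <⟨ ℚ.positive⁻¹ 1ℚ ⟩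
    + 2 ℚ./ 1 ℚ.- 1ℚ                ≤⟨ ℚ.+-monoʳ-≤ (+ 2 ℚ./ 1) (ℚ.neg-antimono-≤ 1/q≤1) ⟩
    + 2 ℚ./ 1 ℚ.- + 1 ℚ./ suc k     ∎)
    where
    open ℚ.≤-Reasoning
    1/q≤1 : + 1 ℚ./ suc k ℚ.≤ 1ℚ
    1/q≤1 = ℚ.toℚᵘ-cancel-≤ (ℚᵘ.≤-respˡ-≃ (ℚᵘ.≃-sym (ℚ.toℚᵘ-fromℚᵘ (mkℚᵘ (+ 1) k)))
              (ℚᵘ.*≤* (ℤ.+≤+ (ℕ.s≤s ℕ.z≤n))))

  ^ℚ-pos : ∀ x → ℚ.Positive x → ∀ n → ℚ.Positive (x ^ℚ n)
  ^ℚ-pos x 0<x zero    = _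
  ^ℚ-pos x 0<x (suc n) = ℚ.pos*pos⇒pos x {{0<x}} (x ^ℚ n) {{^ℚ-pos x 0<x n}}

1/[2-1/_]^_ : ∀ q n → .{{_ : ℕ.NonZero q}} → ℚ
1/[2-1/ q ]^ n =
  (ℚ.1/ ((2-1/ q) ^ℚ n))
    {{ℚ.pos⇒nonZero ((2-1/ q) ^ℚ n) {{^ℚ-pos (2-1/ q) (2-1/q-pos q) n}}}}

-- Since ℝ consists of unquotiented Cauchy sequences with termwise operations, it
-- suffices to treat rational-valued |f|, and after clearing denominators
-- multiplicities μ : K^n → ℕ with S u = max_b ∑_t μ (b + t u). This is done by the
-- method of multiplicities, for polynomials adapted to the directions. For each e
-- fix a hyperplane h; a triple (e, u, k) with e < T u, h(u) ≠ 0 and q|k| ≤ e gives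
-- a polynomial of degree e + (n − 1)(q − 1),
--     h^(e − q|k|) ∏ⱼ ∏ₐ (xⱼ − a h)^(kⱼ + [a ≠ uⱼ / h(u)]).
-- If a combination of them vanishes to order μ x at every x, restrict it to the
-- line b + t (u + V), where V is a generic vector of the hyperplane h = 0: the
-- coefficient of V^k is a polynomial in t with more zeros than its degree, because
-- T u ≈ S u / (2 − 1/q) is chosen so that e + (n − 1)(q − 1) + (q − 1)|k| < S u for
-- every triple. Hence its leading coefficient vanishes. By
-- downward induction on e and upward induction on |k| this is a nonzero multiple of
-- the coefficient of (e, u, k). So the number of triples is at most the number of
-- vanishing conditions ∑ₓ #{β : |β| < μ x}. Choosing h by averaging over the
-- directions gives ∑ (T u)^n ≤ |P| ∑ (μ x + n)^n, and scaling μ to infinity removes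
-- the lower order terms.
module Submission where

open import Defs using (FiniteField; elements; Representatives; vectors; 0ᵥ; scale)
open import Algebra.Bundles using (CommutativeRing)
open import Data.Empty using (⊥-elim)
open import Data.Fin.Base using (Fin; zero; suc; punchIn; combine; finToFun; funToFin)
import Data.Fin.Properties as Fin
import Data.Integer.Base as ℤ
import Data.Integer.Properties as ℤ
open import Data.List.Base as List using (List; []; _∷_; _++_; map; concatMap; foldr; filter; lookup; length; allFin; tabulate; downFrom)
open import Data.List.Properties using (length-map; length-++; map-∘; map-tabulate; length-tabulate)
open import Data.List.Membership.Propositional using (_∈_; find; lose)
open import Data.List.Membership.Propositional.Properties
open import Data.List.Relation.Unary.All as All using (All; []; _∷_)
import Data.List.Relation.Unary.All.Properties as All
open import Data.List.Relation.Unary.AllPairs using ([]; _∷_)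
open import Data.List.Relation.Unary.Any as Any using (here; there)
open import Data.List.Relation.Unary.Any.Properties using (lookup-index)
open import Data.List.Relation.Unary.Unique.Propositional using (Unique)
import Data.List.Relation.Unary.Unique.Propositional.Properties as Unique
open import Data.Nat.Base as ℕ using (ℕ; zero; suc; NonZero)
open import Data.Nat.DivMod using (_/_; m/n*n≤m; m<n*o⇒m/o<n; m≡m%n+[m/n]*n; m%n<n)
open import Data.Nat.ListAction using (sum)
import Data.Nat.Properties as ℕ
import Data.Nat.Solver as ℕSolver
open import Data.Product.Base using (_,_; _×_; Σ-syntax; ∃-syntax; proj₁; proj₂)
open import Data.Rational.Base as ℚ using (ℚ; mkℚ; 0ℚ; 1ℚ)
import Data.Rational.Properties as ℚ
import Data.Rational.Solver as ℚSolver
open import Data.Rational.Unnormalised.Base as ℚᵘ using (mkℚᵘ; *≡*)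
import Data.Rational.Unnormalised.Properties as ℚᵘ
open import Data.Sum.Base as Sum using (inj₁; inj₂)
open import Data.Unit.Base using (⊤; tt)
open import Data.Vec.Base as Vec using (Vec; []; _∷_)
open import Data.Vec.Functional using (insertAt)
open import Data.Vec.Functional.Properties using (insertAt-lookup; insertAt-punchIn)
import Data.Vec.Properties as Vec
open import Function.Base using (_∘_; id)
open import Function.Bundles using (Inverse)
open import Level using (0ℓ)
open import Relation.Binary.Definitions using (tri<; tri≈; tri>)
open import Relation.Binary.PropositionalEquality as ≡ using (_≡_; _≢_; subst)
open import Relation.Nullary using (¬_; yes; no; Dec)
open import Relation.Nullary.Decidable using (¬?; _×-dec_)

-- The constant comes from the degree count: with |k| ≤ e/q the demand on S u is about e + (q - 1)
-- e/q = (2 - 1/q) e. The coefficient of V^k costs (q - 1)|k| zeros and not q|k|, because V enters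
-- the line as t V, which already vanishes at t = 0; no zeros are lost there. At any direction u′
-- with h(u′) ≠ 0 exactly one factor of each row j vanishes, the one with a = u′ⱼ / h(u′). Its
-- exponent is kⱼ, raised by one if u and u′ differ in that coordinate. So the lowest monomial at u′
-- is V^k times the variables that tell u from u′, which makes the system for one e triangular in
-- |k|. Only triples with equal e are compared in this way, so h may depend on e. The condition q|k|
-- ≤ e, due to the q factors of each row, divides the number of monomials by about q^(n - 1). On the
-- other hand at least q^(n - 1) of the |P| choices of h are nonzero at a given u. The two powers
-- cancel and 1/|P| remains. Multiplicities are orders with respect to filtrations of power series
-- rings. Derivatives do not occur, so the characteristic does not interfere.

Ring : Set₁
Ring = CommutativeRing 0ℓ 0ℓ

-- Formal power series over a commutative ring

module PowerSeries (R : Ring) where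
  open CommutativeRing R
  open import Algebra.Properties.CommutativeSemigroup +-commutativeSemigroup
    using (x∙yz≈y∙xz; interchange)
  open import Relation.Binary.Reasoning.Setoid setoid

  infix  4 _≋_
  infixl 6 _⊞_
  infixl 7 _⊠_ _⊡_

  PS : Set
  PS = ℕ → Carrier

  _≋_ : PS → PS → Set
  f ≋ g = ∀ n → f n ≈ g n

  tail : PS → PS
  tail f = f ∘ suc

  -- Recursion on `f` as head plus indeterminate times `tail f` replaces the sum over splittings of
  -- the index, so that the ring laws become inductions on the index.
  _⊞_ _⊠_ : PS → PS → PS
  (f ⊞ g) n = f n + g n
  (f ⊠ g) zero    = f 0 * g 0
  (f ⊠ g) (suc n) = f 0 * g (suc n) + (tail f ⊠ g) n

  _⊡_ : Carrier → PS → PS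
  (a ⊡ f) n = a * f n

  constant : Carrier → PS
  constant a zero    = a
  constant a (suc _) = 0#

  indeterminate : PS
  indeterminate zero    = 0#
  indeterminate (suc n) = constant 1# n

  ⊠-cong : ∀ {f f′ g g′} → f ≋ f′ → g ≋ g′ → f ⊠ g ≋ f′ ⊠ g′
  ⊠-cong p r zero    = *-cong (p 0) (r 0)
  ⊠-cong p r (suc n) = +-cong (*-cong (p 0) (r (suc n))) (⊠-cong (p ∘ suc) r n)

  ⊠-zeroˡ : ∀ {f} g → (∀ n → f n ≈ 0#) → ∀ n → (f ⊠ g) n ≈ 0#
  ⊠-zeroˡ g z zero    = trans (*-congʳ (z 0)) (zeroˡ _)
  ⊠-zeroˡ g z (suc n) = trans (+-cong (trans (*-congʳ (z 0)) (zeroˡ _)) (⊠-zeroˡ g (z ∘ suc) n))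
                              (+-identityˡ 0#)

  constant-⊠ : ∀ a g → constant a ⊠ g ≋ a ⊡ g
  constant-⊠ a g zero    = refl
  constant-⊠ a g (suc n) = trans (+-congˡ (⊠-zeroˡ g (λ _ → refl) n)) (+-identityʳ _)

  ⊠-distribʳ : ∀ h f g → (f ⊞ g) ⊠ h ≋ f ⊠ h ⊞ g ⊠ h
  ⊠-distribʳ h f g zero    = distribʳ _ _ _
  ⊠-distribʳ h f g (suc n) =
    trans (+-cong (distribʳ _ _ _) (⊠-distribʳ h (tail f) (tail g) n)) (interchange _ _ _ _)

  ⊡-⊠ : ∀ a g h → (a ⊡ g) ⊠ h ≋ a ⊡ (g ⊠ h)
  ⊡-⊠ a g h zero    = *-assoc _ _ _
  ⊡-⊠ a g h (suc n) = trans (+-cong (*-assoc _ _ _) (⊡-⊠ a (tail g) h n)) (sym (distribˡ _ _ _))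

  -- The defining recursion splits off the head of `f`, this one the head of `g`; comparing the two
  -- gives commutativity.
  ⊠-sucʳ : ∀ f g n → (f ⊠ g) (suc n) ≈ f (suc n) * g 0 + (f ⊠ tail g) n
  ⊠-sucʳ f g zero    = +-comm _ _
  ⊠-sucʳ f g (suc n) = trans (+-congˡ (⊠-sucʳ (tail f) g n)) (x∙yz≈y∙xz _ _ _)

  ⊠-comm : ∀ f g → f ⊠ g ≋ g ⊠ f
  ⊠-comm f g zero    = *-comm _ _
  ⊠-comm f g (suc n) = trans (+-cong (*-comm _ _) (⊠-comm (tail f) g n)) (sym (⊠-sucʳ g f n))

  ⊠-assoc : ∀ f g h → (f ⊠ g) ⊠ h ≋ f ⊠ (g ⊠ h)
  ⊠-assoc f g h zero    = *-assoc _ _ _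
  ⊠-assoc f g h (suc n) = begin
    f 0 * g 0 * h (suc n) + (tail (f ⊠ g) ⊠ h) n
      ≈⟨ +-cong (*-assoc _ _ _) (⊠-distribʳ h (f 0 ⊡ tail g) (tail f ⊠ g) n) ⟩
    f 0 * (g 0 * h (suc n)) + (((f 0 ⊡ tail g) ⊠ h) n + ((tail f ⊠ g) ⊠ h) n)
      ≈⟨ +-assoc _ _ _ ⟨
    f 0 * (g 0 * h (suc n)) + ((f 0 ⊡ tail g) ⊠ h) n + ((tail f ⊠ g) ⊠ h) n
      ≈⟨ +-cong (+-congˡ (⊡-⊠ (f 0) (tail g) h n)) (⊠-assoc (tail f) g h n) ⟩
    f 0 * (g 0 * h (suc n)) + f 0 * (tail g ⊠ h) n + (tail f ⊠ (g ⊠ h)) n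
      ≈⟨ +-congʳ (distribˡ _ _ _) ⟨
    f 0 * (g ⊠ h) (suc n) + (tail f ⊠ (g ⊠ h)) n
      ∎

  indeterminate-⊠ : ∀ g n → (indeterminate ⊠ g) (suc n) ≈ g n
  indeterminate-⊠ g n =
    trans (+-cong (zeroˡ _) (trans (constant-⊠ 1# g n) (*-identityˡ _))) (+-identityˡ _)

  powerSeries : Ring
  powerSeries = record
    { Carrier = PS
    ; _≈_ = _≋_
    ; _+_ = _⊞_
    ; _*_ = _⊠_
    ; -_  = λ f n → - f n
    ; 0#  = λ _ → 0#
    ; 1#  = constant 1#
    ; isCommutativeRing = record
      { isRing = record
        { +-isAbelianGroup = record
          { isGroup = record
            { isMonoid = record
              { isSemigroup = record
                { isMagma = record
                  { isEquivalence = record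
                    { refl  = λ _ → refl
                    ; sym   = λ p n → sym (p n)
                    ; trans = λ p r n → trans (p n) (r n)
                    }
                  ; ∙-cong = λ p r n → +-cong (p n) (r n)
                  }
                ; assoc = λ f g h n → +-assoc _ _ _
                }
              ; identity = (λ f n → +-identityˡ _) , (λ f n → +-identityʳ _)
              }
            ; inverse = (λ f n → -‿inverseˡ _) , (λ f n → -‿inverseʳ _)
            ; ⁻¹-cong = λ p n → -‿cong (p n)
            }
          ; comm = λ f g n → +-comm _ _
          }
        ; *-cong     = ⊠-cong
        ; *-assoc    = ⊠-assoc
        ; *-identity = one-⊠ , λ f n → trans (⊠-comm f _ n) (one-⊠ f n)
        ; distrib    = (λ f g h n → trans (⊠-comm f _ n)
                         (trans (⊠-distribʳ f g h n) (+-cong (⊠-comm g f n) (⊠-comm h f n))))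
                     , ⊠-distribʳ
        }
      ; *-comm = ⊠-comm
      }
    }
    where
    one-⊠ : ∀ f → constant 1# ⊠ f ≋ f
    one-⊠ f n = trans (constant-⊠ 1# f n) (*-identityˡ _)

-- Power inequalities, counts of monomials, finite sums

module Combinatorics where
  open import Data.Nat.Base
  open import Data.Nat.Properties
  open import Algebra.Properties.CommutativeSemigroup *-commutativeSemigroup
    using (interchange) renaming (x∙yz≈y∙xz to *-left-comm)
  open ≡

  -- The mean value bound for x^(n + 1) on [a, a + b], with the slope taken at the right end. It
  -- serves to compare sums with powers and to bound the errors of the final scaling.
  [a+b]^n≤ : ∀ a b n → (a + b) ^ suc n ≤ a ^ suc n + suc n * b * (a + b) ^ n
  [a+b]^n≤ a b zero = ≤-reflexive (begin
    (a + b) * 1              ≡⟨ *-distribʳ-+ 1 a b ⟩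
    a * 1 + b * 1            ≡⟨ cong (λ v → a * 1 + v * 1) (+-identityʳ b) ⟨
    a * 1 + (b + 0) * 1      ∎)
    where open ≡-Reasoning
  [a+b]^n≤ a b (suc n) = begin
    (a + b) * X                                          ≡⟨ *-distribʳ-+ X a b ⟩
    a * X + b * X                                        ≤⟨ +-monoˡ-≤ (b * X) (*-monoʳ-≤ a ([a+b]^n≤ a b n)) ⟩
    a * (a ^ suc n + suc n * b * Y) + b * X              ≡⟨ cong (_+ b * X) (trans (*-distribˡ-+ a (a ^ suc n) _) (cong (a ^ suc (suc n) +_) (*-left-comm a (suc n * b) Y))) ⟩
    a ^ suc (suc n) + suc n * b * (a * Y) + b * X        ≤⟨ +-monoˡ-≤ (b * X) (+-monoʳ-≤ (a ^ suc (suc n)) (*-monoʳ-≤ (suc n * b) (*-monoˡ-≤ Y (m≤m+n a b)))) ⟩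
    a ^ suc (suc n) + suc n * b * X + b * X              ≡⟨ +-assoc (a ^ suc (suc n)) _ _ ⟩
    a ^ suc (suc n) + (suc n * b * X + b * X)            ≡⟨ cong (a ^ suc (suc n) +_) (trans (+-comm _ (b * X)) (sym (*-distribʳ-+ X b (suc n * b)))) ⟩
    a ^ suc (suc n) + suc (suc n) * b * X                ∎
    where
    open ≤-Reasoning
    X = (a + b) ^ suc n
    Y = (a + b) ^ n

  -- The companion lower bound on [a, a + 1], with the slope at the left end.
  a^n+≤[1+a]^n : ∀ a n → a ^ suc n + suc n * a ^ n ≤ suc a ^ suc n
  a^n+≤[1+a]^n a zero = ≤-reflexive (cong₂ _+_ (*-identityʳ a) refl ⟨ trans ⟩ trans (+-comm a 1) (sym (*-identityʳ (suc a))))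
    where open import Function.Base using (_⟨_⟩_)
  a^n+≤[1+a]^n a (suc n) = begin
    a ^ suc (suc n) + (a ^ suc n + suc n * a ^ suc n)
      ≡⟨ cong (a ^ suc (suc n) +_) (+-comm (a ^ suc n) _) ⟩
    a ^ suc (suc n) + (suc n * a ^ suc n + a ^ suc n)
      ≡⟨ +-assoc (a ^ suc (suc n)) _ _ ⟨
    a * a ^ suc n + suc n * (a * a ^ n) + a ^ suc n
      ≡⟨ cong (λ v → a * a ^ suc n + v + a ^ suc n) (*-left-comm (suc n) a (a ^ n)) ⟩
    a * a ^ suc n + a * (suc n * a ^ n) + a ^ suc n
      ≡⟨ cong (_+ a ^ suc n) (*-distribˡ-+ a (a ^ suc n) _) ⟨
    a * (a ^ suc n + suc n * a ^ n) + a ^ suc n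
      ≤⟨ +-mono-≤ (*-monoʳ-≤ a (a^n+≤[1+a]^n a n)) (^-monoˡ-≤ (suc n) (n≤1+n a)) ⟩
    a * suc a ^ suc n + suc a ^ suc n
      ≡⟨ +-comm (a * suc a ^ suc n) _ ⟩
    suc a * suc a ^ suc n
      ∎
    where open ≤-Reasoning

  ^-distribʳ-* : ∀ n a b → (a * b) ^ n ≡ a ^ n * b ^ n
  ^-distribʳ-* zero    a b = refl
  ^-distribʳ-* (suc n) a b = trans (cong (a * b *_) (^-distribʳ-* n a b)) (interchange a b (a ^ n) (b ^ n))

  m<[1+m/n]*n : ∀ m n .{{_ : NonZero n}} → m < suc (m / n) * n
  m<[1+m/n]*n m n = begin-strict
    m                    ≡⟨ m≡m%n+[m/n]*n m n ⟩
    m % n + m / n * n    <⟨ +-monoˡ-< (m / n * n) (m%n<n m n) ⟩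
    n + m / n * n        ∎
    where open ≤-Reasoning

  raise : ∀ {n} → Vec ℕ (suc n) → Vec ℕ (suc n)
  raise (i ∷ k) = suc i ∷ k

  -- The exponent vectors of degree less than `r`; for r ≥ 1 there are binom(r + n - 1, n) of them.
  -- The two branches of the recursion are Pascal's rule.
  monomials : ∀ n → ℕ → List (Vec ℕ n)
  monomials n       zero    = []
  monomials zero    (suc r) = [] ∷ []
  monomials (suc n) (suc r) = map (0 ∷_) (monomials n (suc r)) ++ map raise (monomials (suc n) r)

  ∈-monomials : ∀ {n r} (k : Vec ℕ n) → Vec.sum k < r → k ∈ monomials n r
  ∈-monomials {zero}  {suc r} []          _        = here refl
  ∈-monomials {suc n} {suc r} (zero ∷ k)  lt       = ∈-++⁺ˡ (∈-map⁺ (0 ∷_) (∈-monomials k lt))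
  ∈-monomials {suc n} {suc r} (suc i ∷ k) (s≤s lt) =
    ∈-++⁺ʳ (map (0 ∷_) (monomials n (suc r))) (∈-map⁺ raise (∈-monomials (i ∷ k) lt))

  monomials-small : ∀ n r → All (λ k → Vec.sum k < r) (monomials n r)
  monomials-small n       zero    = []
  monomials-small zero    (suc r) = s≤s z≤n ∷ []
  monomials-small (suc n) (suc r) = All.++⁺ (All.map⁺ (monomials-small n (suc r)))
    (All.map⁺ (All.map (λ { {i ∷ k} lt → s≤s lt }) (monomials-small (suc n) r)))

  monomials-unique : ∀ n r → Unique (monomials n r)
  monomials-unique n       zero    = []
  monomials-unique zero    (suc r) = [] ∷ []
  monomials-unique (suc n) (suc r) = Unique.++⁺
    (Unique.map⁺ Vec.∷-injectiveʳ (monomials-unique n (suc r)))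
    (Unique.map⁺ (λ { {_ ∷ _} {_ ∷ _} refl → refl }) (monomials-unique (suc n) r))
    λ (p , r) → disjoint (∈-map⁻ (0 ∷_) p) (∈-map⁻ raise r)
    where
    disjoint : ∀ {v} {xs : List (Vec ℕ n)} {ys : List (Vec ℕ (suc n))} →
      ∃[ k ] k ∈ xs × v ≡ 0 ∷ k → ¬ (∃[ k ] k ∈ ys × v ≡ raise k)
    disjoint (_ , _ , refl) (_ ∷ _ , _ , ())

  length-monomials : ∀ n r → length (monomials (suc n) (suc r)) ≡
                             length (monomials n (suc r)) + length (monomials (suc n) r)
  length-monomials n r = trans (length-++ (map (0 ∷_) (monomials n (suc r))))
    (cong₂ _+_ (length-map (0 ∷_) (monomials n (suc r))) (length-map raise (monomials (suc n) r)))

  n!*length-suc : ∀ n r → suc n ! * length (monomials (suc n) (suc r)) ≡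
    suc n * (n ! * length (monomials n (suc r))) + suc n ! * length (monomials (suc n) r)
  n!*length-suc n r = trans (cong (suc n ! *_) (length-monomials n r))
    (trans (*-distribˡ-+ (suc n !) _ _) (cong (_+ suc n ! * length (monomials (suc n) r)) (*-assoc (suc n) (n !) _)))

  -- For r ≥ 1 the left side is r (r + 1) ⋯ (r + n - 1). The crude bound costs only lower order
  -- terms, which the scaling removes.
  length-monomials-≤ : ∀ n r → n ! * length (monomials n r) ≤ (r + n) ^ n
  length-monomials-≤ n       zero    = ≤-trans (≤-reflexive (*-zeroʳ (n !))) z≤n
  length-monomials-≤ zero    (suc r) = ≤-refl
  length-monomials-≤ (suc n) (suc r) = begin
    suc n ! * length (monomials (suc n) (suc r))
      ≡⟨ n!*length-suc n r ⟩
    suc n * (n ! * length (monomials n (suc r))) + suc n ! * length (monomials (suc n) r)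
      ≤⟨ +-mono-≤ (*-monoʳ-≤ (suc n) (length-monomials-≤ n (suc r))) (length-monomials-≤ (suc n) r) ⟩
    suc n * (suc r + n) ^ n + (r + suc n) ^ suc n
      ≡⟨ cong (λ v → suc n * (suc r + n) ^ n + v ^ suc n) (+-suc r n) ⟩
    suc n * (suc r + n) ^ n + (suc r + n) ^ suc n
      ≡⟨ +-comm (suc n * (suc r + n) ^ n) _ ⟩
    (suc r + n) ^ suc n + suc n * (suc r + n) ^ n
      ≤⟨ a^n+≤[1+a]^n (suc r + n) n ⟩
    suc (suc r + n) ^ suc n
      ≡⟨ cong (λ v → v ^ suc n) (+-suc (suc r) n) ⟨
    (suc r + suc n) ^ suc n
      ∎
    where open ≤-Reasoning

  -- The right side is (r + 1) ⋯ (r + n), a product of n factors of which r + 1 is the least.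
  length-monomials-≥ : ∀ n r → suc r ^ n ≤ n ! * length (monomials n (suc r))
  length-monomials-≥ zero    r = ≤-refl
  length-monomials-≥ (suc n) r = begin
    suc r ^ suc n
      ≡⟨ cong (_^ suc n) (+-comm 1 r) ⟩
    (r + 1) ^ suc n
      ≤⟨ [a+b]^n≤ r 1 n ⟩
    r ^ suc n + suc n * 1 * (r + 1) ^ n
      ≡⟨ cong₂ (λ a b → r ^ suc n + a * b ^ n) (*-identityʳ (suc n)) (+-comm r 1) ⟩
    r ^ suc n + suc n * suc r ^ n
      ≤⟨ +-mono-≤ (smaller r) (*-monoʳ-≤ (suc n) (length-monomials-≥ n r)) ⟩
    suc n ! * length (monomials (suc n) r) + suc n * (n ! * length (monomials n (suc r)))
      ≡⟨ +-comm (suc n ! * length (monomials (suc n) r)) _ ⟩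
    suc n * (n ! * length (monomials n (suc r))) + suc n ! * length (monomials (suc n) r)
      ≡⟨ n!*length-suc n r ⟨
    suc n ! * length (monomials (suc n) (suc r))
      ∎
    where
    open ≤-Reasoning
    smaller : ∀ r → r ^ suc n ≤ suc n ! * length (monomials (suc n) r)
    smaller zero    = z≤n
    smaller (suc r) = length-monomials-≥ (suc n) r

  ∑ : {A : Set} → List A → (A → ℕ) → ℕ
  ∑ xs f = sum (map f xs)

  private
    variable
      A B : Set

  ∑-mono : ∀ xs {f g : A → ℕ} → (∀ x → f x ≤ g x) → ∑ xs f ≤ ∑ xs g
  ∑-mono []       p = z≤n
  ∑-mono (x ∷ xs) p = +-mono-≤ (p x) (∑-mono xs p)

  ∑-cong : ∀ xs {f g : A → ℕ} → (∀ x → f x ≡ g x) → ∑ xs f ≡ ∑ xs g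
  ∑-cong []       p = refl
  ∑-cong (x ∷ xs) p = cong₂ _+_ (p x) (∑-cong xs p)

  ∑-zero : ∀ (xs : List A) → ∑ xs (λ _ → 0) ≡ 0
  ∑-zero []       = refl
  ∑-zero (x ∷ xs) = ∑-zero xs

  ∑-+ : ∀ xs (f g : A → ℕ) → ∑ xs (λ x → f x + g x) ≡ ∑ xs f + ∑ xs g
  ∑-+ []       f g = refl
  ∑-+ (x ∷ xs) f g = trans (cong (f x + g x +_) (∑-+ xs f g)) (+-interchange (f x) (g x) (∑ xs f) (∑ xs g))
    where open import Algebra.Properties.CommutativeSemigroup +-commutativeSemigroup
            using () renaming (interchange to +-interchange)

  ∑-*ˡ : ∀ xs c (f : A → ℕ) → ∑ xs (λ x → c * f x) ≡ c * ∑ xs f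
  ∑-*ˡ []       c f = sym (*-zeroʳ c)
  ∑-*ˡ (x ∷ xs) c f = trans (cong (c * f x +_) (∑-*ˡ xs c f)) (sym (*-distribˡ-+ c (f x) _))

  ∑-const : ∀ (xs : List A) c → ∑ xs (λ _ → c) ≡ length xs * c
  ∑-const []       c = refl
  ∑-const (x ∷ xs) c = cong (c +_) (∑-const xs c)

  ∑-swap : ∀ (xs : List A) (ys : List B) (f : A → B → ℕ) →
           ∑ xs (λ x → ∑ ys (f x)) ≡ ∑ ys (λ y → ∑ xs (λ x → f x y))
  ∑-swap []       ys f = sym (∑-zero ys)
  ∑-swap (x ∷ xs) ys f = trans (cong (∑ ys (f x) +_) (∑-swap xs ys f)) (sym (∑-+ ys (f x) _))

  ≤-average : A → ∀ xs (f : A → ℕ) → ∃[ y ] ∑ xs f ≤ length xs * f y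
  ≤-average x []       f = x , z≤n
  ≤-average x (y ∷ ys) f with ≤-average x ys f
  ... | z , le with ≤-total (f y) (f z)
  ... | inj₁ fy≤fz = z , +-mono-≤ fy≤fz le
  ... | inj₂ fz≤fy = y , +-monoʳ-≤ (f y) (≤-trans le (*-monoʳ-≤ (length ys) fz≤fy))

  ≤-∑ : ∀ {x xs} (f : A → ℕ) → x ∈ xs → f x ≤ ∑ xs f
  ≤-∑ f (here refl) = m≤m+n _ _
  ≤-∑ f (there x∈)  = ≤-trans (≤-∑ f x∈) (m≤n+m _ _)

  length-concatMap : ∀ (f : A → List B) xs → length (concatMap f xs) ≡ ∑ xs (length ∘ f)
  length-concatMap f []       = refl
  length-concatMap f (x ∷ xs) = trans (length-++ (f x)) (cong (length (f x) +_) (length-concatMap f xs))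

  -- `label` recovers from an entry the element whose block contains it, so blocks of different
  -- elements are disjoint.
  concatMap-unique : ∀ (f : A → List B) (label : B → A) xs → Unique xs →
    (∀ x → Unique (f x)) → (∀ x {y} → y ∈ f x → label y ≡ x) → Unique (concatMap f xs)
  concatMap-unique f label []       []         u l = []
  concatMap-unique f label (x ∷ xs) (x∉ ∷ uxs) u l = Unique.++⁺ (u x) (concatMap-unique f label xs uxs u l)
    λ (p , r) → absurd (find′ xs (∈-concatMap⁻ f r)) (l x p)
    where
    find′ : ∀ {y} xs → Any.Any ((y ∈_) ∘ f) xs → label y ∈ xs
    find′ (z ∷ xs) (here p)  = here (l z p)
    find′ (z ∷ xs) (there p) = there (find′ xs p)
    absurd : ∀ {y} → y ∈ xs → ¬ (y ≡ x)
    absurd y∈ refl = All.lookup x∉ y∈ refl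

  lookup-injective : ∀ {xs : List A} → Unique xs → ∀ {i j} → lookup xs i ≡ lookup xs j → i ≡ j
  lookup-injective (x∉ ∷ u) {zero}  {zero}  e = refl
  lookup-injective (x∉ ∷ u) {zero}  {suc j} e = ⊥-elim (All.lookup x∉ (∈-lookup j) e)
  lookup-injective (x∉ ∷ u) {suc i} {zero}  e = ⊥-elim (All.lookup x∉ (∈-lookup i) (sym e))
  lookup-injective (x∉ ∷ u) {suc i} {suc j} e = cong suc (lookup-injective u e)

  injection-≤ : ∀ {n} {f : Fin n → A} {xs} → (∀ {i j} → f i ≡ f j → i ≡ j) → (∀ i → f i ∈ xs) →
                n ≤ length xs
  injection-≤ {f = f} {xs} inj f∈ = Fin.injective⇒≤ {f = λ i → Any.index (f∈ i)} λ {i} {j} e →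
    inj (trans (lookup-index (f∈ i)) (trans (cong (lookup xs) e) (sym (lookup-index (f∈ j)))))

  indicator : ∀ {A : Set} → Dec A → ℕ
  indicator (yes _) = 1
  indicator (no _)  = 0

  module _ {A : Set} {P : A → Set} (P? : ∀ x → Dec (P x)) where
    length-filter : ∀ xs → length (filter P? xs) ≡ ∑ xs (λ x → indicator (P? x))
    length-filter []       = refl
    length-filter (x ∷ xs) with P? x
    ... | yes _ = cong suc (length-filter xs)
    ... | no _  = length-filter xs

  -- A discrete layer-cake formula: each layer e < T adds at most (m + 1)(e + 1)^m to the power, by
  -- `[a+b]^n≤` with b = 1. The cut-off `E` lets all directions share one range of layers.
  ⊓-power-≤ : ∀ T E m → (T ⊓ E) ^ suc m ≤ ∑ (downFrom E) (λ e → indicator (e <? T) * (suc m * suc e ^ m))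
  ⊓-power-≤ T zero    m = ≤-reflexive (cong (_^ suc m) (⊓-zeroʳ T))
  ⊓-power-≤ T (suc E) m with E <? T
  ... | yes E<T = begin
    (T ⊓ suc E) ^ suc m
      ≡⟨ cong (_^ suc m) (trans (m≥n⇒m⊓n≡n E<T) (+-comm 1 E)) ⟩
    (E + 1) ^ suc m
      ≤⟨ [a+b]^n≤ E 1 m ⟩
    E ^ suc m + suc m * 1 * (E + 1) ^ m
      ≡⟨ cong₂ (λ a b → E ^ suc m + a * b ^ m) (*-identityʳ (suc m)) (+-comm E 1) ⟩
    E ^ suc m + suc m * suc E ^ m
      ≡⟨ cong (λ v → v ^ suc m + suc m * suc E ^ m) (m≥n⇒m⊓n≡n (<⇒≤ E<T)) ⟨
    (T ⊓ E) ^ suc m + suc m * suc E ^ m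
      ≤⟨ +-monoˡ-≤ (suc m * suc E ^ m) (⊓-power-≤ T E m) ⟩
    S + suc m * suc E ^ m
      ≡⟨ +-comm S (suc m * suc E ^ m) ⟩
    suc m * suc E ^ m + S
      ≡⟨ cong (_+ S) (*-identityˡ (suc m * suc E ^ m)) ⟨
    1 * (suc m * suc E ^ m) + S
      ∎
    where
    open ≤-Reasoning
    S = ∑ (downFrom E) (λ e → indicator (e <? T) * (suc m * suc e ^ m))
  ... | no E≮T = ≤-trans (≤-reflexive (cong (_^ suc m)
      (trans (m≤n⇒m⊓n≡m (m≤n⇒m≤1+n (≮⇒≥ E≮T))) (sym (m≤n⇒m⊓n≡m (≮⇒≥ E≮T))))))
    (⊓-power-≤ T E m)

open Combinatorics

module OverField {q : ℕ} (F : FiniteField q) where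
  open FiniteField F public using (_⊕_; _⊗_; ⊖_; 1≢0; inverse; enumeration)
    renaming (Carrier to K; 0# to 0ᴷ; 1# to 1ᴷ)

  -- Iterated power series over the field

  fieldRing : Ring
  fieldRing = record { isCommutativeRing = FiniteField.isCommutativeRing F }

  private module K = CommutativeRing fieldRing

  record Algebra : Set₁ where
    field
      ring : Ring
    open CommutativeRing ring public hiding (ring; zero)
    field
      ι   : K → Carrier
      ι-+ : ∀ a b → ι (a ⊕ b) ≈ ι a + ι b
      ι-* : ∀ a b → ι (a ⊗ b) ≈ ι a * ι b
      ι-0 : ι 0ᴷ ≈ 0#
      ι-1 : ι 1ᴷ ≈ 1#

  base : Algebra
  base = record
    { ring = fieldRing ; ι = id
    ; ι-+ = λ _ _ → ≡.refl ; ι-* = λ _ _ → ≡.refl ; ι-0 = ≡.refl ; ι-1 = ≡.refl }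

  series : Algebra → Algebra
  series A = record
    { ring = powerSeries
    ; ι    = constant ∘ ι
    ; ι-+  = λ { a b zero → ι-+ a b ; a b (suc n) → sym (+-identityˡ _) }
    ; ι-*  = λ { a b zero → ι-* a b
               ; a b (suc n) → sym (trans (constant-⊠ (ι a) (constant (ι b)) (suc n)) (zeroʳ _)) }
    ; ι-0  = λ { zero → ι-0 ; (suc n) → refl }
    ; ι-1  = λ { zero → ι-1 ; (suc n) → refl }
    }
    where
    open Algebra A
    open PowerSeries ring

  _[[_]] : Algebra → ℕ → Algebra
  A [[ zero ]]  = A
  A [[ suc m ]] = series (A [[ m ]])

  module _ (A : Algebra) where
    private
      module A = Algebra A
      ∣_∣ : ℕ → Set
      ∣ m ∣ = Algebra.Carrier (A [[ m ]])

    embed : ∀ m → A.Carrier → ∣ m ∣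
    embed zero    a = a
    embed (suc m) a = PowerSeries.constant (Algebra.ring (A [[ m ]])) (embed m a)

    generator : ∀ {m} → Fin m → ∣ m ∣
    generator {suc m} zero    = PowerSeries.indeterminate (Algebra.ring (A [[ m ]]))
    generator {suc m} (suc j) = PowerSeries.constant (Algebra.ring (A [[ m ]])) (generator j)

    coef : ∀ {m} → (Fin m → ℕ) → ∣ m ∣ → A.Carrier
    coef {zero}  k g = g
    coef {suc m} k g = coef (k ∘ suc) (g (k zero))

    coef-cong : ∀ {m} (k : Fin m → ℕ) {f g : ∣ m ∣} → Algebra._≈_ (A [[ m ]]) f g → coef k f A.≈ coef k g
    coef-cong {zero}  k p = p
    coef-cong {suc m} k p = coef-cong (k ∘ suc) (p (k zero))

    coef-index : ∀ {m} {k l : Fin m → ℕ} (g : ∣ m ∣) → (∀ j → k j ≡ l j) → coef k g ≡ coef l g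
    coef-index {zero}  g k≗l = ≡.refl
    coef-index {suc m} {k} {l} g k≗l rewrite k≗l zero = coef-index (g (l zero)) (k≗l ∘ suc)

    coef-+ : ∀ {m} (k : Fin m → ℕ) (f g : ∣ m ∣) → coef k (Algebra._+_ (A [[ m ]]) f g) A.≈ coef k f A.+ coef k g
    coef-+ {zero}  k f g = A.refl
    coef-+ {suc m} k f g = coef-+ (k ∘ suc) (f (k zero)) (g (k zero))

    coef-0 : ∀ {m} (k : Fin m → ℕ) → coef k (Algebra.0# (A [[ m ]])) A.≈ A.0#
    coef-0 {zero}  k = A.refl
    coef-0 {suc m} k = coef-0 {m} (k ∘ suc)

    coef-ι* : ∀ {m} (k : Fin m → ℕ) a (g : ∣ m ∣) →
              coef k (Algebra._*_ (A [[ m ]]) (Algebra.ι (A [[ m ]]) a) g) A.≈ A.ι a A.* coef k g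
    coef-ι* {zero}  k a g = A.refl
    coef-ι* {suc m} k a g = A.trans
      (coef-cong {m} (k ∘ suc) (PowerSeries.constant-⊠ (Algebra.ring (A [[ m ]])) _ g (k zero)))
      (coef-ι* (k ∘ suc) a (g (k zero)))

  -- `Fil r x` stands for "x has order at least r". The instance of interest is the order of
  -- vanishing at a point of the line, extended to the variables of the generic vector.
  record Filtration (A : Algebra) : Set₁ where
    open Algebra A
    field
      Fil      : ℕ → Carrier → Set
      Fil-resp : ∀ {r x y} → x ≈ y → Fil r x → Fil r y
      Fil-0    : ∀ {r} → Fil r 0#
      Fil-ι    : ∀ a → Fil 0 (ι a)
      Fil-+    : ∀ {r x y} → Fil r x → Fil r y → Fil r (x + y)
      Fil-*    : ∀ {r s x y} → Fil r x → Fil s y → Fil (r ℕ.+ s) (x * y)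
      Fil-anti : ∀ {r s x} → r ℕ.≤ s → Fil s x → Fil r x

  +∸≤+∸ : ∀ r s x → (r ℕ.+ s) ℕ.∸ x ℕ.≤ r ℕ.+ (s ℕ.∸ x)
  +∸≤+∸ r s x = ℕ.m≤n+o⇒m∸n≤o (r ℕ.+ s) x (begin
    r ℕ.+ s                  ≤⟨ ℕ.+-monoʳ-≤ r (ℕ.m≤n+m∸n s x) ⟩
    r ℕ.+ (x ℕ.+ (s ℕ.∸ x))  ≡⟨ x∙yz≈y∙xz r x (s ℕ.∸ x) ⟩
    x ℕ.+ (r ℕ.+ (s ℕ.∸ x))  ∎)
    where
    open ℕ.≤-Reasoning
    open import Algebra.Properties.CommutativeSemigroup ℕ.+-commutativeSemigroup using (x∙yz≈y∙xz)

  -- In the lifted filtration the new indeterminate has order ω.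
  liftFiltration : ∀ {A} → ℕ → Filtration A → Filtration (series A)
  liftFiltration {A} ω 𝓕 = record
    { Fil      = Fil′
    ; Fil-resp = λ p x n → Fil-resp (p n) (x n)
    ; Fil-0    = λ n → Fil-0
    ; Fil-ι    = λ { a zero → Fil-ι a ; a (suc n) → Fil-0 }
    ; Fil-+    = λ x y n → Fil-+ (x n) (y n)
    ; Fil-*    = mul
    ; Fil-anti = λ r≤s x n → Fil-anti (ℕ.∸-monoˡ-≤ (n ℕ.* ω) r≤s) (x n)
    }
    where
    open Algebra A
    open PowerSeries ring
    open Filtration 𝓕
    Fil′ : ℕ → PS → Set
    Fil′ r f = ∀ n → Fil (r ℕ.∸ n ℕ.* ω) (f n)
    mul : ∀ {r s f g} → Fil′ r f → Fil′ s g → Fil′ (r ℕ.+ s) (f ⊠ g)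
    mul {r} {s} x y zero    = Fil-* (x 0) (y 0)
    mul {r} {s} {f} {g} x y (suc n) = Fil-+
      (Fil-anti (+∸≤+∸ r s (suc n ℕ.* ω)) (Fil-* (x 0) (y (suc n))))
      -- The tail of `f` is `f` without its constant term, divided by the indeterminate; its order
      -- is therefore `r ∸ ω`.
      (Fil-anti (begin
         (r ℕ.+ s) ℕ.∸ (ω ℕ.+ n ℕ.* ω)  ≡⟨ ℕ.∸-+-assoc (r ℕ.+ s) ω (n ℕ.* ω) ⟨
         (r ℕ.+ s) ℕ.∸ ω ℕ.∸ n ℕ.* ω    ≡⟨ ≡.cong (λ v → v ℕ.∸ ω ℕ.∸ n ℕ.* ω) (ℕ.+-comm r s) ⟩
         (s ℕ.+ r) ℕ.∸ ω ℕ.∸ n ℕ.* ω    ≤⟨ ℕ.∸-monoˡ-≤ (n ℕ.* ω) (+∸≤+∸ s r ω) ⟩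
         s ℕ.+ (r ℕ.∸ ω) ℕ.∸ n ℕ.* ω    ≡⟨ ≡.cong (ℕ._∸ n ℕ.* ω) (ℕ.+-comm s (r ℕ.∸ ω)) ⟩
         (r ℕ.∸ ω) ℕ.+ s ℕ.∸ n ℕ.* ω    ∎)
        (mul {r ℕ.∸ ω} {s} (λ i → subst (λ v → Fil v (f (suc i))) (≡.sym (ℕ.∸-+-assoc r ω (i ℕ.* ω))) (x (suc i)))
             y n))
      where open ℕ.≤-Reasoning

  iterFiltration : ∀ {A} → ℕ → Filtration A → ∀ m → Filtration (A [[ m ]])
  iterFiltration ω 𝓕 zero    = 𝓕
  iterFiltration ω 𝓕 (suc m) = liftFiltration ω (iterFiltration ω 𝓕 m)

  total : ∀ {m} → (Fin m → ℕ) → ℕ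
  total {zero}  k = 0
  total {suc m} k = k zero ℕ.+ total (k ∘ suc)

  module _ {A : Algebra} (ω : ℕ) (𝓕 : Filtration A) where
    open Filtration

    -- Each variable of the extracted monomial takes its weight ω away. With ω = 1 at t ≠ 0 and ω =
    -- 0 at t = 0 this becomes the loss of (q - 1)|k| zeros.
    coef-Fil : ∀ {m r g} (k : Fin m → ℕ) → Fil (iterFiltration ω 𝓕 m) r g →
               Fil 𝓕 (r ℕ.∸ total k ℕ.* ω) (coef A k g)
    coef-Fil {zero}  k x = x
    coef-Fil {suc m} {r} {g} k x =
      subst (λ v → Fil 𝓕 v (coef A k g))
        (≡.trans (ℕ.∸-+-assoc r (k zero ℕ.* ω) _)
          (≡.cong (r ℕ.∸_) (≡.sym (ℕ.*-distribʳ-+ ω (k zero) (total (k ∘ suc))))))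
        (coef-Fil (k ∘ suc) (x (k zero)))

    embed-Fil : ∀ m {r a} → Fil 𝓕 r a → Fil (iterFiltration ω 𝓕 m) r (embed A m a)
    embed-Fil zero    x         = x
    embed-Fil (suc m) x zero    = embed-Fil m x
    embed-Fil (suc m) x (suc n) = Fil-0 (iterFiltration ω 𝓕 m)

    generator-Fil : ∀ {m} (j : Fin m) → Fil (iterFiltration ω 𝓕 m) ω (generator A j)
    generator-Fil {suc m} zero zero = Fil-0 (iterFiltration ω 𝓕 m)
    generator-Fil {suc m} zero (suc zero) = Fil-anti 𝓖 (ℕ.≤-reflexive
      (≡.trans (≡.cong (ω ℕ.∸_) (ℕ.+-identityʳ ω)) (ℕ.n∸n≡0 ω)))
      (Fil-resp 𝓖 (Algebra.ι-1 (A [[ m ]])) (Fil-ι 𝓖 1ᴷ))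
      where 𝓖 = iterFiltration ω 𝓕 m
    generator-Fil {suc m} zero (suc (suc n)) = Fil-0 (iterFiltration ω 𝓕 m)
    generator-Fil {suc m} (suc j) zero    = generator-Fil j
    generator-Fil {suc m} (suc j) (suc n) = Fil-0 (iterFiltration ω 𝓕 m)

  -- `top D` is the coefficient of degree D, an algebra map on leading terms.
  record Grading (A B : Algebra) : Set₁ where
    private
      module A = Algebra A
      module B = Algebra B
    field
      Low        : ℕ → A.Carrier → Set
      top        : ℕ → A.Carrier → B.Carrier
      Low-resp   : ∀ {D x y} → x A.≈ y → Low D x → Low D y
      Low-0      : ∀ {D} → Low D A.0#
      Low-ι      : ∀ a → Low 0 (A.ι a)
      Low-+      : ∀ {D x y} → Low D x → Low D y → Low D (x A.+ y)
      Low-*      : ∀ {D E x y} → Low D x → Low E y → Low (D ℕ.+ E) (x A.* y)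
      Low-mono   : ∀ {D E x} → D ℕ.≤ E → Low D x → Low E x
      top-cong   : ∀ {D x y} → x A.≈ y → top D x B.≈ top D y
      top-0      : ∀ {D} → top D A.0# B.≈ B.0#
      top-ι      : ∀ a → top 0 (A.ι a) B.≈ B.ι a
      top-+      : ∀ D x y → top D (x A.+ y) B.≈ top D x B.+ top D y
      top-*      : ∀ {D E x y} → Low D x → Low E y → top (D ℕ.+ E) (x A.* y) B.≈ top D x B.* top E y
      top-vanish : ∀ {D E x} → D ℕ.< E → Low D x → top E x B.≈ B.0#

  -- The new indeterminate has degree 0: only the degree in t is measured, and both the bound and
  -- `top` act on each coefficient separately.
  liftGrading : ∀ {A B} → Grading A B → Grading (series A) (series B)
  liftGrading {A} {B} 𝓖 = record
    { Low        = λ D f → ∀ n → Low D (f n)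
    ; top        = λ D f n → top D (f n)
    ; Low-resp   = λ p x n → Low-resp (p n) (x n)
    ; Low-0      = λ n → Low-0
    ; Low-ι      = λ { a zero → Low-ι a ; a (suc n) → Low-0 }
    ; Low-+      = λ x y n → Low-+ (x n) (y n)
    ; Low-*      = low-*
    ; Low-mono   = λ p x n → Low-mono p (x n)
    ; top-cong   = λ p n → top-cong (p n)
    ; top-0      = λ n → top-0
    ; top-ι      = λ { a zero → top-ι a ; a (suc n) → top-0 }
    ; top-+      = λ D x y n → top-+ D (x n) (y n)
    ; top-*      = t-*
    ; top-vanish = λ p x n → top-vanish p (x n)
    }
    where
    open Grading 𝓖
    module B = Algebra B
    module SA = PowerSeries (Algebra.ring A)
    module SB = PowerSeries (Algebra.ring B)
    low-* : ∀ {D E f g} → (∀ n → Low D (f n)) → (∀ n → Low E (g n)) →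
            ∀ n → Low (D ℕ.+ E) ((f SA.⊠ g) n)
    low-* x y zero    = Low-* (x 0) (y 0)
    low-* x y (suc n) = Low-+ (Low-* (x 0) (y (suc n))) (low-* (x ∘ suc) y n)
    t-* : ∀ {D E f g} → (∀ n → Low D (f n)) → (∀ n → Low E (g n)) →
          ∀ n → top (D ℕ.+ E) ((f SA.⊠ g) n) B.≈ ((top D ∘ f) SB.⊠ (top E ∘ g)) n
    t-* x y zero    = top-* (x 0) (y 0)
    t-* x y (suc n) = B.trans (top-+ _ _ _) (B.+-cong (top-* (x 0) (y (suc n))) (t-* (x ∘ suc) y n))

  iterGrading : ∀ {A B} → Grading A B → ∀ m → Grading (A [[ m ]]) (B [[ m ]])
  iterGrading 𝓖 zero    = 𝓖
  iterGrading 𝓖 (suc m) = liftGrading (iterGrading 𝓖 m)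

  module _ {A B : Algebra} (𝓖 : Grading A B) where
    open Grading
    private module B = Algebra B

    coef-Low : ∀ {m D g} (k : Fin m → ℕ) → Low (iterGrading 𝓖 m) D g → Low 𝓖 D (coef A k g)
    coef-Low {zero}  k x = x
    coef-Low {suc m} k x = coef-Low (k ∘ suc) (x (k zero))

    coef-top : ∀ {m} D (k : Fin m → ℕ) g →
               coef B k (top (iterGrading 𝓖 m) D g) ≡ top 𝓖 D (coef A k g)
    coef-top {zero}  D k g = ≡.refl
    coef-top {suc m} D k g = coef-top D (k ∘ suc) (g (k zero))

    embed-Low : ∀ m {D a} → Low 𝓖 D a → Low (iterGrading 𝓖 m) D (embed A m a)
    embed-Low zero    x         = x
    embed-Low (suc m) x zero    = embed-Low m x
    embed-Low (suc m) x (suc n) = Low-0 (iterGrading 𝓖 m)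

    top-embed : ∀ m D a → Algebra._≈_ (B [[ m ]]) (top (iterGrading 𝓖 m) D (embed A m a))
                                                 (embed B m (top 𝓖 D a))
    top-embed zero    D a         = B.refl
    top-embed (suc m) D a zero    = top-embed m D a
    top-embed (suc m) D a (suc n) = top-0 (iterGrading 𝓖 m)

    generator-Low : ∀ {m} (j : Fin m) → Low (iterGrading 𝓖 m) 0 (generator A j)
    generator-Low {suc m} zero zero = Low-0 (iterGrading 𝓖 m)
    generator-Low {suc m} zero (suc zero) =
      Low-resp (iterGrading 𝓖 m) (Algebra.ι-1 (A [[ m ]])) (Low-ι (iterGrading 𝓖 m) 1ᴷ)
    generator-Low {suc m} zero (suc (suc n)) = Low-0 (iterGrading 𝓖 m)
    generator-Low {suc m} (suc j) zero    = generator-Low j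
    generator-Low {suc m} (suc j) (suc n) = Low-0 (iterGrading 𝓖 m)

    top-generator : ∀ {m} (j : Fin m) → Algebra._≈_ (B [[ m ]])
                      (top (iterGrading 𝓖 m) 0 (generator A j)) (generator B j)
    top-generator {suc m} zero zero = top-0 (iterGrading 𝓖 m)
    top-generator {suc m} zero (suc zero) = B′.trans
      (top-cong 𝓜 (Algebra.sym (A [[ m ]]) (Algebra.ι-1 (A [[ m ]]))))
      (B′.trans (top-ι 𝓜 1ᴷ) B′.ι-1)
      where
      𝓜 = iterGrading 𝓖 m
      module B′ = Algebra (B [[ m ]])
    top-generator {suc m} zero (suc (suc n)) = top-0 (iterGrading 𝓖 m)
    top-generator {suc m} (suc j) zero    = top-generator j
    top-generator {suc m} (suc j) (suc n) = top-0 (iterGrading 𝓖 m)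

  embed-1 : ∀ A m → Algebra._≈_ (A [[ m ]]) (embed A m (Algebra.1# A)) (Algebra.1# (A [[ m ]]))
  embed-1 A zero            = Algebra.refl A
  embed-1 A (suc m) zero    = embed-1 A m
  embed-1 A (suc m) (suc n) = Algebra.refl (A [[ m ]])

  -- Univariate series with coefficients in K, graded by degree.
  degreeGrading : Grading (series base) base
  degreeGrading = record
    { Low        = Low
    ; top        = λ D f → f D
    ; Low-resp   = λ p x i D<i → ≡.trans (≡.sym (p i)) (x i D<i)
    ; Low-0      = λ _ _ → ≡.refl
    ; Low-ι      = λ { a (suc i) _ → ≡.refl }
    ; Low-+      = λ x y i D<i → ≡.trans (≡.cong₂ _⊕_ (x i D<i) (y i D<i)) (+-identityˡ 0ᴷ)
    ; Low-*      = low-*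
    ; Low-mono   = λ p x i q → x i (ℕ.≤-<-trans p q)
    ; top-cong   = λ p → p _
    ; top-0      = ≡.refl
    ; top-ι      = λ _ → ≡.refl
    ; top-+      = λ _ _ _ → ≡.refl
    ; top-*      = top-*
    ; top-vanish = λ p x → x _ p
    }
    where
    open CommutativeRing fieldRing using (+-identityˡ; +-identityʳ; zeroʳ)
    open PowerSeries fieldRing
    Low : ℕ → PS → Set
    Low D f = ∀ i → D ℕ.< i → f i ≡ 0ᴷ
    low-* : ∀ {D E f g} → Low D f → Low E g → Low (D ℕ.+ E) (f ⊠ g)
    low-* {zero} {E} {f} {g} x y (suc n) (ℕ.s≤s p) =
      ≡.trans (≡.cong₂ _⊕_ (≡.trans (≡.cong (f 0 ⊗_) (y (suc n) (ℕ.s≤s p))) (zeroʳ _))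
                           (⊠-zeroˡ g (λ i → x (suc i) (ℕ.s≤s ℕ.z≤n)) n))
              (+-identityˡ 0ᴷ)
    low-* {suc D} {E} {f} {g} x y (suc n) (ℕ.s≤s p) =
      ≡.trans (≡.cong₂ _⊕_
          (≡.trans (≡.cong (f 0 ⊗_) (y (suc n) (ℕ.s≤s (ℕ.≤-trans (ℕ.m≤n+m E (suc D)) p)))) (zeroʳ _))
          (low-* {D} (λ i q → x (suc i) (ℕ.s≤s q)) y n p))
        (+-identityˡ 0ᴷ)
    top-* : ∀ {D E f g} → Low D f → Low E g → (f ⊠ g) (D ℕ.+ E) ≡ f D ⊗ g E
    top-* {zero} {zero}  {f} {g} x y = ≡.refl
    top-* {zero} {suc E} {f} {g} x y =
      ≡.trans (≡.cong (_ ⊕_) (⊠-zeroˡ g (λ i → x (suc i) (ℕ.s≤s ℕ.z≤n)) E)) (+-identityʳ _)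
    top-* {suc D} {E} {f} {g} x y =
      ≡.trans (≡.cong₂ _⊕_
          (≡.trans (≡.cong (f 0 ⊗_) (y (suc (D ℕ.+ E)) (ℕ.s≤s (ℕ.m≤n+m E D)))) (zeroʳ _))
          (top-* {D} (λ i q → x (suc i) (ℕ.s≤s q)) y))
        (+-identityˡ _)

  -- Roots with multiplicity

  module RootCount where
    open Algebra (series base)
    open Grading degreeGrading
    open import Algebra.Properties.CommutativeSemiring.Exp commutativeSemiring using (_^_; ^-homo-*)
    open import Algebra.Properties.Ring (CommutativeRing.ring ring)
      using (-‿distribʳ-*)
    open import Algebra.Properties.Group +-group using () renaming (x∙y⁻¹≈ε⇒x≈y to x-y≈0⇒x≈y)
    open import Algebra.Properties.Group (CommutativeRing.+-group fieldRing)
      using () renaming (x∙y⁻¹≈ε⇒x≈y to Kx-y≈0⇒x≈y)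
    import Algebra.Properties.Ring (CommutativeRing.ring fieldRing) as KP
    open import Algebra.Properties.CommutativeSemigroup *-commutativeSemigroup
      using (x∙yz≈y∙xz; interchange)
    open PowerSeries fieldRing using (indeterminate; indeterminate-⊠; constant-⊠)
    open import Relation.Binary.Reasoning.Setoid setoid

    -- Polynomials are power series with a degree bound. The bound matters: for a ≠ 0 the series X -
    -- a is invertible, so divisibility by its powers has content only when the cofactor is a
    -- polynomial.
    Poly : Carrier → Set
    Poly f = ∃[ D ] Low D f

    Poly-0 : Poly 0#
    Poly-0 = 0 , Low-0 {0}

    Poly-ι : ∀ a → Poly (ι a)
    Poly-ι a = 0 , Low-ι a

    Poly-+ : ∀ {f g} → Poly f → Poly g → Poly (f + g)
    Poly-+ {f} {g} (D , x) (E , y) = D ℕ.⊔ E ,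
      Low-+ {D ℕ.⊔ E} {f} {g} (Low-mono {D} {D ℕ.⊔ E} {f} (ℕ.m≤m⊔n D E) x)
                              (Low-mono {E} {D ℕ.⊔ E} {g} (ℕ.m≤n⊔m D E) y)

    Poly-* : ∀ {f g} → Poly f → Poly g → Poly (f * g)
    Poly-* {f} {g} (D , x) (E , y) = D ℕ.+ E , Low-* {D} {E} {f} {g} x y

    Poly-neg : ∀ {f} → Poly f → Poly (- f)
    Poly-neg (D , x) = D , λ i D<i → ≡.trans (≡.cong ⊖_ (x i D<i)) KP.-0#≈0#

    X-_ : K → Carrier
    X- a = indeterminate + ι (⊖ a)

    X-Low : ∀ a → Low 1 (X- a)
    X-Low a (suc (suc i)) _ = K.+-identityˡ 0ᴷ
    X-Low a (suc zero) (ℕ.s≤s ())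

    Poly-X- : ∀ a → Poly (X- a)
    Poly-X- a = 1 , X-Low a

    Poly-^ : ∀ {f} → Poly f → ∀ n → Poly (f ^ n)
    Poly-^ p zero    = Poly-ι 1ᴷ
    Poly-^ {f} p (suc n) = Poly-* {f} {f ^ n} p (Poly-^ p n)

    X-⊠ : ∀ a f i → ((X- a) * f) (suc i) ≡ f i ⊕ (⊖ a) ⊗ f (suc i)
    X-⊠ a f i = ≡.trans (distribʳ f indeterminate (ι (⊖ a)) (suc i))
      (≡.cong₂ _⊕_ (indeterminate-⊠ f i) (constant-⊠ (⊖ a) f (suc i)))

    Below : ℕ → Carrier → Set
    Below n f = ∀ i → n ℕ.≤ i → f i ≡ 0ᴷ

    -- Coefficient i + 1 of (X - a) f is f i - a f (i + 1), so a zero of f at i + 1 passes down to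
    -- i. The descent starts above the degree bound of f. At n = 0 this is the cancellation of X -
    -- a.
    X-descend : ∀ a {f n} → Poly f → Below n ((X- a) * f) → Below (n ℕ.∸ 1) f
    X-descend a {f} {n} (D , x) z i n≤i = go (suc D) i n≤i (ℕ.m≤n+m (suc D) i)
      where
      go : ∀ j i → n ℕ.∸ 1 ℕ.≤ i → D ℕ.< i ℕ.+ j → f i ≡ 0ᴷ
      go zero    i _   D<i = x i (subst (D ℕ.<_) (ℕ.+-identityʳ i) D<i)
      go (suc j) i n≤i D<i = ≡.trans (≡.sym (≡.trans (≡.cong (λ v → f i ⊕ (⊖ a) ⊗ v) fi+1≡0)
          (≡.trans (≡.cong (f i ⊕_) (K.zeroʳ _)) (K.+-identityʳ _))))
        (≡.trans (≡.sym (X-⊠ a f i)) (z (suc i) (ℕ.≤-trans (ℕ.m≤n+m∸n n 1) (ℕ.s≤s n≤i))))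
        where
        fi+1≡0 : f (suc i) ≡ 0ᴷ
        fi+1≡0 = go j (suc i) (ℕ.m≤n⇒m≤1+n n≤i) (subst (D ℕ.<_) (ℕ.+-suc i j) D<i)

    ^-descend : ∀ a m {f n} → Poly f → Below n ((X- a) ^ m * f) → Below (n ℕ.∸ m) f
    ^-descend a zero    {f} {n} p z i n≤i = ≡.trans (≡.sym (*-identityˡ f i)) (z i n≤i)
    ^-descend a (suc m) {f} {n} p z = subst (λ v → Below v f) (ℕ.∸-+-assoc n 1 m)
      (^-descend a m p (X-descend a (Poly-* {(X- a) ^ m} {f} (Poly-^ (Poly-X- a) m) p)
        (λ i n≤i → ≡.trans (≡.sym (*-assoc (X- a) ((X- a) ^ m) f i)) (z i n≤i))))

    X-cancel : ∀ a {f g} → Poly f → Poly g → (X- a) * f ≈ (X- a) * g → f ≈ g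
    X-cancel a {f} {g} p r e = x-y≈0⇒x≈y f g
      (λ i → X-descend a {f + (- g)} {0} (Poly-+ {f} { - g} p (Poly-neg {g} r)) (λ j _ → zero′ j) i ℕ.z≤n)
      where
      zero′ : (X- a) * (f + (- g)) ≈ 0#
      zero′ = begin
        (X- a) * (f + (- g))                ≈⟨ distribˡ (X- a) f (- g) ⟩
        (X- a) * f + (X- a) * (- g)         ≈⟨ +-cong e (sym (-‿distribʳ-* (X- a) g)) ⟩
        (X- a) * g + (- ((X- a) * g))       ≈⟨ -‿inverseʳ ((X- a) * g) ⟩
        0#                                  ∎

    -- (X − a) (f − g) = (a − b) g whenever (X − a) f = (X − b) g.
    X-split : ∀ {a b f g} → a ≢ b → Poly f → Poly g → (X- a) * f ≈ (X- b) * g →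
              ∃[ r ] Poly r × g ≈ (X- a) * r × f ≈ (X- b) * r
    X-split {a} {b} {f} {g} a≢b p s e = r , pr , g≈ , X-cancel a p (Poly-* {X- b} {r} (Poly-X- b) pr)
        (begin
          (X- a) * f              ≈⟨ e ⟩
          (X- b) * g              ≈⟨ *-congˡ {X- b} g≈ ⟩
          (X- b) * ((X- a) * r)   ≈⟨ x∙yz≈y∙xz (X- b) (X- a) r ⟩
          (X- a) * ((X- b) * r)   ∎)
      where
      d = a ⊕ (⊖ b)
      d≢0 : d ≢ 0ᴷ
      d≢0 = a≢b ∘ Kx-y≈0⇒x≈y a b
      c = proj₁ (inverse d d≢0)
      r = ι c * (f + (- g))
      pr : Poly r
      pr = Poly-* {ι c} {f + (- g)} (Poly-ι c) (Poly-+ {f} { - g} p (Poly-neg {g} s))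
      shift : (X- b) ≈ (X- a) + ι d
      shift = begin
        indeterminate + ι (⊖ b)                ≈⟨ +-congˡ {indeterminate} (ι-cong (≡.sym
                                                   (≡.trans (≡.sym (K.+-assoc (⊖ a) a (⊖ b)))
                                                   (≡.trans (≡.cong (_⊕ (⊖ b)) (K.-‿inverseˡ a)) (K.+-identityˡ _))))) ⟩
        indeterminate + ι ((⊖ a) ⊕ d)          ≈⟨ +-congˡ {indeterminate} (ι-+ (⊖ a) d) ⟩
        indeterminate + (ι (⊖ a) + ι d)        ≈⟨ +-assoc indeterminate (ι (⊖ a)) (ι d) ⟨
        (X- a) + ι d                           ∎
        where
        ι-cong : ∀ {x y} → x ≡ y → ι x ≈ ι y
        ι-cong ≡.refl = refl {ι _}
      step : (X- a) * (f + (- g)) ≈ ι d * g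
      step = begin
        (X- a) * (f + (- g))                              ≈⟨ distribˡ (X- a) f (- g) ⟩
        (X- a) * f + (X- a) * (- g)                       ≈⟨ +-cong e (sym (-‿distribʳ-* (X- a) g)) ⟩
        (X- b) * g + (- ((X- a) * g))                     ≈⟨ +-congʳ {_} {(X- b) * g} (trans (*-congʳ {g} shift) (distribʳ g (X- a) (ι d))) ⟩
        (X- a) * g + ι d * g + (- ((X- a) * g))           ≈⟨ +-congʳ { - ((X- a) * g)} (+-comm ((X- a) * g) (ι d * g)) ⟩
        ι d * g + (X- a) * g + (- ((X- a) * g))           ≈⟨ +-assoc (ι d * g) _ _ ⟩
        ι d * g + ((X- a) * g + (- ((X- a) * g)))         ≈⟨ +-congˡ {ι d * g} (-‿inverseʳ ((X- a) * g)) ⟩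
        ι d * g + 0#                                      ≈⟨ +-identityʳ (ι d * g) ⟩
        ι d * g                                           ∎
      g≈ : g ≈ (X- a) * r
      g≈ = begin
        g                                   ≈⟨ *-identityˡ g ⟨
        ι 1ᴷ * g                            ≈⟨ *-congʳ {g} {ι 1ᴷ} {ι (c ⊗ d)} (≡⇒≈ (≡.sym (≡.trans (K.*-comm c d) (proj₂ (inverse d d≢0))))) ⟩
        ι (c ⊗ d) * g                       ≈⟨ *-congʳ {g} (ι-* c d) ⟩
        ι c * ι d * g                       ≈⟨ *-assoc (ι c) (ι d) g ⟩
        ι c * (ι d * g)                     ≈⟨ *-congˡ {ι c} step ⟨
        ι c * ((X- a) * (f + (- g)))        ≈⟨ x∙yz≈y∙xz (ι c) (X- a) (f + (- g)) ⟩
        (X- a) * r                          ∎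
        where
        ≡⇒≈ : ∀ {x y} → x ≡ y → ι x ≈ ι y
        ≡⇒≈ ≡.refl = refl {ι _}

    Divides : K → ℕ → Carrier → Set
    Divides a m g = ∃[ x ] Poly x × g ≈ (X- a) ^ m * x

    -- Coprimality of X - a and X - b, one factor at a time: `X-split` takes X - a out of g and X -
    -- b out of (X - a)^m x, which leaves the same situation with exponent m.
    Divides-cofactor : ∀ {a b} → a ≢ b → ∀ m {g} → Poly g → Divides a m ((X- b) * g) → Divides a m g
    Divides-cofactor a≢b zero {g} p _ = g , p , sym (*-identityˡ g)
    Divides-cofactor {a} {b} a≢b (suc m) {g} p (x , px , e) =
      let r , pr , g≈ , f≈ = X-split {a} {b} {(X- a) ^ m * x} {g} a≢b
            (Poly-* {(X- a) ^ m} {x} (Poly-^ (Poly-X- a) m) px) p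
            (trans (sym (*-assoc (X- a) ((X- a) ^ m) x)) (sym e))
          y , py , r≈ = Divides-cofactor a≢b m {r} pr (x , px , sym f≈)
      in y , py , trans g≈ (trans (*-congˡ {X- a} r≈) (sym (*-assoc (X- a) ((X- a) ^ m) y)))

    Divides-cofactor-^ : ∀ {a b} → a ≢ b → ∀ m n {g} → Poly g → Divides a m ((X- b) ^ n * g) → Divides a m g
    Divides-cofactor-^ a≢b m zero {g} p (x , px , e) = x , px , trans (sym (*-identityˡ g)) e
    Divides-cofactor-^ {a} {b} a≢b m (suc n) {g} p (x , px , e) =
      Divides-cofactor-^ a≢b m n p
        (Divides-cofactor a≢b m (Poly-* {(X- b) ^ n} {g} (Poly-^ (Poly-X- b) n) p)
          (x , px , trans (sym (*-assoc (X- b) ((X- b) ^ n) g)) e))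

    module _ (m : K → ℕ) where
      rootProduct : List K → Carrier
      rootProduct []       = 1#
      rootProduct (t ∷ ts) = (X- t) ^ m t * rootProduct ts

      Poly-rootProduct : ∀ ts → Poly (rootProduct ts)
      Poly-rootProduct []       = Poly-ι 1ᴷ
      Poly-rootProduct (t ∷ ts) =
        Poly-* {(X- t) ^ m t} {rootProduct ts} (Poly-^ (Poly-X- t) (m t)) (Poly-rootProduct ts)

      Divides-rootProduct : ∀ {a} ts → All (a ≢_) ts → ∀ {g} → Poly g →
        Divides a (m a) (rootProduct ts * g) → Divides a (m a) g
      Divides-rootProduct [] [] {g} p (x , px , e) = x , px , trans (sym (*-identityˡ g)) e
      Divides-rootProduct {a} (t ∷ ts) (a≢t ∷ a≢ts) {g} p (x , px , e) =
        Divides-rootProduct ts a≢ts p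
          (Divides-cofactor-^ a≢t (m a) (m t) (Poly-* {rootProduct ts} {g} (Poly-rootProduct ts) p)
            (x , px , trans (sym (*-assoc ((X- t) ^ m t) (rootProduct ts) g)) e))

      factor-roots : ∀ {g} → Poly g → ∀ ts → Unique ts → (∀ t → Divides t (m t) g) →
                     ∃[ y ] Poly y × g ≈ rootProduct ts * y
      factor-roots {g} p [] [] d = g , p , sym (*-identityˡ g)
      factor-roots {g} p (t ∷ ts) (t≢ ∷ u) d =
        let y , py , g≈ = factor-roots p ts u d
            x , px , g≈′ = d t
            z , pz , y≈ = Divides-rootProduct ts t≢ py (x , px , trans (sym g≈) g≈′)
        in z , pz , (begin
          g                                             ≈⟨ g≈ ⟩
          rootProduct ts * y                            ≈⟨ *-congˡ {rootProduct ts} y≈ ⟩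
          rootProduct ts * ((X- t) ^ m t * z)           ≈⟨ x∙yz≈y∙xz (rootProduct ts) ((X- t) ^ m t) z ⟩
          (X- t) ^ m t * (rootProduct ts * z)           ≈⟨ *-assoc ((X- t) ^ m t) (rootProduct ts) z ⟨
          rootProduct (t ∷ ts) * z                      ∎)

      rootProduct-descend : ∀ ts {n y} → Poly y → Below n (rootProduct ts * y) →
                            Below (n ℕ.∸ sum (map m ts)) y
      rootProduct-descend [] {n} {y} p z i n≤i = ≡.trans (≡.sym (*-identityˡ y i)) (z i n≤i)
      rootProduct-descend (t ∷ ts) {n} {y} p z =
        subst (λ v → Below v y) (ℕ.∸-+-assoc n (m t) (sum (map m ts)))
          (rootProduct-descend ts p
            (^-descend t (m t) (Poly-* {rootProduct ts} {y} (Poly-rootProduct ts) p)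
              (λ i n≤i → ≡.trans (≡.sym (*-assoc ((X- t) ^ m t) (rootProduct ts) y i)) (z i n≤i))))

      -- After the powers of X - t for all t in the list are divided out, the degree of the cofactor
      -- would be less than D + 1 minus the number of roots, that is less than 0, so the cofactor is
      -- zero.
      too-many-roots : ∀ {g D} → Low D g → ∀ ts → Unique ts → (∀ t → Divides t (m t) g) →
                       D ℕ.< sum (map m ts) → g ≈ 0#
      too-many-roots {g} {D} low ts u d D<Σ =
        let y , py , g≈ = factor-roots {g} (D , low) ts u d
            y≈0 : y ≈ 0#
            y≈0 i = rootProduct-descend ts {suc D} py
              (λ j D<j → ≡.trans (≡.sym (g≈ j)) (low j D<j)) i
              (subst (ℕ._≤ i) (≡.sym (ℕ.m≤n⇒m∸n≡0 D<Σ)) ℕ.z≤n)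
        in trans g≈ (trans (*-congˡ {rootProduct ts} y≈0) (zeroʳ (rootProduct ts)))

    rootFiltration : K → Filtration (series base)
    rootFiltration a = record
      { Fil      = Divides a
      ; Fil-resp = λ p (x , px , e) → x , px , trans (sym p) e
      ; Fil-0    = λ {r} → 0# , Poly-0 , sym (zeroʳ ((X- a) ^ r))
      ; Fil-ι    = λ b → ι b , Poly-ι b , sym (*-identityˡ (ι b))
      ; Fil-+    = λ {r} (x , px , e) (y , py , f) → x + y , Poly-+ {x} {y} px py ,
                     trans (+-cong e f) (sym (distribˡ ((X- a) ^ r) x y))
      ; Fil-*    = λ {r} {s} (x , px , e) (y , py , f) → x * y , Poly-* {x} {y} px py ,
                     trans (*-cong e f) (trans (interchange ((X- a) ^ r) x ((X- a) ^ s) y)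
                       (*-congʳ {x * y} (sym (^-homo-* (X- a) r s))))
      ; Fil-anti = λ {r} {s} r≤s (x , px , e) →
          (X- a) ^ (s ℕ.∸ r) * x ,
          Poly-* {(X- a) ^ (s ℕ.∸ r)} {x} (Poly-^ (Poly-X- a) (s ℕ.∸ r)) px ,
          trans e (trans (*-congʳ {x} (trans (≡⇒≈ (≡.cong ((X- a) ^_) (≡.sym (ℕ.m+[n∸m]≡n r≤s))))
                                             (^-homo-* (X- a) r (s ℕ.∸ r))))
                         (*-assoc ((X- a) ^ r) ((X- a) ^ (s ℕ.∸ r)) x))
      }
      where
      ≡⇒≈ : ∀ {x y} → x ≡ y → x ≈ y
      ≡⇒≈ ≡.refl = λ _ → ≡.refl

  -- Polynomials, evaluation and leading monomials

  -- Expressions are written once over bare operations and then read in nested lists of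
  -- coefficients, in `K` and in power series rings; homomorphisms carry one reading to another.
  record Operations : Set₁ where
    infixl 6 _+_
    infixl 7 _*_
    field
      Carrier : Set
      _+_ _*_ : Carrier → Carrier → Carrier
      ι       : K → Carrier

  operations : Algebra → Operations
  operations A = record { Algebra A }

  -- No laws are imposed on nested lists of coefficients: only evaluation matters.
  polynomial : ℕ → Operations
  polynomial zero    = record { Carrier = K ; _+_ = _⊕_ ; _*_ = _⊗_ ; ι = id }
  polynomial (suc n) = record { Carrier = List Carrier ; _+_ = add ; _*_ = mul ; ι = λ a → ι a ∷ [] }
    where
    open Operations (polynomial n)
    add mul : List Carrier → List Carrier → List Carrier
    add []      g       = g
    add (a ∷ f) []      = a ∷ f
    add (a ∷ f) (b ∷ g) = a + b ∷ add f g
    mul []      g = []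
    mul (a ∷ f) g = add (map (a *_) g) (ι 0ᴷ ∷ mul f g)

  coordinate : ∀ {n} → Fin n → Operations.Carrier (polynomial n)
  coordinate {suc n} zero    = Operations.ι (polynomial n) 0ᴷ ∷ Operations.ι (polynomial n) 1ᴷ ∷ []
  coordinate {suc n} (suc i) = coordinate i ∷ []

  record Homomorphism (O : Operations) (A : Algebra) : Set where
    private module O = Operations O
    open Algebra A
    field
      ⟦_⟧    : O.Carrier → Carrier
      +-homo : ∀ x y → ⟦ x O.+ y ⟧ ≈ ⟦ x ⟧ + ⟦ y ⟧
      *-homo : ∀ x y → ⟦ x O.* y ⟧ ≈ ⟦ x ⟧ * ⟦ y ⟧
      ι-homo : ∀ a → ⟦ O.ι a ⟧ ≈ ι a

  module Evaluation (A : Algebra) where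
    open Algebra A
    open import Algebra.Properties.CommutativeSemigroup +-commutativeSemigroup using (interchange)
    open import Algebra.Properties.CommutativeSemigroup *-commutativeSemigroup using (x∙yz≈y∙xz)
    open import Relation.Binary.Reasoning.Setoid setoid

    evaluate : ∀ {n} → (Fin n → Carrier) → Homomorphism (polynomial n) A
    evaluate {zero} z = record
      { ⟦_⟧ = ι ; +-homo = ι-+ ; *-homo = ι-* ; ι-homo = λ _ → refl }
    evaluate {suc n} z = record
      { ⟦_⟧ = horner ; +-homo = add-homo ; *-homo = mul-homo ; ι-homo = ι-hom }
      where
      module O = Operations (polynomial n)
      module P = Operations (polynomial (suc n))
      open Homomorphism (evaluate (z ∘ suc))
      horner : List O.Carrier → Carrier
      horner []      = 0#
      horner (a ∷ f) = ⟦ a ⟧ + z zero * horner f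
      ι-hom : ∀ a → horner (P.ι a) ≈ ι a
      ι-hom a = trans (+-cong (ι-homo a) (zeroʳ _)) (+-identityʳ _)
      add-homo : ∀ f g → horner (f P.+ g) ≈ horner f + horner g
      add-homo []      g       = sym (+-identityˡ _)
      add-homo (a ∷ f) []      = sym (+-identityʳ _)
      add-homo (a ∷ f) (b ∷ g) = begin
        ⟦ a O.+ b ⟧ + z zero * horner (f P.+ g)
          ≈⟨ +-cong (+-homo a b) (trans (*-congˡ (add-homo f g)) (distribˡ _ _ _)) ⟩
        ⟦ a ⟧ + ⟦ b ⟧ + (z zero * horner f + z zero * horner g)
          ≈⟨ interchange _ _ _ _ ⟩
        horner (a ∷ f) + horner (b ∷ g)
          ∎
      scale-homo : ∀ a g → horner (map (a O.*_) g) ≈ ⟦ a ⟧ * horner g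
      scale-homo a []      = sym (zeroʳ _)
      scale-homo a (b ∷ g) = begin
        ⟦ a O.* b ⟧ + z zero * horner (map (a O.*_) g)
          ≈⟨ +-cong (*-homo a b) (trans (*-congˡ (scale-homo a g)) (x∙yz≈y∙xz _ _ _)) ⟩
        ⟦ a ⟧ * ⟦ b ⟧ + ⟦ a ⟧ * (z zero * horner g)
          ≈⟨ distribˡ _ _ _ ⟨
        ⟦ a ⟧ * horner (b ∷ g)
          ∎
      mul-homo : ∀ f g → horner (f P.* g) ≈ horner f * horner g
      mul-homo []      g = sym (zeroˡ _)
      mul-homo (a ∷ f) g = begin
        horner (map (a O.*_) g P.+ (O.ι 0ᴷ ∷ f P.* g))
          ≈⟨ add-homo (map (a O.*_) g) _ ⟩
        horner (map (a O.*_) g) + (⟦ O.ι 0ᴷ ⟧ + z zero * horner (f P.* g))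
          ≈⟨ +-cong (scale-homo a g)
               (trans (+-cong (trans (ι-homo 0ᴷ) ι-0) (*-congˡ (mul-homo f g))) (+-identityˡ _)) ⟩
        ⟦ a ⟧ * horner g + z zero * (horner f * horner g)
          ≈⟨ +-congˡ (*-assoc _ _ _) ⟨
        ⟦ a ⟧ * horner g + z zero * horner f * horner g
          ≈⟨ distribʳ _ _ _ ⟨
        horner (a ∷ f) * horner g
          ∎

    evaluate-coordinate : ∀ {n} (z : Fin n → Carrier) i →
                        Homomorphism.⟦_⟧ (evaluate z) (coordinate i) ≈ z i
    evaluate-coordinate {suc n} z zero = begin
      ⟦ O.ι 0ᴷ ⟧ + z zero * (⟦ O.ι 1ᴷ ⟧ + z zero * 0#)
        ≈⟨ +-cong (trans (ι-homo 0ᴷ) ι-0)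
             (*-congˡ (trans (+-cong (trans (ι-homo 1ᴷ) ι-1) (zeroʳ _)) (+-identityʳ _))) ⟩
      0# + z zero * 1#
        ≈⟨ trans (+-identityˡ _) (*-identityʳ _) ⟩
      z zero
        ∎
      where
      open Homomorphism (evaluate (z ∘ suc))
      module O = Operations (polynomial n)
    evaluate-coordinate {suc n} z (suc i) =
      trans (+-cong (evaluate-coordinate (z ∘ suc) i) (zeroʳ _)) (+-identityʳ _)

  polyCoef : ∀ {n} → Vec ℕ n → Operations.Carrier (polynomial n) → K
  polyCoef []          f       = f
  polyCoef (i ∷ β)     []      = 0ᴷ
  polyCoef (zero ∷ β)  (a ∷ f) = polyCoef β a
  polyCoef (suc i ∷ β) (a ∷ f) = polyCoef (i ∷ β) f

  -- The order at the origin. Vanishing at another point x is expressed by first substituting the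
  -- coordinates x + X (see `neighbour`), which takes the place of Hasse derivatives.
  VanishesTo : ∀ n → ℕ → Operations.Carrier (polynomial n) → Set
  VanishesTo n r f = ∀ (β : Vec ℕ n) → Vec.sum β ℕ.< r → polyCoef β f ≡ 0ᴷ

  module _ {A : Algebra} (𝓕 : Filtration A) where
    open Algebra A
    open Filtration 𝓕
    open Evaluation A

    -- Horner's scheme f = a + z f′: here a keeps the order r in the remaining variables, f′ has
    -- order r - 1, and the factor z, of order 1, supplies the missing unit.
    evaluate-Fil : ∀ {n} (z : Fin n → Carrier) → (∀ i → Fil 1 (z i)) → ∀ {r} f → VanishesTo n r f →
                   Fil r (Homomorphism.⟦_⟧ (evaluate z) f)
    evaluate-Fil {zero} z z∈ {zero}  a v = Fil-ι a
    evaluate-Fil {zero} z z∈ {suc r} a v =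
      Fil-resp (sym (trans (reflexive (≡.cong ι (v [] (ℕ.s≤s ℕ.z≤n)))) ι-0)) Fil-0
    evaluate-Fil {suc n} z z∈ []      v = Fil-0
    evaluate-Fil {suc n} z z∈ {r} (a ∷ f) v = Fil-+
      (evaluate-Fil (z ∘ suc) (z∈ ∘ suc) a (λ β → v (zero ∷ β)))
      (Fil-anti (ℕ.m≤n+m∸n r 1) (Fil-* (z∈ zero) (evaluate-Fil z z∈ {r ℕ.∸ 1} f vanish)))
      where
      vanish : VanishesTo (suc n) (r ℕ.∸ 1) f
      vanish (i ∷ β) lt = v (suc i ∷ β) (ℕ.≤-trans (ℕ.s≤s lt) (suc-pred r (ℕ.≤-trans (ℕ.s≤s ℕ.z≤n) lt)))
        where
        suc-pred : ∀ r → 0 ℕ.< r ℕ.∸ 1 → suc (r ℕ.∸ 1) ℕ.≤ r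
        suc-pred (suc r) _ = ℕ.≤-refl

  module Expressions (O : Operations) where
    open Operations O

    linear : ∀ {n} → (Fin n → K) → (Fin n → Carrier) → Carrier
    linear {zero}  ℓ x = ι 0ᴷ
    linear {suc n} ℓ x = ι (ℓ zero) * x zero + linear (ℓ ∘ suc) (x ∘ suc)

    power : ℕ → Carrier → Carrier
    power zero    x = ι 1ᴷ
    power (suc n) x = x * power n x

    product : ∀ {m} → (Fin m → Carrier) → Carrier
    product {zero}  x = ι 1ᴷ
    product {suc m} x = x zero * product (x ∘ suc)

  module _ {O : Operations} {A : Algebra} (φ : Homomorphism O A) where
    open Algebra A
    open Homomorphism φ
    private
      module S = Expressions O
      module T = Expressions (operations A)

    linear-homo : ∀ {n} (ℓ : Fin n → K) {x y} → (∀ i → ⟦ x i ⟧ ≈ y i) → ⟦ S.linear ℓ x ⟧ ≈ T.linear ℓ y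
    linear-homo {zero}  ℓ p = ι-homo 0ᴷ
    linear-homo {suc n} ℓ p = trans (+-homo _ _)
      (+-cong (trans (*-homo _ _) (*-cong (ι-homo _) (p zero))) (linear-homo (ℓ ∘ suc) (p ∘ suc)))

    power-homo : ∀ n {x y} → ⟦ x ⟧ ≈ y → ⟦ S.power n x ⟧ ≈ T.power n y
    power-homo zero    p = ι-homo 1ᴷ
    power-homo (suc n) p = trans (*-homo _ _) (*-cong p (power-homo n p))

    product-homo : ∀ {m} {x : Fin m → _} {y} → (∀ i → ⟦ x i ⟧ ≈ y i) → ⟦ S.product x ⟧ ≈ T.product y
    product-homo {zero}  p = ι-homo 1ᴷ
    product-homo {suc m} p = trans (*-homo _ _) (*-cong (p zero) (product-homo (p ∘ suc)))

  identity : ∀ A → Homomorphism (operations A) A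
  identity A = record { ⟦_⟧ = id ; +-homo = λ _ _ → refl ; *-homo = λ _ _ → refl ; ι-homo = λ _ → refl }
    where open Algebra A

  module _ {A : Algebra} (𝓕 : Filtration A) where
    open Algebra A
    open Filtration 𝓕
    open Expressions (operations A)

    linear-Fil : ∀ {n} (ℓ : Fin n → K) {r x} → (∀ i → Fil r (x i)) → Fil r (linear ℓ x)
    linear-Fil {zero}  ℓ p = Fil-resp (sym ι-0) Fil-0
    linear-Fil {suc n} ℓ p = Fil-+ (Fil-* (Fil-ι _) (p zero)) (linear-Fil (ℓ ∘ suc) (p ∘ suc))

  module _ {A B : Algebra} (𝓖 : Grading A B) where
    private
      module A = Algebra A
      module B = Algebra B
      module S = Expressions (operations A)
      module T = Expressions (operations B)
    open Grading 𝓖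

    linear-Low : ∀ {n} (ℓ : Fin n → K) {D x} → (∀ i → Low D (x i)) → Low D (S.linear ℓ x)
    linear-Low {zero}  ℓ p = Low-mono ℕ.z≤n (Low-ι 0ᴷ)
    linear-Low {suc n} ℓ p = Low-+ (Low-* (Low-ι _) (p zero)) (linear-Low (ℓ ∘ suc) (p ∘ suc))

    top-linear : ∀ {n} (ℓ : Fin n → K) {D x y} → (∀ i → Low D (x i)) → (∀ i → top D (x i) B.≈ y i) →
                 top D (S.linear ℓ x) B.≈ T.linear ℓ y
    top-linear {zero}  ℓ l p = B.trans (top-cong A.ι-0) (B.trans top-0 (B.sym B.ι-0))
    top-linear {suc n} ℓ l p = B.trans (top-+ _ _ _)
      (B.+-cong (B.trans (top-* (Low-ι _) (l zero)) (B.*-cong (top-ι _) (p zero)))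
                (top-linear (ℓ ∘ suc) (l ∘ suc) (p ∘ suc)))

    power-Low : ∀ n {D x} → Low D x → Low (n ℕ.* D) (S.power n x)
    power-Low zero    p = Low-ι 1ᴷ
    power-Low (suc n) p = Low-* p (power-Low n p)

    top-power : ∀ n {D x y} → Low D x → top D x B.≈ y → top (n ℕ.* D) (S.power n x) B.≈ T.power n y
    top-power zero    l p = top-ι 1ᴷ
    top-power (suc n) l p = B.trans (top-* l (power-Low n l)) (B.*-cong p (top-power n l p))

    product-Low : ∀ {m} {D : Fin m → ℕ} {x} → (∀ i → Low (D i) (x i)) → Low (total D) (S.product x)
    product-Low {zero}  p = Low-ι 1ᴷ
    product-Low {suc m} p = Low-* (p zero) (product-Low (p ∘ suc))

    top-product : ∀ {m} {D : Fin m → ℕ} {x y} → (∀ i → Low (D i) (x i)) → (∀ i → top (D i) (x i) B.≈ y i) →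
                  top (total D) (S.product x) B.≈ T.product y
    top-product {zero}  l p = top-ι 1ᴷ
    top-product {suc m} l p = B.trans (top-* (l zero) (product-Low (l ∘ suc)))
      (B.*-cong (p zero) (top-product (l ∘ suc) (p ∘ suc)))

  -- `Lead μ g`: every monomial of g is a multiple of X^μ, and X^μ itself occurs.
  module Leading where
    private
      ∣_∣ : ℕ → Set
      ∣ m ∣ = Algebra.Carrier (base [[ m ]])

    AtLeast : ∀ {m} → (Fin m → ℕ) → ∣ m ∣ → Set
    AtLeast {zero}  μ g = ⊤
    AtLeast {suc m} μ g =
      (∀ i → i ℕ.< μ zero → Algebra._≈_ (base [[ m ]]) (g i) (Algebra.0# (base [[ m ]]))) ×
      (∀ i → AtLeast (μ ∘ suc) (g i))

    AtLeast-coef : ∀ {m} (μ k : Fin m → ℕ) (g : ∣ m ∣) → AtLeast μ g →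
                   (∃[ j ] k j ℕ.< μ j) → coef base k g ≡ 0ᴷ
    AtLeast-coef {suc m} μ k g (z , _) (zero , lt) =
      ≡.trans (coef-cong base (k ∘ suc) (z (k zero) lt)) (coef-0 base {m} (k ∘ suc))
    AtLeast-coef {suc m} μ k g (_ , y) (suc j , lt) = AtLeast-coef _ _ (g (k zero)) (y (k zero)) (j , lt)

    AtLeast-resp : ∀ {m} {μ : Fin m → ℕ} {f g} → Algebra._≈_ (base [[ m ]]) f g → AtLeast μ f → AtLeast μ g
    AtLeast-resp {zero}  p x       = tt
    AtLeast-resp {suc m} p (z , y) = (λ i lt → trans (sym (p i)) (z i lt)) , (λ i → AtLeast-resp (p i) (y i))
      where open Algebra (base [[ m ]])

    AtLeast-index : ∀ {m} {μ ν : Fin m → ℕ} {g} → (∀ j → μ j ≡ ν j) → AtLeast μ g → AtLeast ν g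
    AtLeast-index {zero}  e x       = tt
    AtLeast-index {suc m} e (z , y) =
      (λ i lt → z i (subst (i ℕ.<_) (≡.sym (e zero)) lt)) , (λ i → AtLeast-index (e ∘ suc) (y i))

    AtLeast-0 : ∀ {m} {μ : Fin m → ℕ} → AtLeast μ (Algebra.0# (base [[ m ]]))
    AtLeast-0 {zero}  = tt
    AtLeast-0 {suc m} = (λ _ _ → Algebra.refl (base [[ m ]])) , (λ _ → AtLeast-0 {m})

    AtLeast-trivial : ∀ {m} (g : ∣ m ∣) → AtLeast {m} (λ _ → 0) g
    AtLeast-trivial {zero}  g = tt
    AtLeast-trivial {suc m} g = (λ _ ()) , (λ i → AtLeast-trivial {m} (g i))

    AtLeast-+ : ∀ {m} {μ : Fin m → ℕ} {f g} → AtLeast μ f → AtLeast μ g →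
                AtLeast μ (Algebra._+_ (base [[ m ]]) f g)
    AtLeast-+ {zero}  x y = tt
    AtLeast-+ {suc m} (z , x) (w , y) =
      (λ i lt → trans (+-cong (z i lt) (w i lt)) (+-identityˡ 0#)) , (λ i → AtLeast-+ (x i) (y i))
      where open Algebra (base [[ m ]])

    AtLeast-* : ∀ {m} {μ ν : Fin m → ℕ} {f g} → AtLeast μ f → AtLeast ν g →
                AtLeast (λ j → μ j ℕ.+ ν j) (Algebra._*_ (base [[ m ]]) f g)
    AtLeast-* {zero}  x y = tt
    AtLeast-* {suc m} {μ} {ν} {f} {g} (z , x) (w , y) =
      (λ i → order (μ zero) (ν zero) f g z w i) , (λ i → rest f g x y i)
      where
      open Algebra (base [[ m ]])
      open PowerSeries ring using (_⊠_)
      order : ∀ a b f g → (∀ i → i ℕ.< a → f i ≈ 0#) → (∀ i → i ℕ.< b → g i ≈ 0#) →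
              ∀ i → i ℕ.< a ℕ.+ b → (f ⊠ g) i ≈ 0#
      order zero    b f g z w zero    lt = trans (*-congˡ (w 0 lt)) (zeroʳ _)
      order zero    b f g z w (suc i) lt = trans (+-cong (trans (*-congˡ (w (suc i) lt)) (zeroʳ _))
        (order zero b (f ∘ suc) g (λ _ ()) w i (ℕ.<-trans (ℕ.n<1+n i) lt))) (+-identityˡ 0#)
      order (suc a) b f g z w zero    lt = trans (*-congʳ (z 0 (ℕ.s≤s ℕ.z≤n))) (zeroˡ _)
      order (suc a) b f g z w (suc i) (ℕ.s≤s lt) =
        trans (+-cong (trans (*-congʳ (z 0 (ℕ.s≤s ℕ.z≤n))) (zeroˡ _))
                      (order a b (f ∘ suc) g (λ j l → z (suc j) (ℕ.s≤s l)) w i lt)) (+-identityˡ 0#)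
      rest : ∀ f g → (∀ i → AtLeast (μ ∘ suc) (f i)) → (∀ i → AtLeast (ν ∘ suc) (g i)) →
             ∀ i → AtLeast (λ j → μ (suc j) ℕ.+ ν (suc j)) ((f ⊠ g) i)
      rest f g x y zero    = AtLeast-* (x 0) (y 0)
      rest f g x y (suc i) = AtLeast-+ (AtLeast-* (x 0) (y (suc i))) (rest (f ∘ suc) g (x ∘ suc) y i)

    -- Any other splitting of μ + ν has, in some variable, an exponent too small for one of the two
    -- factors, so a single product contributes.
    coef-* : ∀ {m} (μ ν : Fin m → ℕ) f g → AtLeast μ f → AtLeast ν g →
             coef base (λ j → μ j ℕ.+ ν j) (Algebra._*_ (base [[ m ]]) f g) ≡ coef base μ f ⊗ coef base ν g
    coef-* {zero}  μ ν f g x y = ≡.refl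
    coef-* {suc m} μ ν f g (z , x) (w , y) = ≡.trans
      (coef-cong base {m} _ (lead (μ zero) (ν zero) f g z w))
      (coef-* (μ ∘ suc) (ν ∘ suc) (f (μ zero)) (g (ν zero)) (x _) (y _))
      where
      open Algebra (base [[ m ]])
      open PowerSeries ring using (_⊠_; ⊠-zeroˡ)
      small : ∀ f g b → (∀ i → i ℕ.≤ b → g i ≈ 0#) → (f ⊠ g) b ≈ 0#
      small f g zero    w = trans (*-congˡ (w 0 ℕ.z≤n)) (zeroʳ _)
      small f g (suc b) w = trans (+-cong (trans (*-congˡ (w (suc b) ℕ.≤-refl)) (zeroʳ _))
        (small (f ∘ suc) g b (λ i l → w i (ℕ.m≤n⇒m≤1+n l)))) (+-identityˡ 0#)
      lead : ∀ a b f g → (∀ i → i ℕ.< a → f i ≈ 0#) → (∀ i → i ℕ.< b → g i ≈ 0#) →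
             (f ⊠ g) (a ℕ.+ b) ≈ f a * g b
      lead zero    zero    f g z w = refl
      lead zero    (suc b) f g z w =
        trans (+-congˡ (small (f ∘ suc) g b (λ i l → w i (ℕ.s≤s l)))) (+-identityʳ _)
      lead (suc a) b f g z w =
        trans (+-cong (trans (*-congʳ (z 0 (ℕ.s≤s ℕ.z≤n))) (zeroˡ _))
                      (lead a b (f ∘ suc) g (λ j l → z (suc j) (ℕ.s≤s l)) w)) (+-identityˡ _)

    K-integral : ∀ {a b} → a ≢ 0ᴷ → b ≢ 0ᴷ → a ⊗ b ≢ 0ᴷ
    K-integral {a} {b} a≢0 b≢0 ab≡0 = let c , ac≡1 = inverse a a≢0 in
      b≢0 (≡.trans (≡.sym (K.*-identityˡ b)) (≡.trans (≡.cong (_⊗ b) (≡.trans (≡.sym ac≡1) (K.*-comm a c)))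
        (≡.trans (K.*-assoc c a b) (≡.trans (≡.cong (c ⊗_) ab≡0) (K.zeroʳ c)))))

    Lead : ∀ {m} → (Fin m → ℕ) → ∣ m ∣ → Set
    Lead μ g = AtLeast μ g × coef base μ g ≢ 0ᴷ

    Lead-resp : ∀ {m} {μ : Fin m → ℕ} {f g} → Algebra._≈_ (base [[ m ]]) f g → Lead μ f → Lead μ g
    Lead-resp {m} {μ} {f} {g} p (x , c) =
      AtLeast-resp {m} p x , λ e → c (≡.trans (coef-cong base μ p) e)

    Lead-index : ∀ {m} {μ ν : Fin m → ℕ} {g} → (∀ j → μ j ≡ ν j) → Lead μ g → Lead ν g
    Lead-index {m} {μ} {ν} {g} e (x , c) =
      AtLeast-index {m} e x , λ v → c (≡.trans (coef-index base g e) v)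

    Lead-* : ∀ {m} {μ ν : Fin m → ℕ} {f g} → Lead μ f → Lead ν g →
             Lead (λ j → μ j ℕ.+ ν j) (Algebra._*_ (base [[ m ]]) f g)
    Lead-* {m} {μ} {ν} {f} {g} (x , c) (y , d) =
      AtLeast-* {m} x y , λ e → K-integral c d (≡.trans (≡.sym (coef-* μ ν f g x y)) e)

    coef-0-ι : ∀ {m} a → coef base {m} (λ _ → 0) (Algebra.ι (base [[ m ]]) a) ≡ a
    coef-0-ι {zero}  a = ≡.refl
    coef-0-ι {suc m} a = coef-0-ι {m} a

    Lead-ι : ∀ {m a} → a ≢ 0ᴷ → Lead {m} (λ _ → 0) (Algebra.ι (base [[ m ]]) a)
    Lead-ι {m} {a} a≢0 = AtLeast-trivial {m} _ , λ e → a≢0 (≡.trans (≡.sym (coef-0-ι {m} a)) e)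

    coef-0-generator : ∀ {m} (j : Fin m) → coef base {m} (λ _ → 0) (generator base j) ≡ 0ᴷ
    coef-0-generator {suc m} zero    = coef-0 base {m} (λ _ → 0)
    coef-0-generator {suc m} (suc j) = coef-0-generator j

    Lead-unit : ∀ {m a} (j : Fin m) → a ≢ 0ᴷ →
                Lead {m} (λ _ → 0) (Algebra._+_ (base [[ m ]]) (Algebra.ι (base [[ m ]]) a) (generator base j))
    Lead-unit {m} {a} j a≢0 = AtLeast-trivial {m} _ , λ e → a≢0 (≡.trans (≡.sym (≡.trans
      (coef-+ base {m} (λ _ → 0) (Algebra.ι (base [[ m ]]) a) (generator base j))
      (≡.trans (≡.cong₂ _⊕_ (coef-0-ι {m} a) (coef-0-generator {m} j)) (K.+-identityʳ a)))) e)

    δ : ∀ {m} → Fin m → Fin m → ℕ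
    δ zero    zero    = 1
    δ zero    (suc _) = 0
    δ (suc _) zero    = 0
    δ (suc i) (suc j) = δ i j

    Lead-generator : ∀ {m} (j : Fin m) → Lead (δ j) (generator base j)
    Lead-generator {suc m} zero =
      ((λ { zero _ → refl ; (suc _) (ℕ.s≤s ()) }) , λ i → AtLeast-trivial {m} _) ,
      λ e → 1≢0 (≡.trans (≡.sym (≡.trans (coef-cong base {m} (λ _ → 0) (sym ι-1)) (coef-0-ι {m} 1ᴷ))) e)
      where open Algebra (base [[ m ]])
    Lead-generator {suc m} (suc j) =
      ((λ _ ()) , λ { zero → proj₁ (Lead-generator {m} j) ; (suc i) → AtLeast-0 {m} }) ,
      proj₂ (Lead-generator {m} j)

    module _ {m : ℕ} where
      open Expressions (operations (base [[ m ]]))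

      Lead-power : ∀ n {μ x} → Lead {m} μ x → Lead (λ j → n ℕ.* μ j) (power n x)
      Lead-power zero    p = Lead-ι {m} 1≢0
      Lead-power (suc n) {μ} {x} p = Lead-* {m} {μ} {_} {x} p (Lead-power n {μ} {x} p)

      Lead-product : ∀ {l} {μ : Fin l → Fin m → ℕ} {x} → (∀ i → Lead (μ i) (x i)) →
                     Lead (λ j → total (λ i → μ i j)) (product x)
      Lead-product {zero}  p = Lead-ι {m} 1≢0
      Lead-product {suc l} {μ} {x} p = Lead-* {m} {μ zero} {_} {x zero} (p zero) (Lead-product {l} {μ ∘ suc} {x ∘ suc} (p ∘ suc))

  -- Linear algebra over the finite field

  element : Fin q → K
  element = Inverse.to enumeration

  index : K → Fin q
  index = Inverse.from enumeration

  element-index : ∀ a → element (index a) ≡ a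
  element-index a = Inverse.strictlyInverseˡ enumeration a

  index-element : ∀ i → index (element i) ≡ i
  index-element i = Inverse.strictlyInverseʳ enumeration i

  index-injective : ∀ {a b} → index a ≡ index b → a ≡ b
  index-injective {a} {b} e =
    ≡.trans (≡.sym (element-index a)) (≡.trans (≡.cong element e) (element-index b))

  _≟ᴷ_ : (a b : K) → Dec (a ≡ b)
  a ≟ᴷ b with index a Fin.≟ index b
  ... | yes e = yes (index-injective e)
  ... | no ¬e = no (¬e ∘ ≡.cong index)

  2≤q : 2 ℕ.≤ q
  2≤q = go (index 1ᴷ) (index 0ᴷ) (1≢0 ∘ index-injective)
    where
    go : ∀ {m} (i j : Fin m) → i ≢ j → 2 ℕ.≤ m
    go {suc zero}    zero zero i≢j = ⊥-elim (i≢j ≡.refl)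
    go {suc (suc m)} _    _    _   = ℕ.s≤s (ℕ.s≤s ℕ.z≤n)

  funToFin-cong : ∀ {N} {f g : Fin N → Fin q} → (∀ i → f i ≡ g i) → funToFin f ≡ funToFin g
  funToFin-cong {zero}  p = ≡.refl
  funToFin-cong {suc N} p = ≡.cong₂ combine (p zero) (funToFin-cong (p ∘ suc))

  module KE = Expressions (operations base)

  linear-difference : ∀ {N} (c d x : Fin N → K) →
    KE.linear (λ i → c i ⊕ (⊖ d i)) x ≡ KE.linear c x ⊕ (⊖ KE.linear d x)
  linear-difference {zero}  c d x = ≡.sym (K.-‿inverseʳ 0ᴷ)
  linear-difference {suc N} c d x = begin
    (c₀ ⊕ (⊖ d₀)) ⊗ x₀ ⊕ KE.linear (λ i → c (suc i) ⊕ (⊖ d (suc i))) (x ∘ suc)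
      ≡⟨ ≡.cong₂ _⊕_ (≡.trans (K.distribʳ x₀ c₀ (⊖ d₀)) (≡.cong (c₀ ⊗ x₀ ⊕_) (≡.sym (-‿distribˡ-* d₀ x₀))))
                     (linear-difference (c ∘ suc) (d ∘ suc) (x ∘ suc)) ⟩
    (c₀ ⊗ x₀ ⊕ (⊖ (d₀ ⊗ x₀))) ⊕ (C ⊕ (⊖ D))
      ≡⟨ interchange _ _ _ _ ⟩
    (c₀ ⊗ x₀ ⊕ C) ⊕ ((⊖ (d₀ ⊗ x₀)) ⊕ (⊖ D))
      ≡⟨ ≡.cong ((c₀ ⊗ x₀ ⊕ C) ⊕_) (-‿+-comm _ _) ⟩
    (c₀ ⊗ x₀ ⊕ C) ⊕ (⊖ (d₀ ⊗ x₀ ⊕ D))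
      ∎
    where
    open ≡.≡-Reasoning
    open import Algebra.Properties.Ring (CommutativeRing.ring fieldRing) using (-‿distribˡ-*; -‿+-comm)
    open import Algebra.Properties.CommutativeSemigroup K.+-commutativeSemigroup using (interchange)
    c₀ = c zero
    d₀ = d zero
    x₀ = x zero
    C = KE.linear (c ∘ suc) (x ∘ suc)
    D = KE.linear (d ∘ suc) (x ∘ suc)

  linear-congˡ : ∀ {N} {c d : Fin N → K} (x : Fin N → K) → (∀ i → c i ≡ d i) → KE.linear c x ≡ KE.linear d x
  linear-congˡ {zero}  x p = ≡.refl
  linear-congˡ {suc N} x p = ≡.cong₂ (λ a b → a ⊗ x zero ⊕ b) (p zero) (linear-congˡ (x ∘ suc) (p ∘ suc))

  -- Over a finite field dimensions can be compared by counting vectors.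
  trivial-kernel⇒≤ : ∀ {M N} (L : Fin M → Fin N → K) →
    (∀ c → (∀ m → KE.linear c (L m) ≡ 0ᴷ) → ∀ i → c i ≡ 0ᴷ) → N ℕ.≤ M
  trivial-kernel⇒≤ {M} {N} L kernel = ℕ.≮⇒≥ λ M<N → ℕ.<-irrefl ≡.refl
    (ℕ.<-≤-trans (ℕ.^-monoʳ-< q 2≤q M<N) (Fin.injective⇒≤ {f = Φ} Φ-injective))
    where
    open import Algebra.Properties.Group K.+-group using () renaming (x∙y⁻¹≈ε⇒x≈y to x-y≈0⇒x≈y)
    decode : Fin (q ℕ.^ N) → Fin N → K
    decode v = element ∘ finToFun v
    image : Fin (q ℕ.^ N) → Fin M → Fin q
    image v m = index (KE.linear (decode v) (L m))
    Φ : Fin (q ℕ.^ N) → Fin (q ℕ.^ M)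
    Φ v = funToFin (image v)
    Φ-injective : ∀ {v w} → Φ v ≡ Φ w → v ≡ w
    Φ-injective {v} {w} e = ≡.trans (≡.sym (Fin.funToFin-finToFin {N} {q} v)) (≡.trans
      (funToFin-cong λ i → ≡.trans (≡.sym (index-element _)) (≡.trans
        (≡.cong index (x-y≈0⇒x≈y _ _ (kernel (λ i → decode v i ⊕ (⊖ decode w i)) same i))) (index-element _)))
      (Fin.funToFin-finToFin {N} {q} w))
      where
      agree : ∀ m → image v m ≡ image w m
      agree m = ≡.trans (≡.sym (Fin.finToFun-funToFin (image v) m))
        (≡.trans (≡.cong (λ z → finToFun z m) e) (Fin.finToFun-funToFin (image w) m))
      same : ∀ m → KE.linear (λ i → decode v i ⊕ (⊖ decode w i)) (L m) ≡ 0ᴷ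
      same m = ≡.trans (linear-difference (decode v) (decode w) (L m))
        (≡.trans (≡.cong (_⊕ _) (index-injective (agree m))) (K.-‿inverseʳ _))

  polyCoef-+ : ∀ {n} (β : Vec ℕ n) f g →
    polyCoef β (Operations._+_ (polynomial n) f g) ≡ polyCoef β f ⊕ polyCoef β g
  polyCoef-+ []          f       g       = ≡.refl
  polyCoef-+ (i ∷ β)     []      g       = ≡.sym (K.+-identityˡ _)
  polyCoef-+ (i ∷ β)     (a ∷ f) []      = ≡.sym (K.+-identityʳ _)
  polyCoef-+ (zero ∷ β)  (a ∷ f) (b ∷ g) = polyCoef-+ β a b
  polyCoef-+ (suc i ∷ β) (a ∷ f) (b ∷ g) = polyCoef-+ (i ∷ β) f g

  polyCoef-0 : ∀ {n} (β : Vec ℕ n) → polyCoef β (Operations.ι (polynomial n) 0ᴷ) ≡ 0ᴷ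
  polyCoef-0 []          = ≡.refl
  polyCoef-0 (zero ∷ β)  = polyCoef-0 β
  polyCoef-0 (suc i ∷ β) = ≡.refl

  polyCoef-ι* : ∀ {n} (β : Vec ℕ n) a f →
    polyCoef β (Operations._*_ (polynomial n) (Operations.ι (polynomial n) a) f) ≡ a ⊗ polyCoef β f
  polyCoef-ι* []      a f = ≡.refl
  polyCoef-ι* {suc n} (i ∷ β) a f =
    ≡.trans (polyCoef-+ (i ∷ β) (map (O.ι a O.*_) f) (O.ι 0ᴷ ∷ []))
      (≡.trans (≡.cong₂ _⊕_ (map-scale i f) (polyCoef-0 (i ∷ β))) (K.+-identityʳ _))
    where
    module O = Operations (polynomial n)
    map-scale : ∀ i f → polyCoef (i ∷ β) (map (O.ι a O.*_) f) ≡ a ⊗ polyCoef (i ∷ β) f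
    map-scale i       []      = ≡.sym (K.zeroʳ a)
    map-scale zero    (b ∷ f) = polyCoef-ι* β a b
    map-scale (suc i) (b ∷ f) = map-scale i f

  polyCoef-linear : ∀ {n N} (β : Vec ℕ n) (c : Fin N → K) x →
    polyCoef β (Expressions.linear (polynomial n) c x) ≡ KE.linear c (λ i → polyCoef β (x i))
  polyCoef-linear {N = zero}  β c x = polyCoef-0 β
  polyCoef-linear {N = suc N} β c x = ≡.trans (polyCoef-+ β _ _)
    (≡.cong₂ _⊕_ (polyCoef-ι* β _ _) (polyCoef-linear β (c ∘ suc) (x ∘ suc)))

  total-cong : ∀ {m} {f g : Fin m → ℕ} → (∀ i → f i ≡ g i) → total f ≡ total g
  total-cong {zero}  p = ≡.refl
  total-cong {suc m} p = ≡.cong₂ ℕ._+_ (p zero) (total-cong (p ∘ suc))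

  total-zero : ∀ {m} {f : Fin m → ℕ} → (∀ i → f i ≡ 0) → total f ≡ 0
  total-zero {zero}  p = ≡.refl
  total-zero {suc m} p = ≡.cong₂ ℕ._+_ (p zero) (total-zero (p ∘ suc))

  total-single : ∀ {m} {f : Fin m → ℕ} i → (∀ j → j ≢ i → f j ≡ 0) → total f ≡ f i
  total-single {suc m} {f} zero    p =
    ≡.trans (≡.cong (f zero ℕ.+_) (total-zero (λ j → p (suc j) λ ()))) (ℕ.+-identityʳ _)
  total-single {suc m} {f} (suc i) p =
    ≡.trans (≡.cong (ℕ._+ total (f ∘ suc)) (p zero λ ()))
            (total-single i (λ j j≢i → p (suc j) (j≢i ∘ Fin.suc-injective)))

  total-+ : ∀ {m} (f g : Fin m → ℕ) → total (λ i → f i ℕ.+ g i) ≡ total f ℕ.+ total g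
  total-+ {zero}  f g = ≡.refl
  total-+ {suc m} f g = ≡.trans (≡.cong (f zero ℕ.+ g zero ℕ.+_) (total-+ (f ∘ suc) (g ∘ suc)))
    (interchange (f zero) (g zero) (total (f ∘ suc)) (total (g ∘ suc)))
    where open import Algebra.Properties.CommutativeSemigroup ℕ.+-commutativeSemigroup using (interchange)

  total-const : ∀ m a → total {m} (λ _ → a) ≡ m ℕ.* a
  total-const zero    a = ≡.refl
  total-const (suc m) a = ≡.cong (a ℕ.+_) (total-const m a)

  total-*ʳ : ∀ {m} (f : Fin m → ℕ) a → total (λ i → f i ℕ.* a) ≡ total f ℕ.* a
  total-*ʳ {zero}  f a = ≡.refl
  total-*ʳ {suc m} f a = ≡.trans (≡.cong (f zero ℕ.* a ℕ.+_) (total-*ʳ (f ∘ suc) a))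
    (≡.sym (ℕ.*-distribʳ-+ a (f zero) (total (f ∘ suc))))

  total-mono : ∀ {m} {f g : Fin m → ℕ} → (∀ i → f i ℕ.≤ g i) → total f ℕ.≤ total g
  total-mono {zero}  p = ℕ.z≤n
  total-mono {suc m} p = ℕ.+-mono-≤ (p zero) (total-mono (p ∘ suc))

  -- Terms of equal total compared from one side agree.
  total-squeeze : ∀ {m} {f g : Fin m → ℕ} → (∀ i → f i ℕ.≤ g i) → total g ℕ.≤ total f → ∀ i → f i ≡ g i
  total-squeeze {suc m} {f} {g} p t = go
    where
    rest≤ = total-mono (p ∘ suc)
    head≡ : f zero ≡ g zero
    head≡ = ℕ.≤-antisym (p zero) (ℕ.+-cancelʳ-≤ (total (f ∘ suc)) (g zero) (f zero)
              (ℕ.≤-trans (ℕ.+-monoʳ-≤ (g zero) rest≤) t))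
    go : ∀ i → f i ≡ g i
    go zero    = head≡
    go (suc i) = total-squeeze (p ∘ suc) (ℕ.+-cancelˡ-≤ (f zero) _ _
      (subst (λ v → v ℕ.+ total (g ∘ suc) ℕ.≤ total f) (≡.sym head≡) t)) i

  module _ (A : Algebra) where
    open Algebra A
    open Expressions (operations A)
    private module S = CommutativeRing (Algebra.ring A)
    open import Algebra.Properties.CommutativeSemigroup S.+-commutativeSemigroup using (interchange; x∙yz≈y∙xz)
    open import Relation.Binary.Reasoning.Setoid setoid

    linear-cong : ∀ {n} (ℓ : Fin n → K) {x y} → (∀ i → x i ≈ y i) → linear ℓ x ≈ linear ℓ y
    linear-cong = linear-homo (identity A)

    linear-ι+ : ∀ {n} (ℓ u : Fin n → K) v →
                linear ℓ (λ i → ι (u i) + v i) ≈ ι (KE.linear ℓ u) + linear ℓ v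
    linear-ι+ {zero}  ℓ u v = sym (trans (+-congˡ ι-0) (+-identityʳ _))
    linear-ι+ {suc n} ℓ u v = begin
      ι ℓ₀ * (ι (u zero) + v zero) + linear (ℓ ∘ suc) (λ i → ι (u (suc i)) + v (suc i))
        ≈⟨ +-cong (trans (distribˡ _ _ _) (+-congʳ (sym (ι-* _ _)))) (linear-ι+ (ℓ ∘ suc) (u ∘ suc) (v ∘ suc)) ⟩
      ι (ℓ₀ ⊗ u zero) + ι ℓ₀ * v zero + (ι (KE.linear (ℓ ∘ suc) (u ∘ suc)) + linear (ℓ ∘ suc) (v ∘ suc))
        ≈⟨ interchange _ _ _ _ ⟩
      ι (ℓ₀ ⊗ u zero) + ι (KE.linear (ℓ ∘ suc) (u ∘ suc)) + linear ℓ v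
        ≈⟨ +-congʳ (ι-+ _ _) ⟨
      ι (KE.linear ℓ u) + linear ℓ v
        ∎
      where ℓ₀ = ℓ zero

    linear-remove : ∀ {n} (p : Fin (suc n)) (ℓ : Fin (suc n) → K) x →
      linear ℓ x ≈ ι (ℓ p) * x p + linear (ℓ ∘ punchIn p) (x ∘ punchIn p)
    linear-remove zero    ℓ x = refl
    linear-remove {suc n} (suc p) ℓ x = trans (+-congˡ (linear-remove p (ℓ ∘ suc) (x ∘ suc))) (x∙yz≈y∙xz _ _ _)

    -- The point of the hyperplane ℓ = 0 with coordinates x off the pivot p.
    complete : ∀ {n} (ℓ : Fin (suc n) → K) (p : Fin (suc n)) → ℓ p ≢ 0ᴷ →
               (Fin n → Carrier) → Fin (suc n) → Carrier
    complete ℓ p ℓp≢0 x = insertAt x p (ι (⊖ proj₁ (inverse (ℓ p) ℓp≢0)) * linear (ℓ ∘ punchIn p) x)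

    linear-complete : ∀ {n} (ℓ : Fin (suc n) → K) p ℓp≢0 x → linear ℓ (complete ℓ p ℓp≢0 x) ≈ 0#
    linear-complete ℓ p ℓp≢0 x = begin
      linear ℓ v
        ≈⟨ linear-remove p ℓ v ⟩
      ι (ℓ p) * v p + linear (ℓ ∘ punchIn p) (v ∘ punchIn p)
        ≈⟨ +-cong (*-congˡ (reflexive (insertAt-lookup x p _)))
                  (linear-cong (ℓ ∘ punchIn p) (λ i → reflexive (insertAt-punchIn x p _ i))) ⟩
      ι (ℓ p) * (ι (⊖ c) * Λ) + Λ
        ≈⟨ +-congʳ (trans (sym (*-assoc _ _ _)) (*-congʳ (sym (ι-* _ _)))) ⟩
      ι (ℓ p ⊗ (⊖ c)) * Λ + Λ
        ≈⟨ +-cong (*-congʳ (reflexive (≡.cong ι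
             (≡.trans (≡.sym (-‿distribʳ-* _ _)) (≡.cong ⊖_ (proj₂ (inverse (ℓ p) ℓp≢0))))))) (sym (trans (*-congʳ ι-1) (*-identityˡ Λ))) ⟩
      ι (⊖ 1ᴷ) * Λ + ι 1ᴷ * Λ
        ≈⟨ distribʳ _ _ _ ⟨
      (ι (⊖ 1ᴷ) + ι 1ᴷ) * Λ
        ≈⟨ *-congʳ (trans (sym (ι-+ _ _)) (trans (reflexive (≡.cong ι (K.-‿inverseˡ 1ᴷ))) ι-0)) ⟩
      0# * Λ
        ≈⟨ zeroˡ _ ⟩
      0#
        ∎
      where
      open import Algebra.Properties.Ring (CommutativeRing.ring fieldRing) using (-‿distribʳ-*)
      v = complete ℓ p ℓp≢0 x
      c = proj₁ (inverse (ℓ p) ℓp≢0)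
      Λ = linear (ℓ ∘ punchIn p) x

  insertAt-∀₂ : ∀ {a b} {A : Set a} {B : Set b} {n} (P : A → B → Set) {x : Fin n → A} {y : Fin n → B} {v w}
    (p : Fin (suc n)) → (∀ j → P (x j) (y j)) → P v w → ∀ i → P (insertAt x p v i) (insertAt y p w i)
  insertAt-∀₂ P zero    q r zero    = r
  insertAt-∀₂ P zero    q r (suc i) = q i
  insertAt-∀₂ {n = suc n} P (suc p) q r zero    = q zero
  insertAt-∀₂ {n = suc n} P (suc p) q r (suc i) = insertAt-∀₂ P p (q ∘ suc) r i

  embed-+ : ∀ A m a b → Algebra._≈_ (A [[ m ]]) (embed A m (Algebra._+_ A a b))
              (Algebra._+_ (A [[ m ]]) (embed A m a) (embed A m b))
  embed-+ A zero    a b         = Algebra.refl A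
  embed-+ A (suc m) a b zero    = embed-+ A m a b
  embed-+ A (suc m) a b (suc n) = sym (+-identityˡ 0#)
    where open Algebra (A [[ m ]])

  embed-ι : ∀ A m a → Algebra._≈_ (A [[ m ]]) (embed A m (Algebra.ι A a)) (Algebra.ι (A [[ m ]]) a)
  embed-ι A zero    a         = Algebra.refl A
  embed-ι A (suc m) a zero    = embed-ι A m a
  embed-ι A (suc m) a (suc n) = Algebra.refl (A [[ m ]])

  failure success : ∀ {A : Set} → Dec A → ℕ
  failure (yes _) = 0
  failure (no _)  = 1
  success (yes _) = 1
  success (no _)  = 0

  -- The source of both terms q - 1: it counts the a other than uⱼ / h(u) in the degree of a row,
  -- and the nonzero t at which the coefficient of V^k loses zeros.
  total-failure : ∀ {r} {P : Fin r → Set} (P? : ∀ i → Dec (P i)) a → P a → (∀ i → P i → i ≡ a) →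
                  total (λ i → failure (P? i)) ≡ r ℕ.∸ 1
  total-failure {r} {P} P? a pa unique = ≡.trans (≡.sym (ℕ.m+n∸n≡m _ 1)) (≡.cong (ℕ._∸ 1) (begin
    total (λ i → failure (P? i)) ℕ.+ 1
      ≡⟨ ≡.cong (total (λ i → failure (P? i)) ℕ.+_) (≡.trans (total-single a others) (hit (P? a))) ⟨
    total (λ i → failure (P? i)) ℕ.+ total (λ i → success (P? i))
      ≡⟨ total-+ (λ i → failure (P? i)) (λ i → success (P? i)) ⟨
    total (λ i → failure (P? i) ℕ.+ success (P? i))
      ≡⟨ total-cong (λ i → both (P? i)) ⟩
    total {r} (λ _ → 1)
      ≡⟨ ≡.trans (total-const r 1) (ℕ.*-identityʳ r) ⟩
    r ∎))
    where
    open ≡.≡-Reasoning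
    both : ∀ {A : Set} (d : Dec A) → failure d ℕ.+ success d ≡ 1
    both (yes _) = ≡.refl
    both (no _)  = ≡.refl
    hit : (d : Dec (P a)) → success d ≡ 1
    hit (yes _)  = ≡.refl
    hit (no ¬pa) = ⊥-elim (¬pa pa)
    miss : ∀ {i} → i ≢ a → (d : Dec (P i)) → success d ≡ 0
    miss i≢a (yes pi) = ⊥-elim (i≢a (unique _ pi))
    miss i≢a (no _)   = ≡.refl
    others : ∀ i → i ≢ a → success (P? i) ≡ 0
    others i i≢a = miss i≢a (P? i)

  sum-elements : ∀ (f : K → ℕ) → sum (map f (elements F)) ≡ total (f ∘ element)
  sum-elements f = ≡.trans (≡.cong sum (≡.trans (≡.sym (map-∘ (allFin q))) (map-tabulate id (f ∘ element))))
                           (go (f ∘ element))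
    where
    go : ∀ {m} (g : Fin m → ℕ) → sum (tabulate g) ≡ total g
    go {zero}  g = ≡.refl
    go {suc m} g = ≡.cong (g zero ℕ.+_) (go (g ∘ suc))

  elements-unique : Unique (elements F)
  elements-unique = Unique.map⁺ (λ {i} {j} e →
    ≡.trans (≡.sym (index-element i)) (≡.trans (≡.cong index e) (index-element j))) (Unique.allFin⁺ q)

  -- The polynomials adapted to the directions

  module Basis {m : ℕ} (O : Operations) where
    open Operations O
    open Expressions O

    -- h^r ∏ⱼ ∏ₐ (xⱼ − a h)^(e j a), where j runs over the coordinates other than p.
    basis : (Fin (suc m) → K) → Fin (suc m) → ℕ → (Fin m → Fin q → ℕ) → (Fin (suc m) → Carrier) → Carrier
    basis h p r e x =
      power r (linear h x) *
      product (λ j → product (λ i → power (e j i) (x (punchIn p j) + ι (⊖ element i) * linear h x)))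

  open Basis

  -- The factors 1 are the degrees of the linear forms; with them the expression is literally the
  -- bound built up by `power-Low` and `product-Low`.
  degree : ∀ {m} → ℕ → (Fin m → Fin q → ℕ) → ℕ
  degree r e = r ℕ.* 1 ℕ.+ total (λ j → total (λ i → e j i ℕ.* 1))

  basis-homo : ∀ {m O A} (φ : Homomorphism O A) h p r (e : Fin m → Fin q → ℕ) {x y} →
    (∀ i → Algebra._≈_ A (Homomorphism.⟦_⟧ φ (x i)) (y i)) →
    Algebra._≈_ A (Homomorphism.⟦_⟧ φ (basis O h p r e x)) (basis (operations A) h p r e y)
  basis-homo {A = A} φ h p r e {x} {y} eq =
    trans (*-homo _ _) (*-cong (power-homo φ r (linear-homo φ h eq))
      (product-homo φ λ j → product-homo φ λ i → power-homo φ (e j i)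
        (trans (+-homo _ _) (+-cong (eq _)
          (trans (*-homo _ _) (*-cong (ι-homo _) (linear-homo φ h eq)))))))
    where
    open Algebra A
    open Homomorphism φ

  module _ {A B : Algebra} (𝓖 : Grading A B) where
    private
      module A = Algebra A
      module B = Algebra B
    open Grading 𝓖

    basis-Low : ∀ {m} h p r (e : Fin m → Fin q → ℕ) {x} → (∀ i → Low 1 (x i)) →
                Low (degree r e) (basis (operations A) h p r e x)
    basis-Low h p r e l = Low-* (power-Low 𝓖 r (linear-Low 𝓖 h l))
      (product-Low 𝓖 λ j → product-Low 𝓖 λ i → power-Low 𝓖 (e j i)
        (Low-+ (l _) (Low-* (Low-ι _) (linear-Low 𝓖 h l))))

    top-basis : ∀ {m} h p r (e : Fin m → Fin q → ℕ) {x y} → (∀ i → Low 1 (x i)) → (∀ i → top 1 (x i) B.≈ y i) →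
                top (degree r e) (basis (operations A) h p r e x) B.≈ basis (operations B) h p r e y
    top-basis h p r e {x} l t = B.trans
      (top-* (power-Low 𝓖 r (linear-Low 𝓖 h l))
             (product-Low 𝓖 λ j → product-Low 𝓖 λ i → power-Low 𝓖 (e j i) (low i j)))
      (B.*-cong (top-power 𝓖 r (linear-Low 𝓖 h l) (top-linear 𝓖 h l t))
        (top-product 𝓖 (λ j → product-Low 𝓖 λ i → power-Low 𝓖 (e j i) (low i j))
          λ j → top-product 𝓖 (λ i → power-Low 𝓖 (e j i) (low i j)) λ i →
            top-power 𝓖 (e j i) (low i j)
              (B.trans (top-+ _ _ _) (B.+-cong (t _)
                (B.trans (top-* (Low-ι _) (linear-Low 𝓖 h l))
                  (B.*-cong (top-ι _) (top-linear 𝓖 h l t)))))))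
      where
      low : ∀ i j → Low 1 (A._+_ (x (punchIn p j)) (A.ι (⊖ element i) A.* Expressions.linear (operations A) h x))
      low i j = Low-+ (l _) (Low-* (Low-ι _) (linear-Low 𝓖 h l))

  exponent : ∀ {m} → (Fin m → ℕ) → (Fin m → Fin q) → Fin m → Fin q → ℕ
  exponent k α j i = k j ℕ.+ failure (i Fin.≟ α j)

  -- The power of h compensates the q|k| linear factors due to k, so the degree depends on e alone,
  -- and the top coefficients of all triples with one e are seen in the same degree.
  degree-exponent : ∀ {m} e (k : Fin m → ℕ) α → total k ℕ.* q ℕ.≤ e →
                    degree (e ℕ.∸ total k ℕ.* q) (exponent k α) ≡ e ℕ.+ m ℕ.* (q ℕ.∸ 1)
  degree-exponent {m} e k α le = begin
    r ℕ.* 1 ℕ.+ total (λ j → total (λ i → exponent k α j i ℕ.* 1))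
      ≡⟨ ≡.cong₂ ℕ._+_ (ℕ.*-identityʳ r) (total-cong λ j → ≡.trans
           (total-cong {q} (λ i → ℕ.*-identityʳ (exponent k α j i))) (≡.trans (total-+ {q} (λ _ → k j) (λ i → failure (i Fin.≟ α j)))
           (≡.cong₂ ℕ._+_ (≡.trans (total-const q (k j)) (ℕ.*-comm q (k j)))
                          (total-failure (Fin._≟ α j) (α j) ≡.refl (λ _ e → e))))) ⟩
    r ℕ.+ total (λ j → k j ℕ.* q ℕ.+ (q ℕ.∸ 1))
      ≡⟨ ≡.cong (r ℕ.+_) (≡.trans (total-+ (λ j → k j ℕ.* q) (λ _ → q ℕ.∸ 1))
           (≡.cong₂ ℕ._+_ (total-*ʳ k q) (total-const m (q ℕ.∸ 1)))) ⟩
    r ℕ.+ (total k ℕ.* q ℕ.+ m ℕ.* (q ℕ.∸ 1))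
      ≡⟨ ℕ.+-assoc r _ _ ⟨
    r ℕ.+ total k ℕ.* q ℕ.+ m ℕ.* (q ℕ.∸ 1)
      ≡⟨ ≡.cong (ℕ._+ m ℕ.* (q ℕ.∸ 1)) (ℕ.m∸n+n≡m le) ⟩
    e ℕ.+ m ℕ.* (q ℕ.∸ 1) ∎
    where
    open ≡.≡-Reasoning
    r = e ℕ.∸ total k ℕ.* q

  module _ {m : ℕ} where
    open Algebra (base [[ m ]])
    open Leading
    open Expressions (operations (base [[ m ]]))

    δ-diagonal : ∀ {m} (j : Fin m) → δ j j ≡ 1
    δ-diagonal zero    = ≡.refl
    δ-diagonal (suc j) = δ-diagonal j

    δ-off : ∀ {m} {i j : Fin m} → i ≢ j → δ i j ≡ 0
    δ-off {i = zero}  {zero}  i≢j = ⊥-elim (i≢j ≡.refl)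
    δ-off {i = zero}  {suc _} i≢j = ≡.refl
    δ-off {i = suc _} {zero}  i≢j = ≡.refl
    δ-off {i = suc i} {suc j} i≢j = δ-off (i≢j ∘ ≡.cong suc)

    -- The factor xⱼ − a h vanishes at the point exactly when a = (xⱼ / h)(u) = element (β j).
    basis-Lead : ∀ h p r (e : Fin m → Fin q → ℕ) (β : Fin m → Fin q) (u : Fin (suc m) → K) {η} {x} → η ≢ 0ᴷ →
      (∀ j → u (punchIn p j) ≡ element (β j) ⊗ η) →
      linear h x ≈ ι η → (∀ j → x (punchIn p j) ≈ ι (u (punchIn p j)) + generator base j) →
      Lead (λ l → e l (β l)) (basis (operations (base [[ m ]])) h p r e x)
    basis-Lead h p r e β u {η} {x} η≢0 u≡ h≈ x≈ = Lead-index {m} count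
      (Lead-* {m} {λ l → r ℕ.* 0} {λ l → total (λ j → total (λ i → e j i ℕ.* order j i l))}
        (Lead-power r (Lead-resp {m} (sym h≈) (Lead-ι {m} η≢0)))
        (Lead-product {l = m} (λ j → Lead-product {l = q} (λ i → Lead-power (e j i) (factor j i (i Fin.≟ β j))))))
      where
      open import Algebra.Properties.Ring (CommutativeRing.ring fieldRing) using (-‿distribˡ-*)
      open import Algebra.Properties.Group K.+-group using () renaming (x∙y⁻¹≈ε⇒x≈y to x-y≈0⇒x≈y)
      order′ : ∀ {A : Set} → Dec A → Fin m → Fin m → ℕ
      order′ (yes _) j = δ j
      order′ (no _)  j = λ _ → 0
      order : Fin m → Fin q → Fin m → ℕ
      order j i = order′ (i Fin.≟ β j) j
      value : Fin m → Fin q → K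
      value j i = u (punchIn p j) ⊕ (⊖ (element i ⊗ η))
      factor≈ : ∀ j i → x (punchIn p j) + ι (⊖ element i) * linear h x ≈ ι (value j i) + generator base j
      factor≈ j i = begin
        x (punchIn p j) + ι (⊖ element i) * linear h x
          ≈⟨ +-cong (x≈ j) (trans (*-congˡ h≈) (trans (sym (ι-* _ _)) (reflexive (≡.cong ι (≡.sym (-‿distribˡ-* _ _)))))) ⟩
        ι (u (punchIn p j)) + generator base j + ι (⊖ (element i ⊗ η))
          ≈⟨ trans (+-assoc _ _ _) (trans (+-congˡ (+-comm _ _)) (sym (+-assoc _ _ _))) ⟩
        ι (u (punchIn p j)) + ι (⊖ (element i ⊗ η)) + generator base j
          ≈⟨ +-congʳ (sym (ι-+ _ _)) ⟩
        ι (value j i) + generator base j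
          ∎
        where open import Relation.Binary.Reasoning.Setoid setoid
      cancel-η : ∀ {a b} → a ⊗ η ≡ b ⊗ η → a ≡ b
      cancel-η {a} {b} e = let c , ηc≡1 = inverse η η≢0 in
        ≡.trans (≡.sym (undo a c ηc≡1)) (≡.trans (≡.cong (_⊗ c) e) (undo b c ηc≡1))
        where
        undo : ∀ a c → η ⊗ c ≡ 1ᴷ → a ⊗ η ⊗ c ≡ a
        undo a c ηc≡1 = ≡.trans (K.*-assoc a η c) (≡.trans (≡.cong (a ⊗_) ηc≡1) (K.*-identityʳ a))
      factor : ∀ j i (d : Dec (i ≡ β j)) →
        Lead (order′ d j) (x (punchIn p j) + ι (⊖ element i) * linear h x)
      factor j i (yes ≡.refl) = Lead-resp {m} (sym (trans (factor≈ j i)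
        (trans (+-congʳ (trans (reflexive (≡.cong ι (≡.trans (≡.cong (_⊕ (⊖ (element i ⊗ η))) (u≡ j)) (K.-‿inverseʳ _)))) ι-0))
               (+-identityˡ _)))) (Lead-generator j)
      factor j i (no i≢β) = Lead-resp {m} (sym (factor≈ j i)) (Lead-unit j λ v≡0 → i≢β
        (≡.trans (≡.sym (index-element i)) (≡.trans (≡.cong index
          (cancel-η (≡.sym (≡.trans (≡.sym (u≡ j)) (x-y≈0⇒x≈y _ _ v≡0))))) (index-element (β j)))))
      count : ∀ l → r ℕ.* 0 ℕ.+ total (λ j → total (λ i → e j i ℕ.* order j i l)) ≡ e l (β l)
      count l = ≡.cong₂ ℕ._+_ (ℕ.*-zeroʳ r) (≡.trans
        (total-cong (λ j → ≡.trans (total-single (β j) (λ i i≢β → miss j i i≢β (i Fin.≟ β j)))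
                                   (hit j (β j Fin.≟ β j))))
        (≡.trans (total-single l (λ j j≢l → ≡.trans (≡.cong (e j (β j) ℕ.*_) (δ-off j≢l)) (ℕ.*-zeroʳ (e j (β j)))))
                 (≡.trans (≡.cong (e l (β l) ℕ.*_) (δ-diagonal l)) (ℕ.*-identityʳ _))))
        where
        miss : ∀ j i → i ≢ β j → (d : Dec (i ≡ β j)) → e j i ℕ.* order′ d j l ≡ 0
        miss j i i≢β (yes i≡β) = ⊥-elim (i≢β i≡β)
        miss j i i≢β (no _)    = ℕ.*-zeroʳ (e j i)
        hit : ∀ j (d : Dec (β j ≡ β j)) → e j (β j) ℕ.* order′ d j l ≡ e j (β j) ℕ.* δ j l
        hit j (yes _) = ≡.refl
        hit j (no ¬p) = ⊥-elim (¬p ≡.refl)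

  open Basis

  total-lookup : ∀ {m} (k : Vec ℕ m) → total (Vec.lookup k) ≡ Vec.sum k
  total-lookup []      = ≡.refl
  total-lookup (i ∷ k) = ≡.cong (i ℕ.+_) (total-lookup k)

  neighbour : ∀ {n} → Vec K n → Fin n → Operations.Carrier (polynomial n)
  neighbour {n} x l = ι (Vec.lookup x l) + coordinate l
    where open Operations (polynomial n)

  -- The triples (e, u, k) with their charts h = chart e: excess is e, monomial is k,
  -- and rich says that some line in direction u carries the multiplicity needed.
  record Entries (m : ℕ) (U : Set) (dir : U → Fin (suc m) → K) (μ : Vec K (suc m) → ℕ) : Set where
    field
      dir-injective : ∀ {u u′} c → c ≢ 0ᴷ → (∀ i → dir u′ i ≡ c ⊗ dir u i) → u ≡ u′
      chart         : ℕ → Fin (suc m) → K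
      pivot         : ℕ → Fin (suc m)
      chart-pivot   : ∀ e → chart e (pivot e) ≢ 0ᴷ
      count         : ℕ
      entry         : Fin count → ℕ × U × Vec ℕ m
      entry-injective : ∀ {i j} → entry i ≡ entry j → i ≡ j
      bound         : ℕ

    excess : Fin count → ℕ
    excess i = proj₁ (entry i)

    direction : Fin count → Fin (suc m) → K
    direction i = dir (proj₁ (proj₂ (entry i)))

    monomial : Fin count → Fin m → ℕ
    monomial i = Vec.lookup (proj₂ (proj₂ (entry i)))

    hyperplane : Fin count → Fin (suc m) → K
    hyperplane i = chart (excess i)

    line : (Fin (suc m) → K) → Fin count → K → Vec K (suc m)
    line b i t = Vec.tabulate λ l → b l ⊕ t ⊗ direction i l

    field
      excess<bound : ∀ i → excess i ℕ.< bound
      transversal  : ∀ i → KE.linear (hyperplane i) (direction i) ≢ 0ᴷ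
      small        : ∀ i → total (monomial i) ℕ.* q ℕ.≤ excess i
      rich         : ∀ i → ∃[ b ] (excess i ℕ.+ m ℕ.* (q ℕ.∸ 1)) ℕ.+ total (monomial i) ℕ.* (q ℕ.∸ 1)
                       ℕ.< total (λ t → μ (line b i (element t)))

  -- Linear independence of the adapted polynomials

  module Independence {m U dir μ} (𝓔 : Entries m U dir μ) where
    open Entries 𝓔

    -- The affine coordinates uⱼ / h(u) of a direction in its chart.
    slope : Fin count → Fin m → Fin q
    slope i j = index (direction i (punchIn (pivot (excess i)) j) ⊗ proj₁ (inverse _ (transversal i)))

    remainder : Fin count → ℕ
    remainder i = excess i ℕ.∸ total (monomial i) ℕ.* q

    exponents : Fin count → Fin m → Fin q → ℕ
    exponents i = exponent (monomial i) (slope i)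

    term : (O : Operations) → (Fin (suc m) → Operations.Carrier O) → Fin count → Operations.Carrier O
    term O x i = basis O (hyperplane i) (pivot (excess i)) (remainder i) (exponents i) x

    form : (O : Operations) → (Fin count → K) → (Fin (suc m) → Operations.Carrier O) → Operations.Carrier O
    form O c x = Expressions.linear O c (term O x)

    form-homo : ∀ {O A} (φ : Homomorphism O A) c {x y} →
      (∀ i → Algebra._≈_ A (Homomorphism.⟦_⟧ φ (x i)) (y i)) →
      Algebra._≈_ A (Homomorphism.⟦_⟧ φ (form O c x)) (form (operations A) c y)
    form-homo φ c eq = linear-homo φ c (λ i → basis-homo φ (hyperplane i) (pivot (excess i)) (remainder i) (exponents i) eq)

    expansion : (Fin count → K) → Vec K (suc m) → Operations.Carrier (polynomial (suc m))
    expansion c x = form (polynomial (suc m)) c (neighbour x)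

    deg : Fin count → ℕ
    deg i = degree (remainder i) (exponents i)

    deg≡ : ∀ i → deg i ≡ excess i ℕ.+ m ℕ.* (q ℕ.∸ 1)
    deg≡ i = degree-exponent (excess i) (monomial i) (slope i) (small i)

    slope-spec : ∀ i j → direction i (punchIn (pivot (excess i)) j) ≡
                         element (slope i j) ⊗ KE.linear (hyperplane i) (direction i)
    slope-spec i j = let c , ηc≡1 = inverse _ (transversal i) in ≡.sym (≡.trans
      (≡.cong₂ _⊗_ (element-index _) ≡.refl) (≡.trans (K.*-assoc _ c _)
      (≡.trans (≡.cong₂ _⊗_ ≡.refl (≡.trans (K.*-comm c _) ηc≡1)) (K.*-identityʳ _))))

    -- The coefficient of t^D σ^k on the line b + t (d + V(σ)) isolates c i₀: summands of
    -- smaller excess have too low a degree, and for those of equal excess the leading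
    -- monomial in σ does not divide σ^k.
    module Step (c : Fin count → K) (vanish : ∀ x → VanishesTo (suc m) (μ x) (expansion c x)) (i₀ : Fin count)
      (later   : ∀ i → excess i₀ ℕ.< excess i → c i ≡ 0ᴷ)
      (earlier : ∀ i → excess i ≡ excess i₀ → total (monomial i) ℕ.< total (monomial i₀) → c i ≡ 0ᴷ) where

      private
        h = hyperplane i₀
        p = pivot (excess i₀)
        hp≢0 = chart-pivot (excess i₀)
        d = direction i₀
        k = monomial i₀
        w = total k
        η = KE.linear h d
        b = proj₁ (rich i₀)
        D = deg i₀
        module R = Algebra (series base [[ m ]])
        module C = Algebra (base [[ m ]])
        𝓖 = iterGrading degreeGrading m
        module 𝓖 = Grading 𝓖
        σᴿ : Fin m → R.Carrier
        σᴿ = generator (series base)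
        σᶜ : Fin m → C.Carrier
        σᶜ = generator base

      -- The superscript R refers to K[[t]][[σ]], where the generic line lives, and C to K[[σ]],
      -- where the coefficients of powers of t live. The σ are the coordinates of the generic vector
      -- off the pivot.
      Vᴿ : Fin (suc m) → R.Carrier
      Vᴿ = complete (series base [[ m ]]) h p hp≢0 σᴿ

      Vᶜ : Fin (suc m) → C.Carrier
      Vᶜ = complete (base [[ m ]]) h p hp≢0 σᶜ

      embedding : Algebra.Carrier (series base) → R.Carrier
      embedding = embed (series base) m

      tᴿ : R.Carrier
      tᴿ = embedding (PowerSeries.indeterminate fieldRing)

      X : Fin (suc m) → R.Carrier
      X l = R.ι (b l) R.+ tᴿ R.* (R.ι (d l) R.+ Vᴿ l)

      Y : Fin (suc m) → C.Carrier
      Y l = C.ι (d l) C.+ Vᶜ l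

      V-graded : ∀ l → 𝓖.Low 0 (Vᴿ l) × 𝓖.top 0 (Vᴿ l) C.≈ Vᶜ l
      V-graded = insertAt-∀₂ (λ x y → 𝓖.Low 0 x × 𝓖.top 0 x C.≈ y) p
        (λ j → generator-Low degreeGrading j , top-generator degreeGrading j)
        ( 𝓖.Low-* (𝓖.Low-ι _) lowΛ
        , C.trans (𝓖.top-* (𝓖.Low-ι _) lowΛ)
            (C.*-cong (𝓖.top-ι _) (top-linear 𝓖 (h ∘ punchIn p) (generator-Low degreeGrading) (top-generator degreeGrading))))
        where
        lowΛ : 𝓖.Low 0 (Expressions.linear (operations (series base [[ m ]])) (h ∘ punchIn p) σᴿ)
        lowΛ = linear-Low 𝓖 (h ∘ punchIn p) (generator-Low degreeGrading)

      direction-Low : ∀ l → 𝓖.Low 0 (R.ι (d l) R.+ Vᴿ l)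
      direction-Low l = 𝓖.Low-+ (𝓖.Low-ι _) (proj₁ (V-graded l))

      t-Low : 𝓖.Low 1 tᴿ
      t-Low = embed-Low degreeGrading m λ { (suc (suc i)) _ → ≡.refl ; (suc zero) (ℕ.s≤s ()) }

      X-Low : ∀ l → 𝓖.Low 1 (X l)
      X-Low l = 𝓖.Low-+ (𝓖.Low-mono ℕ.z≤n (𝓖.Low-ι (b l))) (𝓖.Low-* t-Low (direction-Low l))

      X-top : ∀ l → 𝓖.top 1 (X l) C.≈ Y l
      X-top l = begin
        𝓖.top 1 (X l)
          ≈⟨ 𝓖.top-+ 1 _ _ ⟩
        𝓖.top 1 (R.ι (b l)) C.+ 𝓖.top 1 (tᴿ R.* (R.ι (d l) R.+ Vᴿ l))
          ≈⟨ C.+-cong (𝓖.top-vanish ℕ.≤-refl (𝓖.Low-ι (b l))) (𝓖.top-* t-Low (direction-Low l)) ⟩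
        C.0# C.+ 𝓖.top 1 tᴿ C.* 𝓖.top 0 (R.ι (d l) R.+ Vᴿ l)
          ≈⟨ C.trans (C.+-identityˡ _) (C.*-cong (C.trans (top-embed degreeGrading m 1 _) (embed-1 base m)) (𝓖.top-+ 0 _ _)) ⟩
        C.1# C.* (𝓖.top 0 (R.ι (d l)) C.+ 𝓖.top 0 (Vᴿ l))
          ≈⟨ C.trans (C.*-identityˡ _) (C.+-cong (𝓖.top-ι (d l)) (proj₂ (V-graded l))) ⟩
        Y l
          ∎
        where open import Relation.Binary.Reasoning.Setoid C.setoid

      module _ (t₀ : K) where
        private
          -- The weight of the variables σ. In `shift` below, the summand t₀ V needs positive order
          -- from V itself unless t₀ = 0, when it is zero. So weight 0 suffices at t₀ = 0; weight 1
          -- there as well would give the constant 2 in place of 2 - 1/q.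
          ω = failure (t₀ ≟ᴷ 0ᴷ)
          𝓕 = iterFiltration ω (RootCount.rootFiltration t₀) m
          module 𝓕 = Filtration 𝓕

        -- X = (b + t₀ d) + shift, and shift has positive order at t = t₀.
        shift : Fin (suc m) → R.Carrier
        shift l = embedding (RootCount.X- t₀) R.* (R.ι (d l) R.+ Vᴿ l) R.+ R.ι t₀ R.* Vᴿ l

        V-Fil : ∀ l → 𝓕.Fil ω (Vᴿ l)
        V-Fil = insertAt-∀₂ {B = R.Carrier} (λ x _ → 𝓕.Fil ω x) {y = Vᴿ ∘ punchIn p} {w = Vᴿ p} p
          (generator-Fil ω (RootCount.rootFiltration t₀))
          (𝓕.Fil-* (𝓕.Fil-ι _) (linear-Fil 𝓕 (h ∘ punchIn p) (generator-Fil ω (RootCount.rootFiltration t₀))))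

        shift-Fil : ∀ l → 𝓕.Fil 1 (shift l)
        shift-Fil l = 𝓕.Fil-+
          (𝓕.Fil-* (embed-Fil ω (RootCount.rootFiltration t₀) m root)
                   (𝓕.Fil-+ (𝓕.Fil-ι (d l)) (𝓕.Fil-anti ℕ.z≤n (V-Fil l))))
          (scaled (t₀ ≟ᴷ 0ᴷ) (V-Fil l))
          where
          open Algebra (series base) using (*-identityʳ; sym; trans)
          root : RootCount.Divides t₀ 1 (RootCount.X- t₀)
          root = Algebra.1# (series base) , RootCount.Poly-ι 1ᴷ ,
                 sym (trans (*-identityʳ _) (*-identityʳ _))
          scaled : (z : Dec (t₀ ≡ 0ᴷ)) → 𝓕.Fil (failure z) (Vᴿ l) → 𝓕.Fil 1 (R.ι t₀ R.* Vᴿ l)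
          scaled (yes t₀≡0) _ = 𝓕.Fil-resp (R.sym (R.trans
            (R.*-congʳ (R.trans (R.reflexive (≡.cong R.ι t₀≡0)) R.ι-0)) (R.zeroˡ _))) 𝓕.Fil-0
          scaled (no _) v = 𝓕.Fil-* (𝓕.Fil-ι t₀) v

        shift≈ : ∀ l → R.ι (b l ⊕ t₀ ⊗ d l) R.+ shift l R.≈ X l
        shift≈ l = begin
          R.ι (b l ⊕ t₀ ⊗ d l) R.+ (e R.* y R.+ s R.* Vᴿ l)
            ≈⟨ R.+-congʳ (R.trans (R.ι-+ _ _) (R.+-congˡ (R.ι-* _ _))) ⟩
          R.ι (b l) R.+ s R.* R.ι (d l) R.+ (e R.* y R.+ s R.* Vᴿ l)
            ≈⟨ R.trans (R.+-assoc _ _ _) (R.+-congˡ (x∙yz≈y∙xz _ _ _)) ⟩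
          R.ι (b l) R.+ (e R.* y R.+ (s R.* R.ι (d l) R.+ s R.* Vᴿ l))
            ≈⟨ R.+-congˡ (R.+-congˡ (R.distribˡ _ _ _)) ⟨
          R.ι (b l) R.+ (e R.* y R.+ s R.* y)
            ≈⟨ R.+-congˡ (R.distribʳ _ _ _) ⟨
          R.ι (b l) R.+ (e R.+ s) R.* y
            ≈⟨ R.+-congˡ (R.*-congʳ root+) ⟩
          X l
            ∎
          where
          open import Relation.Binary.Reasoning.Setoid R.setoid
          open import Algebra.Properties.CommutativeSemigroup
            (CommutativeRing.+-commutativeSemigroup (Algebra.ring (series base [[ m ]]))) using (x∙yz≈y∙xz)
          e = embedding (RootCount.X- t₀)
          s = R.ι t₀
          y = R.ι (d l) R.+ Vᴿ l
          root+ : e R.+ s R.≈ tᴿ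
          root+ = R.trans (R.+-cong (embed-+ (series base) m _ _) R.refl) (R.trans (R.+-assoc _ _ _)
            (R.trans (R.+-congˡ (R.trans (R.+-congʳ (embed-ι (series base) m _))
              (R.trans (R.sym (R.ι-+ _ _)) (R.trans (R.reflexive (≡.cong R.ι (K.-‿inverseˡ t₀))) R.ι-0))))
            (R.+-identityʳ _)))

        -- The expansion at b + t₀ d, evaluated at `shift`, is the combination on the generic line.
        -- Since `shift` has order 1 the value has order μ, and the coefficient of σ^k loses w ω of
        -- it.
        form-Divides : RootCount.Divides t₀ (μ (line b i₀ t₀) ℕ.∸ w ℕ.* ω)
                         (coef (series base) k (form (operations (series base [[ m ]])) c X))
        form-Divides = coef-Fil ω (RootCount.rootFiltration t₀) k
          (𝓕.Fil-resp (form-homo (evaluate shift) c {x = neighbour x} hom) (evaluate-Fil 𝓕 shift shift-Fil (expansion c x) (vanish x)))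
          where
          open Evaluation (series base [[ m ]])
          open Homomorphism (evaluate {suc m} shift)
          x = line b i₀ t₀
          hom : ∀ l → ⟦ neighbour x l ⟧ R.≈ X l
          hom l = R.trans (+-homo (Operations.ι (polynomial (suc m)) (Vec.lookup x l)) (coordinate l)) (R.trans
            (R.+-cong (R.trans (ι-homo (Vec.lookup x l)) (R.reflexive (≡.cong R.ι (Vec.lookup∘tabulate (λ l → b l ⊕ t₀ ⊗ d l) l)))) (evaluate-coordinate shift l))
            (shift≈ l))

      deg-≤ : ∀ i → excess i ℕ.≤ excess i₀ → deg i ℕ.≤ D
      deg-≤ i le = ℕ.≤-trans (ℕ.≤-reflexive (deg≡ i))
        (ℕ.≤-trans (ℕ.+-monoˡ-≤ _ le) (ℕ.≤-reflexive (≡.sym (deg≡ i₀))))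

      deg-< : ∀ i → excess i ℕ.< excess i₀ → deg i ℕ.< D
      deg-< i lt = ℕ.≤-trans (ℕ.≤-reflexive (≡.cong suc (deg≡ i)))
        (ℕ.≤-trans (ℕ.+-monoˡ-< _ lt) (ℕ.≤-reflexive (≡.sym (deg≡ i₀))))

      summand : Fin count → R.Carrier
      summand i = R.ι (c i) R.* term (operations (series base [[ m ]])) X i

      summand-zero : ∀ {i} → c i ≡ 0ᴷ → summand i R.≈ R.0#
      summand-zero e = R.trans (R.*-congʳ (R.trans (R.reflexive (≡.cong R.ι e)) R.ι-0)) (R.zeroˡ _)

      term-Low : ∀ i → 𝓖.Low (deg i) (term (operations (series base [[ m ]])) X i)
      term-Low i = basis-Low 𝓖 (hyperplane i) (pivot (excess i)) (remainder i) (exponents i) X-Low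

      summand-Low : ∀ i → 𝓖.Low (deg i) (summand i)
      summand-Low i = 𝓖.Low-* (𝓖.Low-ι (c i)) (term-Low i)

      -- Summands of larger excess have coefficient zero by `later`; for the others the degree is at
      -- most `D`, being governed by the excess.
      form-Low : 𝓖.Low D (form (operations (series base [[ m ]])) c X)
      form-Low = sum-Low c (term (operations (series base [[ m ]])) X) each
        where
        each : ∀ i → 𝓖.Low D (summand i)
        each i with excess i ℕ.≤? excess i₀
        ... | yes le = 𝓖.Low-mono (deg-≤ i le) (summand-Low i)
        ... | no ¬le = 𝓖.Low-resp (R.sym (summand-zero {i} (later i (ℕ.≰⇒> ¬le)))) 𝓖.Low-0
        sum-Low : ∀ {n} (c : Fin n → K) x → (∀ i → 𝓖.Low D (R.ι (c i) R.* x i)) →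
                  𝓖.Low D (Expressions.linear (operations (series base [[ m ]])) c x)
        sum-Low {zero}  c x l = 𝓖.Low-mono ℕ.z≤n (𝓖.Low-ι 0ᴷ)
        sum-Low {suc n} c x l = 𝓖.Low-+ (l zero) (sum-Low (c ∘ suc) (x ∘ suc) (l ∘ suc))

      -- The orders from `form-Divides`, summed over t, are at least the sum of μ on the line minus
      -- w (q - 1), and `rich` makes this exceed `D`.
      coef-form≡0 : coef (series base) k (form (operations (series base [[ m ]])) c X) D ≡ 0ᴷ
      coef-form≡0 = RootCount.too-many-roots (λ t → μ (line b i₀ t) ℕ.∸ w ℕ.* failure (t ≟ᴷ 0ᴷ))
        {g = coef (series base) k (form (operations (series base [[ m ]])) c X)} {D = D}
        (coef-Low degreeGrading k form-Low) (elements F) elements-unique form-Divides enough D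
        where
        open ℕ.≤-Reasoning
        μ′ ω′ : Fin q → ℕ
        μ′ i = μ (line b i₀ (element i))
        ω′ i = failure (element i ≟ᴷ 0ᴷ)
        enough : D ℕ.< sum (map (λ t → μ (line b i₀ t) ℕ.∸ w ℕ.* failure (t ≟ᴷ 0ᴷ)) (elements F))
        enough = ℕ.+-cancelʳ-< (w ℕ.* (q ℕ.∸ 1)) _ _ (begin-strict
          D ℕ.+ w ℕ.* (q ℕ.∸ 1)
            ≡⟨ ≡.cong (ℕ._+ w ℕ.* (q ℕ.∸ 1)) (deg≡ i₀) ⟩
          excess i₀ ℕ.+ m ℕ.* (q ℕ.∸ 1) ℕ.+ w ℕ.* (q ℕ.∸ 1)
            <⟨ proj₂ (rich i₀) ⟩
          total μ′
            ≤⟨ total-mono (λ i → ℕ.≤-trans (ℕ.m≤n+m∸n (μ′ i) (ω′ i ℕ.* w)) (ℕ.≤-reflexive (ℕ.+-comm (ω′ i ℕ.* w) _))) ⟩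
          total (λ i → μ′ i ℕ.∸ ω′ i ℕ.* w ℕ.+ ω′ i ℕ.* w)
            ≡⟨ total-+ (λ i → μ′ i ℕ.∸ ω′ i ℕ.* w) (λ i → ω′ i ℕ.* w) ⟩
          total (λ i → μ′ i ℕ.∸ ω′ i ℕ.* w) ℕ.+ total (λ i → ω′ i ℕ.* w)
            ≡⟨ ≡.cong₂ ℕ._+_
                 (≡.trans (total-cong (λ i → ≡.cong (μ′ i ℕ.∸_) (ℕ.*-comm (ω′ i) w))) (≡.sym (sum-elements _)))
                 (≡.trans (total-*ʳ ω′ w) (≡.trans (ℕ.*-comm _ w) (≡.cong (w ℕ.*_)
                   (total-failure (λ i → element i ≟ᴷ 0ᴷ) (index 0ᴷ) (element-index 0ᴷ)
                     (λ i e → ≡.trans (≡.sym (index-element i)) (≡.cong index e)))))) ⟩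
          sum (map (λ t → μ (line b i₀ t) ℕ.∸ w ℕ.* failure (t ≟ᴷ 0ᴷ)) (elements F)) ℕ.+ w ℕ.* (q ℕ.∸ 1)
            ∎)

      leading : R.Carrier → K
      leading g = coef base k (𝓖.top D g)

      leading-cong : ∀ {f g} → f R.≈ g → leading f ≡ leading g
      leading-cong f≈g = coef-cong base k (𝓖.top-cong f≈g)

      leading-0 : leading R.0# ≡ 0ᴷ
      leading-0 = ≡.trans (coef-cong base k 𝓖.top-0) (coef-0 base k)

      leading-+ : ∀ f g → leading (f R.+ g) ≡ leading f ⊕ leading g
      leading-+ f g = ≡.trans (coef-cong base k (𝓖.top-+ D f g)) (coef-+ base k _ _)

      leading-linear : ∀ {n} (c : Fin n → K) x i → (∀ j → j ≢ i → leading (R.ι (c j) R.* x j) ≡ 0ᴷ) →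
        leading (Expressions.linear (operations (series base [[ m ]])) c x) ≡ leading (R.ι (c i) R.* x i)
      leading-linear {suc n} c x zero z = ≡.trans (leading-+ _ _)
        (≡.trans (≡.cong₂ _⊕_ ≡.refl (vanishing (c ∘ suc) (x ∘ suc) (λ j → z (suc j) λ ()))) (K.+-identityʳ _))
        where
        vanishing : ∀ {n} (c : Fin n → K) x → (∀ j → leading (R.ι (c j) R.* x j) ≡ 0ᴷ) →
                    leading (Expressions.linear (operations (series base [[ m ]])) c x) ≡ 0ᴷ
        vanishing {zero}  c x z = ≡.trans (leading-cong R.ι-0) leading-0
        vanishing {suc n} c x z = ≡.trans (leading-+ _ _)
          (≡.trans (≡.cong₂ _⊕_ (z zero) (vanishing (c ∘ suc) (x ∘ suc) (z ∘ suc))) (K.+-identityˡ 0ᴷ))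
      leading-linear {suc n} c x (suc i) z = ≡.trans (leading-+ _ _) (≡.trans (≡.cong₂ _⊕_ (z zero λ ())
        (leading-linear (c ∘ suc) (x ∘ suc) i (λ j j≢i → z (suc j) (j≢i ∘ Fin.suc-injective)))) (K.+-identityˡ _))

      leading-summand : ∀ i → deg i ≡ D →
        leading (summand i) ≡ c i ⊗ coef base k (term (operations (base [[ m ]])) Y i)
      leading-summand i e = ≡.trans (coef-cong base k (C.trans
        (C.reflexive (≡.cong (λ v → 𝓖.top v (summand i)) (≡.sym e)))
        (C.trans (𝓖.top-* (𝓖.Low-ι (c i)) (term-Low i))
          (C.*-cong (𝓖.top-ι (c i)) (top-basis 𝓖 (hyperplane i) (pivot (excess i)) (remainder i) (exponents i) X-Low X-top)))))
        (coef-ι* base k (c i) _)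

      -- Triples of equal excess share chart and pivot, so the polynomial of i can be examined at
      -- direction i₀: there h takes the constant value η, and the coordinates off the pivot are
      -- those of d plus σ. The leading exponent is that of i, raised by one where the slopes of i
      -- and i₀ differ.
      Y-Lead : ∀ i → excess i ≡ excess i₀ →
        Leading.Lead (λ l → exponents i l (slope i₀ l)) (term (operations (base [[ m ]])) Y i)
      Y-Lead i e = subst (λ v → Leading.Lead (λ l → exponents i l (slope i₀ l))
          (basis (operations (base [[ m ]])) (chart v) (pivot v) (remainder i) (exponents i) Y)) (≡.sym e)
        (basis-Lead h p (remainder i) (exponents i) (slope i₀) d {x = Y} (transversal i₀) (slope-spec i₀)
          (C.trans (linear-ι+ (base [[ m ]]) h d Vᶜ)
            (C.trans (C.+-congˡ (linear-complete (base [[ m ]]) h p hp≢0 σᶜ)) (C.+-identityʳ _)))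
          (λ j → C.+-congˡ (C.reflexive (insertAt-punchIn σᶜ p _ j))))

      failure≡0 : ∀ {A : Set} (a? : Dec A) → failure a? ≡ 0 → A
      failure≡0 (yes a) _ = a

      -- Affine coordinates determine a point of the chart. Off the pivot, proportionality is read
      -- off from the slopes; at the pivot it follows from the values of h, whose pivot coefficient
      -- is nonzero.
      same-direction : ∀ i → excess i ≡ excess i₀ → (∀ j → slope i₀ j ≡ slope i j) →
                       proj₁ (proj₂ (entry i₀)) ≡ proj₁ (proj₂ (entry i))
      same-direction i e s = dir-injective (ηᵢ ⊗ c₀) (Leading.K-integral (transversal i) c₀≢0) proportional
        where
        ηᵢ = KE.linear (hyperplane i) (direction i)
        c₀ = proj₁ (inverse η (transversal i₀))
        ηc₀≡1 = proj₂ (inverse η (transversal i₀))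
        c₀≢0 : c₀ ≢ 0ᴷ
        c₀≢0 z = 1≢0 (≡.trans (≡.sym ηc₀≡1) (≡.trans (≡.cong (η ⊗_) z) (K.zeroʳ η)))
        λᵢ = ηᵢ ⊗ c₀
        ηᵢ≡ : ηᵢ ≡ λᵢ ⊗ η
        ηᵢ≡ = ≡.sym (≡.trans (K.*-assoc ηᵢ c₀ η) (≡.trans (≡.cong (ηᵢ ⊗_) (≡.trans (K.*-comm c₀ η) ηc₀≡1)) (K.*-identityʳ ηᵢ)))
        off-pivot : ∀ j → direction i (punchIn p j) ≡ λᵢ ⊗ d (punchIn p j)
        off-pivot j = begin
          direction i (punchIn p j)
            ≡⟨ ≡.cong (λ v → direction i (punchIn (pivot v) j)) e ⟨
          direction i (punchIn (pivot (excess i)) j)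
            ≡⟨ slope-spec i j ⟩
          element (slope i j) ⊗ ηᵢ
            ≡⟨ ≡.cong₂ _⊗_ (≡.cong element (≡.sym (s j))) ηᵢ≡ ⟩
          element (slope i₀ j) ⊗ (λᵢ ⊗ η)
            ≡⟨ x∙yz≈y∙xz _ λᵢ η ⟩
          λᵢ ⊗ (element (slope i₀ j) ⊗ η)
            ≡⟨ ≡.cong (λᵢ ⊗_) (slope-spec i₀ j) ⟨
          λᵢ ⊗ d (punchIn p j)
            ∎
          where
          open ≡.≡-Reasoning
          open import Algebra.Properties.CommutativeSemigroup K.*-commutativeSemigroup using (x∙yz≈y∙xz)
        linear-scale : ∀ {n} (ℓ v : Fin n → K) → KE.linear ℓ (λ l → λᵢ ⊗ v l) ≡ λᵢ ⊗ KE.linear ℓ v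
        linear-scale {zero}  ℓ v = ≡.sym (K.zeroʳ λᵢ)
        linear-scale {suc n} ℓ v = ≡.trans (≡.cong₂ _⊕_ (x∙yz≈y∙xz (ℓ zero) λᵢ (v zero)) (linear-scale (ℓ ∘ suc) (v ∘ suc)))
                                    (≡.sym (K.distribˡ λᵢ _ _))
          where open import Algebra.Properties.CommutativeSemigroup K.*-commutativeSemigroup using (x∙yz≈y∙xz)
        at-pivot : direction i p ≡ λᵢ ⊗ d p
        at-pivot = cancelˡ (h p) hp≢0 (+-cancelʳ (KE.linear (h ∘ punchIn p) (direction i ∘ punchIn p)) _ _ (begin
          h p ⊗ direction i p ⊕ KE.linear (h ∘ punchIn p) (direction i ∘ punchIn p)
            ≡⟨ linear-remove base p h (direction i) ⟨
          KE.linear h (direction i)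
            ≡⟨ ≡.cong (λ v → KE.linear (chart v) (direction i)) e ⟨
          ηᵢ
            ≡⟨ ηᵢ≡ ⟩
          λᵢ ⊗ η
            ≡⟨ linear-scale h d ⟨
          KE.linear h (λ l → λᵢ ⊗ d l)
            ≡⟨ linear-remove base p h (λ l → λᵢ ⊗ d l) ⟩
          h p ⊗ (λᵢ ⊗ d p) ⊕ KE.linear (h ∘ punchIn p) (λ j → λᵢ ⊗ d (punchIn p j))
            ≡⟨ ≡.cong (h p ⊗ (λᵢ ⊗ d p) ⊕_) (linear-cong base (h ∘ punchIn p) off-pivot) ⟨
          h p ⊗ (λᵢ ⊗ d p) ⊕ KE.linear (h ∘ punchIn p) (direction i ∘ punchIn p)
            ∎))
          where
          open ≡.≡-Reasoning
          open import Algebra.Properties.Group K.+-group using () renaming (∙-cancelʳ to +-cancelʳ)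
          cancelˡ : ∀ a {x y} → a ≢ 0ᴷ → a ⊗ x ≡ a ⊗ y → x ≡ y
          cancelˡ a a≢0 ax≡ay = let a⁻¹ , aa⁻¹≡1 = inverse a a≢0 in
            ≡.trans (≡.sym (undo aa⁻¹≡1 _)) (≡.trans (≡.cong (a⁻¹ ⊗_) ax≡ay) (undo aa⁻¹≡1 _))
            where
            undo : ∀ {a a⁻¹} → a ⊗ a⁻¹ ≡ 1ᴷ → ∀ x → a⁻¹ ⊗ (a ⊗ x) ≡ x
            undo {a} {a⁻¹} aa⁻¹≡1 x = ≡.trans (≡.sym (K.*-assoc a⁻¹ a x))
              (≡.trans (≡.cong (_⊗ x) (≡.trans (K.*-comm a⁻¹ a) aa⁻¹≡1)) (K.*-identityˡ x))
        proportional : ∀ l → direction i l ≡ λᵢ ⊗ d l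
        proportional l with p Fin.≟ l
        ... | yes ≡.refl = at-pivot
        ... | no p≢l = subst (λ v → direction i v ≡ λᵢ ⊗ d v) (Fin.punchIn-punchOut p≢l) (off-pivot _)

      -- The hypotheses squeeze: the monomial of i lies below its raised exponents and these below
      -- k, while its degree is at least that of k. All three agree, so nothing was raised and the
      -- slopes coincide.
      same-entry : ∀ i → excess i ≡ excess i₀ → total (monomial i₀) ℕ.≤ total (monomial i) →
        (∀ l → exponents i l (slope i₀ l) ℕ.≤ k l) → i ≡ i₀
      same-entry i e w≤ le = entry-injective (≡.cong₂ _,_ e (≡.cong₂ _,_
        (≡.sym (same-direction i e λ j → failure≡0 (slope i₀ j Fin.≟ slope i j)
          (ℕ.+-cancelˡ-≡ (monomial i j) _ 0 (≡.trans (exact j) (≡.trans (≡.sym (k≡ j)) (≡.sym (ℕ.+-identityʳ _)))))))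
        (≡.trans (≡.sym (Vec.tabulate∘lookup _)) (≡.trans (Vec.tabulate-cong k≡) (Vec.tabulate∘lookup _)))))
        where
        k≡ : ∀ l → monomial i l ≡ k l
        k≡ = total-squeeze (λ l → ℕ.≤-trans (ℕ.m≤m+n _ _) (le l)) w≤
        exact : ∀ l → exponents i l (slope i₀ l) ≡ k l
        exact l = ℕ.≤-antisym (le l) (ℕ.≤-trans (ℕ.≤-reflexive (≡.sym (k≡ l))) (ℕ.m≤m+n _ _))

      others-vanish : ∀ i → i ≢ i₀ → leading (summand i) ≡ 0ᴷ
      others-vanish i i≢i₀ with ℕ.<-cmp (excess i) (excess i₀)
      ... | tri> _ _ gt = ≡.trans (leading-cong (summand-zero {i} (later i gt))) leading-0
      ... | tri< lt _ _ = ≡.trans (coef-cong base k (𝓖.top-vanish (deg-< i lt) (summand-Low i))) (coef-0 base k)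
      ... | tri≈ _ e _ with w ℕ.≤? total (monomial i)
      ... | no w≰ = ≡.trans (leading-cong (summand-zero {i} (earlier i e (ℕ.≰⇒> w≰)))) leading-0
      -- Equal excess and a monomial of no smaller degree: by `same-entry` some exponent of the
      -- leading monomial exceeds that of σ^k, so σ^k does not occur.
      ... | yes w≤ = ≡.trans (leading-summand i (≡.trans (deg≡ i) (≡.trans (≡.cong (ℕ._+ m ℕ.* (q ℕ.∸ 1)) e) (≡.sym (deg≡ i₀)))))
        (≡.trans (≡.cong (c i ⊗_) (Leading.AtLeast-coef _ k _ (proj₁ (Y-Lead i e)) (l , ℕ.≰⇒> l≰))) (K.zeroʳ (c i)))
        where
        some = Fin.¬∀⟶∃¬ m _ (λ l → exponents i l (slope i₀ l) ℕ.≤? k l)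
                 (i≢i₀ ∘ same-entry i e w≤)
        l = proj₁ some
        l≰ = proj₂ some

      coefficient≡0 : c i₀ ≡ 0ᴷ
      coefficient≡0 = let z , yz≡1 = inverse y y≢0 in
        ≡.trans (≡.sym (K.*-identityʳ (c i₀))) (≡.trans (≡.cong (c i₀ ⊗_) (≡.sym yz≡1))
          (≡.trans (≡.sym (K.*-assoc (c i₀) y z)) (≡.trans (≡.cong (_⊗ z) cy≡0) (K.zeroˡ z))))
        where
        y = coef base k (term (operations (base [[ m ]])) Y i₀)
        failure-refl : ∀ j → failure (j Fin.≟ j) ≡ 0
        failure-refl j with j Fin.≟ j
        ... | yes _ = ≡.refl
        ... | no ¬e = ⊥-elim (¬e ≡.refl)
        y≢0 : y ≢ 0ᴷ
        y≢0 = proj₂ (Leading.Lead-index {m} (λ l → ≡.trans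
          (≡.cong (k l ℕ.+_) (failure-refl (slope i₀ l))) (ℕ.+-identityʳ (k l))) (Y-Lead i₀ ≡.refl))
        cy≡0 : c i₀ ⊗ y ≡ 0ᴷ
        cy≡0 = ≡.trans (≡.sym (leading-summand i₀ ≡.refl))
          (≡.trans (≡.sym (leading-linear c _ i₀ others-vanish))
          (≡.trans (coef-top degreeGrading D k _) coef-form≡0))

    -- The fuel `f` bounds the distance from the excess to `bound`, so a smaller `f` covers larger
    -- excesses and supplies `later`; the inner induction on `s` supplies `earlier`.
    independent : ∀ c → (∀ x → VanishesTo (suc m) (μ x) (expansion c x)) → ∀ i → c i ≡ 0ᴷ
    independent c vanish i = downward bound i (ℕ.m≤n+m bound (excess i))
      where
      downward : ∀ f i → bound ℕ.≤ excess i ℕ.+ f → c i ≡ 0ᴷ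
      downward zero    i le = ⊥-elim (ℕ.<⇒≱ (excess<bound i) (subst (bound ℕ.≤_) (ℕ.+-identityʳ _) le))
      downward (suc f) i le = upward (suc (total (monomial i))) i le ℕ.≤-refl
        where
        upward : ∀ s i → bound ℕ.≤ excess i ℕ.+ suc f → total (monomial i) ℕ.< s → c i ≡ 0ᴷ
        upward (suc s) i le (ℕ.s≤s w≤s) = Step.coefficient≡0 c vanish i
          (λ j lt → downward f j (ℕ.≤-trans le (ℕ.≤-trans (ℕ.≤-reflexive (ℕ.+-suc _ f)) (ℕ.+-monoˡ-≤ f lt))))
          (λ j e lt → upward s j (subst (λ v → bound ℕ.≤ v ℕ.+ suc f) (≡.sym e) le) (ℕ.<-≤-trans lt w≤s))

    -- For each jet (x, β) the coefficient of X^β in the expansion at x is a linear functional of c.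
    -- By `independent` these functionals have trivial common kernel.
    count-≤ : (jets : List (Vec K (suc m) × Vec ℕ (suc m))) →
              (∀ x β → Vec.sum β ℕ.< μ x → (x , β) ∈ jets) → count ℕ.≤ length jets
    count-≤ jets all = trivial-kernel⇒≤
      (λ s i → polyCoef (proj₂ (lookup jets s)) (terms (proj₁ (lookup jets s)) i))
      λ c zeros → independent c λ x β lt → ≡.trans (polyCoef-linear β c (terms x))
        (subst (λ (x , β) → KE.linear c (λ i → polyCoef β (terms x i)) ≡ 0ᴷ)
               (≡.sym (lookup-index (all x β lt))) (zeros (Any.index (all x β lt))))
      where
      terms : Vec K (suc m) → Fin count → Operations.Carrier (polynomial (suc m))
      terms x = term (polynomial (suc m)) (neighbour x)

  -- Charts by averaging, and the count of triples

  instance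
    q-nonZero : ℕ.NonZero q
    q-nonZero = ℕ.>-nonZero (ℕ.<-trans (ℕ.s≤s ℕ.z≤n) 2≤q)

  ∈-elements : ∀ a → a ∈ elements F
  ∈-elements a = subst (_∈ elements F) (element-index a) (∈-map⁺ element (∈-allFin (index a)))

  ∈-vectors : ∀ {n} (x : Vec K n) → x ∈ vectors F n
  ∈-vectors []      = here ≡.refl
  ∈-vectors (a ∷ x) = ∈-cartesianProductWith⁺ _∷_ (∈-elements a) (∈-vectors x)

  lookup-extensional : ∀ {n} {x y : Vec K n} → (∀ i → Vec.lookup x i ≡ Vec.lookup y i) → x ≡ y
  lookup-extensional {x = x} {y} p = ≡.trans (≡.sym (Vec.tabulate∘lookup x))
    (≡.trans (Vec.tabulate-cong p) (Vec.tabulate∘lookup y))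

  nonzero-coordinate : ∀ {n} {v : Vec K n} → v ≢ 0ᵥ F → ∃[ p ] Vec.lookup v p ≢ 0ᴷ
  nonzero-coordinate {n} {v} v≢0 = Fin.¬∀⟶∃¬ n _ (λ p → Vec.lookup v p ≟ᴷ 0ᴷ)
    λ z → v≢0 (lookup-extensional λ i → ≡.trans (z i) (≡.sym (Vec.lookup-replicate i 0ᴷ)))

  linear-comm : ∀ {n} (x y : Fin n → K) → KE.linear x y ≡ KE.linear y x
  linear-comm {zero}  x y = ≡.refl
  linear-comm {suc n} x y = ≡.cong₂ _⊕_ (K.*-comm _ _) (linear-comm (x ∘ suc) (y ∘ suc))

  linear-scale : ∀ {n} c (x y : Fin n → K) → KE.linear (λ i → c ⊗ x i) y ≡ c ⊗ KE.linear x y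
  linear-scale {zero}  c x y = ≡.sym (K.zeroʳ c)
  linear-scale {suc n} c x y = ≡.trans
    (≡.cong₂ _⊕_ (K.*-assoc c _ _) (linear-scale c (x ∘ suc) (y ∘ suc))) (≡.sym (K.distribˡ c _ _))

  module _ {m : ℕ} (P : Representatives F (suc m)) where
    open Representatives P
    private
      n = suc m
      module B = Inverse bijection

    direction : Fin size → Fin n → K
    direction i = Vec.lookup (rep i)

    direction-injective : ∀ {u v} c → c ≢ 0ᴷ → (∀ i → direction v i ≡ c ⊗ direction u i) → u ≡ v
    direction-injective {u} {v} c c≢0 eq = ≡.trans (≡.sym (B.strictlyInverseʳ u)) (≡.trans
      (B.from-cong (c , c≢0 , lookup-extensional λ i → ≡.trans (eq i) (≡.sym (Vec.lookup-map i (c ⊗_) (rep u)))))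
      (B.strictlyInverseʳ v))

    pivot : ∀ i → ∃[ p ] direction i p ≢ 0ᴷ
    pivot i = nonzero-coordinate (proj₂ (B.to i))

    -- The hyperplanes ℓ·u = 1 are q^m in number and pairwise non-proportional.
    module _ (u : Fin size) where
      private
        p = proj₁ (pivot u)
        up≢0 = proj₂ (pivot u)
        u⁻¹ = proj₁ (inverse _ up≢0)
        rest : (Fin m → K) → K
        rest s = KE.linear s (direction u ∘ punchIn p)

      normalised : (Fin m → K) → Fin n → K
      normalised s = insertAt s p (u⁻¹ ⊗ (1ᴷ ⊕ (⊖ rest s)))

      normalised-1 : ∀ s → KE.linear (normalised s) (direction u) ≡ 1ᴷ
      normalised-1 s = begin
        KE.linear h d
          ≡⟨ linear-comm h d ⟩
        KE.linear d h
          ≡⟨ linear-remove base p d h ⟩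
        d p ⊗ h p ⊕ KE.linear (d ∘ punchIn p) (h ∘ punchIn p)
          ≡⟨ ≡.cong₂ _⊕_ (≡.cong (d p ⊗_) (insertAt-lookup s p _))
               (≡.trans (linear-cong base (d ∘ punchIn p) (insertAt-punchIn s p _)) (linear-comm _ s)) ⟩
        d p ⊗ (u⁻¹ ⊗ (1ᴷ ⊕ (⊖ rest s))) ⊕ rest s
          ≡⟨ ≡.cong (_⊕ rest s) (≡.trans (≡.sym (K.*-assoc _ u⁻¹ _))
               (≡.trans (≡.cong (_⊗ (1ᴷ ⊕ (⊖ rest s))) (proj₂ (inverse _ up≢0))) (K.*-identityˡ _))) ⟩
        1ᴷ ⊕ (⊖ rest s) ⊕ rest s
          ≡⟨ ≡.trans (K.+-assoc 1ᴷ _ _) (≡.trans (≡.cong (1ᴷ ⊕_) (K.-‿inverseˡ _)) (K.+-identityʳ 1ᴷ)) ⟩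
        1ᴷ
          ∎
        where
        open ≡.≡-Reasoning
        h = normalised s
        d = direction u

      normalised-≢0 : ∀ s → Vec.tabulate (normalised s) ≢ 0ᵥ F
      normalised-≢0 s e = 1≢0 (≡.trans (≡.sym (normalised-1 s)) (≡.trans
        (linear-congˡ (direction u) λ i → ≡.trans (≡.sym (Vec.lookup∘tabulate (normalised s) i))
          (≡.trans (≡.cong (λ v → Vec.lookup v i) e) (≡.trans (Vec.lookup-replicate i 0ᴷ) (≡.sym (K.zeroˡ 0ᴷ)))))
        (≡.trans (linear-scale 0ᴷ (λ _ → 0ᴷ) (direction u)) (K.zeroˡ _))))

      -- Charts are drawn from the chosen representatives, read as linear forms, so the average over
      -- charts runs over `size` points. This is the origin of the factor 1/|P|.
      class : (Fin m → K) → Fin size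
      class s = B.from (Vec.tabulate (normalised s) , normalised-≢0 s)

      class-spec : ∀ s → ∃[ c ] ∀ i → normalised s i ≡ c ⊗ direction (class s) i
      class-spec s = let c , _ , e = B.strictlyInverseˡ (Vec.tabulate (normalised s) , normalised-≢0 s) in
        c , λ i → ≡.trans (≡.sym (Vec.lookup∘tabulate (normalised s) i))
          (≡.trans (≡.cong (λ v → Vec.lookup v i) e) (Vec.lookup-map i (c ⊗_) (rep (class s))))

      class-normal : ∀ s → proj₁ (class-spec s) ⊗ KE.linear (direction (class s)) (direction u) ≡ 1ᴷ
      class-normal s = ≡.trans (≡.sym (linear-scale _ (direction (class s)) (direction u)))
        (≡.trans (≡.sym (linear-congˡ (direction u) (proj₂ (class-spec s)))) (normalised-1 s))

      class-transversal : ∀ s → KE.linear (direction (class s)) (direction u) ≢ 0ᴷ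
      class-transversal s z = 1≢0 (≡.trans (≡.sym (class-normal s)) (≡.trans (≡.cong₂ _⊗_ ≡.refl z) (K.zeroʳ _)))

      -- Two multiples of one form that both take the value 1 at u are equal, and s is read off from
      -- its form away from the pivot.
      class-injective : ∀ {s t} → class s ≡ class t → ∀ j → s j ≡ t j
      class-injective {s} {t} e j = begin
        s j                        ≡⟨ insertAt-punchIn s p _ j ⟨
        normalised s (punchIn p j) ≡⟨ proj₂ (class-spec s) _ ⟩
        c ⊗ direction (class s) _  ≡⟨ ≡.cong₂ _⊗_ c≡d (≡.cong (λ v → direction v (punchIn p j)) e) ⟩
        d ⊗ direction (class t) _  ≡⟨ proj₂ (class-spec t) _ ⟨
        normalised t (punchIn p j) ≡⟨ insertAt-punchIn t p _ j ⟩
        t j                        ∎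
        where
        open ≡.≡-Reasoning
        c = proj₁ (class-spec s)
        d = proj₁ (class-spec t)
        y = KE.linear (direction (class s)) (direction u)
        cy≡1 : c ⊗ y ≡ 1ᴷ
        cy≡1 = class-normal s
        dy≡1 : d ⊗ y ≡ 1ᴷ
        dy≡1 = ≡.trans (≡.cong (λ v → d ⊗ KE.linear (direction v) (direction u)) e) (class-normal t)
        c≡d : c ≡ d
        c≡d = ≡.trans (≡.sym (K.*-identityʳ c)) (≡.trans (≡.cong (c ⊗_) (≡.sym dy≡1))
          (≡.trans (≡.cong (c ⊗_) (K.*-comm d y)) (≡.trans (≡.sym (K.*-assoc c y d))
          (≡.trans (≡.cong (_⊗ d) cy≡1) (K.*-identityˡ d)))))

    module Counting (μ : Vec K n → ℕ) (T : Fin size → ℕ)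
      (rich : ∀ u e → e ℕ.< T u → Σ[ b ∈ (Fin n → K) ] e ℕ.+ m ℕ.* (q ℕ.∸ 1) ℕ.+ (e / q) ℕ.* (q ℕ.∸ 1) ℕ.<
                total (λ t → μ (Vec.tabulate λ l → b l ⊕ element t ⊗ direction u l))) where

      private
        points = allFin size
        -- A common upper bound for the values of `T`.
        E = ∑ points T

      Selected : ℕ → Fin size → Fin size → Set
      Selected e i u = e ℕ.< T u × KE.linear (direction i) (direction u) ≢ 0ᴷ

      selected? : ∀ e i u → Dec (Selected e i u)
      selected? e i u = (e ℕ.<? T u) ×-dec ¬? (KE.linear (direction i) (direction u) ≟ᴷ 0ᴷ)

      selection : ℕ → Fin size → List (Fin size)
      selection e i = filter (selected? e i) points

      -- The forms with value 1 at u, sent to their classes, give q^m different charts in which u is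
      -- visible.
      transversal-count : ∀ e u → indicator (e ℕ.<? T u) ℕ.* q ℕ.^ m ℕ.≤ ∑ points (λ i → indicator (selected? e i u))
      transversal-count e u with e ℕ.<? T u
      ... | no _    = ℕ.z≤n
      ... | yes e<T = ℕ.≤-trans (ℕ.≤-reflexive (ℕ.*-identityˡ (q ℕ.^ m))) (ℕ.≤-trans
        (injection-≤ {f = class u ∘ decode}
          (λ {i} {j} eq → ≡.trans (≡.sym (Fin.funToFin-finToFin {m} {q} i)) (≡.trans
            (funToFin-cong λ l → ≡.trans (≡.sym (index-element _)) (≡.trans
              (≡.cong index (class-injective u eq l)) (index-element _)))
            (Fin.funToFin-finToFin {m} {q} j)))
          (λ i → ∈-filter⁺ transversal? (∈-allFin _) (class-transversal u (decode i))))
        (ℕ.≤-trans (ℕ.≤-reflexive (length-filter transversal? points))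
          (∑-mono points λ i → ind (KE.linear (direction i) (direction u) ≟ᴷ 0ᴷ))))
        where
        transversal? : ∀ i → Dec (KE.linear (direction i) (direction u) ≢ 0ᴷ)
        transversal? i = ¬? (KE.linear (direction i) (direction u) ≟ᴷ 0ᴷ)
        decode : Fin (q ℕ.^ m) → Fin m → K
        decode v = element ∘ finToFun v
        ind : ∀ {a} (d : Dec (a ≡ 0ᴷ)) → indicator (¬? d) ℕ.≤ indicator (yes e<T ×-dec ¬? d)
        ind (yes _) = ℕ.z≤n
        ind (no _)  = ℕ.≤-refl

      average : ∀ e → ∃[ i ] ∑ points (λ i → length (selection e i)) ℕ.≤ length points ℕ.* length (selection e i)
      average e = ≤-average (B.from (1ᴷ ∷ 0ᵥ F , 1≢0 ∘ ≡.cong Vec.head)) points (λ i → length (selection e i))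

      chart : ℕ → Fin size
      chart e = proj₁ (average e)

      -- Double counting of pairs of a chart and a direction visible in it: each direction occurs at
      -- least q^m times, and `chart e` does no worse than the average chart.
      chart-large : ∀ e → ∑ points (λ u → indicator (e ℕ.<? T u)) ℕ.* q ℕ.^ m ℕ.≤ size ℕ.* length (selection e (chart e))
      chart-large e = begin
        ∑ points (λ u → indicator (e ℕ.<? T u)) ℕ.* q ℕ.^ m
          ≡⟨ ≡.trans (ℕ.*-comm _ (q ℕ.^ m)) (≡.sym (∑-*ˡ points (q ℕ.^ m) _)) ⟩
        ∑ points (λ u → q ℕ.^ m ℕ.* indicator (e ℕ.<? T u))
          ≤⟨ ∑-mono points (λ u → ℕ.≤-trans (ℕ.≤-reflexive (ℕ.*-comm (q ℕ.^ m) _)) (transversal-count e u)) ⟩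
        ∑ points (λ u → ∑ points (λ i → indicator (selected? e i u)))
          ≡⟨ ∑-swap points points _ ⟩
        ∑ points (λ i → ∑ points (λ u → indicator (selected? e i u)))
          ≡⟨ ∑-cong points (λ i → ≡.sym (length-filter (selected? e i) points)) ⟩
        ∑ points (λ i → length (selection e i))
          ≤⟨ proj₂ (average e) ⟩
        length points ℕ.* length (selection e (chart e))
          ≡⟨ ≡.cong (ℕ._* length (selection e (chart e))) (length-tabulate {n = size} id) ⟩
        size ℕ.* length (selection e (chart e))
          ∎
        where open ℕ.≤-Reasoning

      monomials-at : ℕ → List (Vec ℕ m)
      monomials-at e = monomials m (suc (e / q))

      layer : ℕ → Fin size → List (ℕ × Fin size × Vec ℕ m)
      layer e u = map (λ k → e , u , k) (monomials-at e)

      slice : ℕ → List (ℕ × Fin size × Vec ℕ m)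
      slice e = concatMap (layer e) (selection e (chart e))

      index-list : List (ℕ × Fin size × Vec ℕ m)
      index-list = concatMap slice (downFrom E)

      ∈-layer : ∀ {e u i} → i ∈ layer e u → proj₁ i ≡ e × proj₁ (proj₂ i) ≡ u × proj₂ (proj₂ i) ∈ monomials-at e
      ∈-layer {e} {u} i∈ with ∈-map⁻ (λ k → e , u , k) i∈
      ... | k , k∈ , ≡.refl = ≡.refl , ≡.refl , k∈

      ∈-slice : ∀ {e i} → i ∈ slice e →
                proj₁ i ≡ e × Selected e (chart e) (proj₁ (proj₂ i)) × proj₂ (proj₂ i) ∈ monomials-at e
      ∈-slice {e} i∈ with find (∈-concatMap⁻ (layer e) i∈)
      ... | u , u∈ , i∈layer with ∈-layer {e} {u} i∈layer
      ... | e≡ , ≡.refl , k∈ = e≡ , proj₂ (∈-filter⁻ (selected? e (chart e)) {xs = points} u∈) , k∈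

      ∈-index-list : ∀ {i} → i ∈ index-list → proj₁ i ℕ.< E ×
        Selected (proj₁ i) (chart (proj₁ i)) (proj₁ (proj₂ i)) × proj₂ (proj₂ i) ∈ monomials-at (proj₁ i)
      ∈-index-list i∈ with find (∈-concatMap⁻ slice i∈)
      ... | e , e∈ , i∈slice with ∈-slice {e} i∈slice
      ... | ≡.refl , sel , k∈ = ∈-downFrom⁻ e∈ , sel , k∈

      index-list-unique : Unique index-list
      index-list-unique = concatMap-unique slice proj₁ (downFrom E) (Unique.downFrom⁺ E)
        (λ e → concatMap-unique (layer e) (proj₁ ∘ proj₂) (selection e (chart e))
          (Unique.filter⁺ (selected? e (chart e)) (Unique.allFin⁺ size))
          (λ u → Unique.map⁺ (≡.cong (proj₂ ∘ proj₂)) (monomials-unique m (suc (e / q))))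
          (λ u i∈ → proj₁ (proj₂ (∈-layer {e} {u} i∈))))
        (λ e i∈ → proj₁ (∈-slice {e} i∈))

      entry-spec : ∀ i → _
      entry-spec i = ∈-index-list (∈-lookup {xs = index-list} i)

      order-≤ : ∀ i → let e , _ , k = lookup index-list i in total (Vec.lookup k) ℕ.≤ e / q
      order-≤ i = let e , _ , k = lookup index-list i in ℕ.≤-trans (ℕ.≤-reflexive (total-lookup k))
        (ℕ.s≤s⁻¹ (All.lookup (monomials-small m (suc (e / q))) (proj₂ (proj₂ (entry-spec i)))))

      entries : Entries m (Fin size) direction μ
      entries = record
        { dir-injective   = direction-injective
        ; chart           = direction ∘ chart
        ; pivot           = λ e → proj₁ (pivot (chart e))
        ; chart-pivot     = λ e → proj₂ (pivot (chart e))
        ; count           = length index-list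
        ; entry           = lookup index-list
        ; entry-injective = lookup-injective index-list-unique
        ; bound           = E
        ; excess<bound    = λ i → proj₁ (entry-spec i)
        ; transversal     = λ i → proj₂ (proj₁ (proj₂ (entry-spec i)))
        ; small           = λ i → ℕ.≤-trans (ℕ.*-monoˡ-≤ q (order-≤ i)) (m/n*n≤m _ q)
        ; rich            = λ i → let b , lt = rich _ _ (proj₁ (proj₁ (proj₂ (entry-spec i)))) in
            b , ℕ.≤-<-trans (ℕ.+-monoʳ-≤ _ (ℕ.*-monoˡ-≤ (q ℕ.∸ 1) (order-≤ i))) lt
        }

      jets : List (Vec K n × Vec ℕ n)
      jets = concatMap (λ x → map (x ,_) (monomials n (μ x))) (vectors F n)

      ∈-jets : ∀ x β → Vec.sum β ℕ.< μ x → (x , β) ∈ jets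
      ∈-jets x β lt = ∈-concatMap⁺ (λ x → map (x ,_) (monomials n (μ x)))
        (lose (∈-vectors x) (∈-map⁺ (x ,_) (∈-monomials β lt)))

      length-jets : length jets ≡ ∑ (vectors F n) (λ x → length (monomials n (μ x)))
      length-jets = ≡.trans (length-concatMap _ (vectors F n))
        (∑-cong (vectors F n) λ x → length-map (x ,_) (monomials n (μ x)))

      length-index-list : length index-list ≡
        ∑ (downFrom E) (λ e → length (selection e (chart e)) ℕ.* length (monomials-at e))
      length-index-list = ≡.trans (length-concatMap slice (downFrom E)) (∑-cong (downFrom E) λ e →
        ≡.trans (length-concatMap (layer e) (selection e (chart e)))
        (≡.trans (∑-cong (selection e (chart e)) λ u → length-map (λ k → e , u , k) (monomials-at e))
                 (∑-const (selection e (chart e)) _)))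

      -- Because e + 1 ≤ (e / q + 1) q, restricting |k| to at most e / q costs a factor q^m.
      power-count : ∀ e → suc e ℕ.^ m ℕ.≤ q ℕ.^ m ℕ.* (m ℕ.! ℕ.* length (monomials-at e))
      power-count e = begin
        suc e ℕ.^ m                                        ≤⟨ ℕ.^-monoˡ-≤ m (m<[1+m/n]*n e q) ⟩
        (suc (e / q) ℕ.* q) ℕ.^ m                          ≡⟨ ^-distribʳ-* m (suc (e / q)) q ⟩
        suc (e / q) ℕ.^ m ℕ.* q ℕ.^ m                        ≡⟨ ℕ.*-comm (suc (e / q) ℕ.^ m) (q ℕ.^ m) ⟩
        q ℕ.^ m ℕ.* suc (e / q) ℕ.^ m                        ≤⟨ ℕ.*-monoʳ-≤ (q ℕ.^ m) (length-monomials-≥ m (e / q)) ⟩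
        q ℕ.^ m ℕ.* (m ℕ.! ℕ.* length (monomials-at e))      ∎
        where open ℕ.≤-Reasoning

      -- The q^m lost in `power-count` is the q^m gained in `chart-large`, and n · m! = n!.
      slice-count : ∀ e → ∑ points (λ u → indicator (e ℕ.<? T u) ℕ.* (n ℕ.* suc e ℕ.^ m)) ℕ.≤
        size ℕ.* n ℕ.! ℕ.* (length (selection e (chart e)) ℕ.* length (monomials-at e))
      slice-count e = begin
        ∑ points (λ u → indicator (e ℕ.<? T u) ℕ.* (n ℕ.* suc e ℕ.^ m))
          ≡⟨ ≡.trans (∑-cong points λ u → ℕ.*-comm (indicator (e ℕ.<? T u)) _) (∑-*ˡ points (n ℕ.* suc e ℕ.^ m) _) ⟩
        n ℕ.* suc e ℕ.^ m ℕ.* A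
          ≤⟨ ℕ.*-monoˡ-≤ A (ℕ.*-monoʳ-≤ n (power-count e)) ⟩
        n ℕ.* (q ℕ.^ m ℕ.* (m ℕ.! ℕ.* J)) ℕ.* A
          ≡⟨ solve 5 (λ n Q f J A → n :* (Q :* (f :* J)) :* A := A :* Q :* (n :* f :* J)) ≡.refl n (q ℕ.^ m) (m ℕ.!) J A ⟩
        A ℕ.* q ℕ.^ m ℕ.* (n ℕ.! ℕ.* J)
          ≤⟨ ℕ.*-monoˡ-≤ (n ℕ.! ℕ.* J) (chart-large e) ⟩
        size ℕ.* L ℕ.* (n ℕ.! ℕ.* J)
          ≡⟨ solve 4 (λ s L f J → s :* L :* (f :* J) := s :* f :* (L :* J)) ≡.refl size L (n ℕ.!) J ⟩
        size ℕ.* n ℕ.! ℕ.* (L ℕ.* J)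
          ∎
        where
        open ℕ.≤-Reasoning
        open ℕSolver.+-*-Solver
        A = ∑ points (λ u → indicator (e ℕ.<? T u))
        J = length (monomials-at e)
        L = length (selection e (chart e))

      ∑-power-≤ : ∑ points (λ u → T u ℕ.^ n) ℕ.≤ size ℕ.* ∑ (vectors F n) (λ x → (μ x ℕ.+ n) ℕ.^ n)
      ∑-power-≤ = begin
        ∑ points (λ u → T u ℕ.^ n)
          ≤⟨ ∑-mono points (λ u → ℕ.≤-trans
               (ℕ.≤-reflexive (≡.cong (ℕ._^ n) (≡.sym (ℕ.m≤n⇒m⊓n≡m (≤-∑ T (∈-allFin u)))))) (⊓-power-≤ (T u) E m)) ⟩
        ∑ points (λ u → ∑ (downFrom E) (λ e → indicator (e ℕ.<? T u) ℕ.* (n ℕ.* suc e ℕ.^ m)))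
          ≡⟨ ∑-swap points (downFrom E) _ ⟩
        ∑ (downFrom E) (λ e → ∑ points (λ u → indicator (e ℕ.<? T u) ℕ.* (n ℕ.* suc e ℕ.^ m)))
          ≤⟨ ∑-mono (downFrom E) slice-count ⟩
        ∑ (downFrom E) (λ e → size ℕ.* n ℕ.! ℕ.* (length (selection e (chart e)) ℕ.* length (monomials-at e)))
          ≡⟨ ∑-*ˡ (downFrom E) (size ℕ.* n ℕ.!) _ ⟩
        size ℕ.* n ℕ.! ℕ.* ∑ (downFrom E) (λ e → length (selection e (chart e)) ℕ.* length (monomials-at e))
          ≡⟨ ≡.cong (size ℕ.* n ℕ.! ℕ.*_) length-index-list ⟨
        size ℕ.* n ℕ.! ℕ.* length index-list
          ≤⟨ ℕ.*-monoʳ-≤ (size ℕ.* n ℕ.!) (Independence.count-≤ entries jets ∈-jets) ⟩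
        size ℕ.* n ℕ.! ℕ.* length jets
          ≡⟨ ℕ.*-assoc size (n ℕ.!) _ ⟩
        size ℕ.* (n ℕ.! ℕ.* length jets)
          ≡⟨ ≡.cong (λ v → size ℕ.* (n ℕ.! ℕ.* v)) length-jets ⟩
        size ℕ.* (n ℕ.! ℕ.* ∑ (vectors F n) (λ x → length (monomials n (μ x))))
          ≡⟨ ≡.cong (size ℕ.*_) (∑-*ˡ (vectors F n) (n ℕ.!) _) ⟨
        size ℕ.* ∑ (vectors F n) (λ x → n ℕ.! ℕ.* length (monomials n (μ x)))
          ≤⟨ ℕ.*-monoʳ-≤ size (∑-mono (vectors F n) λ x → length-monomials-≤ n (μ x)) ⟩
        size ℕ.* ∑ (vectors F n) (λ x → (μ x ℕ.+ n) ℕ.^ n)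
          ∎
        where open ℕ.≤-Reasoning

  -- Removal of the lower order terms by scaling

  open ℕSolver.+-*-Solver using (solve; _:*_; _:+_; _:=_)

  -- If x < y, then at l = k the left side exceeds (k + 1) x by at least k + 1, more than the error
  -- k allows.
  *-limit : ∀ {x y} k → (∀ l → suc l ℕ.* y ℕ.≤ suc l ℕ.* x ℕ.+ k) → y ℕ.≤ x
  *-limit {x} {y} k h = ℕ.≮⇒≥ λ x<y → ℕ.<-irrefl ≡.refl (begin-strict
    k                                  <⟨ ℕ.n<1+n k ⟩
    suc k                              ≤⟨ ℕ.+-cancelˡ-≤ (suc k ℕ.* x) (suc k) k (begin
      suc k ℕ.* x ℕ.+ suc k              ≡⟨ ≡.trans (ℕ.+-comm _ (suc k)) (≡.sym (ℕ.*-suc (suc k) x)) ⟩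
      suc k ℕ.* suc x                    ≤⟨ ℕ.*-monoʳ-≤ (suc k) x<y ⟩
      suc k ℕ.* y                        ≤⟨ h k ⟩
      suc k ℕ.* x ℕ.+ k                  ∎) ⟩
    k                                  ∎)
    where open ℕ.≤-Reasoning

  -- The error is arranged as L^m times a factor free of L = l + 1, one power of L below the main
  -- term.
  [La+b]^n≤ : ∀ m l a b → (suc l ℕ.* a ℕ.+ b) ℕ.^ suc m ℕ.≤
    suc l ℕ.^ suc m ℕ.* a ℕ.^ suc m ℕ.+ suc l ℕ.^ m ℕ.* (suc m ℕ.* b ℕ.* (a ℕ.+ b) ℕ.^ m)
  [La+b]^n≤ m l a b = begin
    (L ℕ.* a ℕ.+ b) ℕ.^ suc m
      ≤⟨ [a+b]^n≤ (L ℕ.* a) b m ⟩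
    (L ℕ.* a) ℕ.^ suc m ℕ.+ suc m ℕ.* b ℕ.* (L ℕ.* a ℕ.+ b) ℕ.^ m
      ≤⟨ ℕ.+-mono-≤ (ℕ.≤-reflexive (^-distribʳ-* (suc m) L a)) (ℕ.*-monoʳ-≤ (suc m ℕ.* b)
           (ℕ.^-monoˡ-≤ m (ℕ.≤-trans (ℕ.+-monoʳ-≤ (L ℕ.* a) (ℕ.m≤n*m b L)) (ℕ.≤-reflexive (≡.sym (ℕ.*-distribˡ-+ L a b)))))) ⟩
    L ℕ.^ suc m ℕ.* a ℕ.^ suc m ℕ.+ suc m ℕ.* b ℕ.* (L ℕ.* (a ℕ.+ b)) ℕ.^ m
      ≡⟨ ≡.cong (L ℕ.^ suc m ℕ.* a ℕ.^ suc m ℕ.+_) (≡.trans (≡.cong (suc m ℕ.* b ℕ.*_) (^-distribʳ-* m L (a ℕ.+ b)))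
           (*-left-comm (suc m ℕ.* b) (L ℕ.^ m) _)) ⟩
    L ℕ.^ suc m ℕ.* a ℕ.^ suc m ℕ.+ L ℕ.^ m ℕ.* (suc m ℕ.* b ℕ.* (a ℕ.+ b) ℕ.^ m)
      ∎
    where
    open ℕ.≤-Reasoning
    open import Algebra.Properties.CommutativeSemigroup ℕ.*-commutativeSemigroup
      using () renaming (x∙yz≈y∙xz to *-left-comm)
    L = suc l

  -- Truncation does no harm, since L a ≤ (L a ∸ b) + b whether or not b exceeds L a.
  La^n≤ : ∀ m l a b → suc l ℕ.^ suc m ℕ.* a ℕ.^ suc m ℕ.≤
    (suc l ℕ.* a ℕ.∸ b) ℕ.^ suc m ℕ.+ suc l ℕ.^ m ℕ.* (suc m ℕ.* b ℕ.* (a ℕ.+ b) ℕ.^ m)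
  La^n≤ m l a b = begin
    L ℕ.^ suc m ℕ.* a ℕ.^ suc m
      ≡⟨ ^-distribʳ-* (suc m) L a ⟨
    (L ℕ.* a) ℕ.^ suc m
      ≤⟨ ℕ.^-monoˡ-≤ (suc m) (ℕ.≤-trans (ℕ.m≤n+m∸n (L ℕ.* a) b) (ℕ.≤-reflexive (ℕ.+-comm b _))) ⟩
    (d ℕ.+ b) ℕ.^ suc m
      ≤⟨ [a+b]^n≤ d b m ⟩
    d ℕ.^ suc m ℕ.+ suc m ℕ.* b ℕ.* (d ℕ.+ b) ℕ.^ m
      ≤⟨ ℕ.+-monoʳ-≤ (d ℕ.^ suc m) (ℕ.*-monoʳ-≤ (suc m ℕ.* b) (ℕ.^-monoˡ-≤ m
           (ℕ.≤-trans (ℕ.+-mono-≤ (ℕ.m∸n≤m (L ℕ.* a) b) (ℕ.m≤n*m b L)) (ℕ.≤-reflexive (≡.sym (ℕ.*-distribˡ-+ L a b)))))) ⟩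
    d ℕ.^ suc m ℕ.+ suc m ℕ.* b ℕ.* (L ℕ.* (a ℕ.+ b)) ℕ.^ m
      ≡⟨ ≡.cong (d ℕ.^ suc m ℕ.+_) (≡.trans (≡.cong (suc m ℕ.* b ℕ.*_) (^-distribʳ-* m L (a ℕ.+ b)))
           (*-left-comm (suc m ℕ.* b) (L ℕ.^ m) _)) ⟩
    d ℕ.^ suc m ℕ.+ L ℕ.^ m ℕ.* (suc m ℕ.* b ℕ.* (a ℕ.+ b) ℕ.^ m)
      ∎
    where
    open ℕ.≤-Reasoning
    open import Algebra.Properties.CommutativeSemigroup ℕ.*-commutativeSemigroup
      using () renaming (x∙yz≈y∙xz to *-left-comm)
    L = suc l
    d = L ℕ.* a ℕ.∸ b

  module _ {m : ℕ} (P : Representatives F (suc m)) where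
    open Representatives P
    private
      n = suc m
      -- This is q (2 - 1/q). The next constant is the part of the degree that stays fixed under
      -- scaling.
      Q = q ℕ.+ (q ℕ.∸ 1)
      c = m ℕ.* (q ℕ.∸ 1)
      points = allFin size
      V = vectors F n

    module _ (μ : Vec K n → ℕ) (S : Fin size → ℕ)
      (attained : ∀ u → Σ[ b ∈ (Fin n → K) ] S u ℕ.≤ total (λ t → μ (Vec.tabulate λ l → b l ⊕ element t ⊗ direction P u l))) where

      -- Scaling μ by (2q − 1) L makes T (u) = q L S (u) − c an admissible number of layers.
      scaled-≤ : ∀ L → ∑ points (λ u → (L ℕ.* (q ℕ.* S u) ℕ.∸ c) ℕ.^ n) ℕ.≤
                       size ℕ.* ∑ V (λ x → (L ℕ.* (Q ℕ.* μ x) ℕ.+ n) ℕ.^ n)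
      scaled-≤ L = Counting.∑-power-≤ P (λ x → L ℕ.* (Q ℕ.* μ x)) (λ u → L ℕ.* (q ℕ.* S u) ℕ.∸ c) rich
        where
        open ℕ.≤-Reasoning
        rich : ∀ u e → e ℕ.< L ℕ.* (q ℕ.* S u) ℕ.∸ c → ∃[ b ] e ℕ.+ c ℕ.+ (e / q) ℕ.* (q ℕ.∸ 1) ℕ.<
                 total (λ t → L ℕ.* (Q ℕ.* μ (Vec.tabulate λ l → b l ⊕ element t ⊗ direction P u l)))
        rich u e e<T = let b , S≤ = attained u in b , (begin-strict
          e ℕ.+ c ℕ.+ (e / q) ℕ.* (q ℕ.∸ 1)
            -- The choice of T gives e + c < q L S u, and hence e / q < L S u. The contributions q
            -- and q - 1, each times L S u, add up to Q L S u.
            <⟨ ℕ.+-mono-<-≤ e+c< (ℕ.*-monoˡ-≤ (q ℕ.∸ 1) (ℕ.<⇒≤ e/q<)) ⟩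
          L ℕ.* (q ℕ.* S u) ℕ.+ L ℕ.* S u ℕ.* (q ℕ.∸ 1)
            ≡⟨ solve 4 (λ L q S p → L :* (q :* S) :+ L :* S :* p := S :* (L :* (q :+ p))) ≡.refl L q (S u) (q ℕ.∸ 1) ⟩
          S u ℕ.* (L ℕ.* Q)
            ≤⟨ ℕ.*-monoˡ-≤ (L ℕ.* Q) S≤ ⟩
          total (λ t → μ (Vec.tabulate λ l → b l ⊕ element t ⊗ direction P u l)) ℕ.* (L ℕ.* Q)
            ≡⟨ total-*ʳ (λ t → μ (Vec.tabulate λ l → b l ⊕ element t ⊗ direction P u l)) (L ℕ.* Q) ⟨
          total (λ t → μ (Vec.tabulate λ l → b l ⊕ element t ⊗ direction P u l) ℕ.* (L ℕ.* Q))
            ≡⟨ total-cong {q} (λ t → ≡.trans (ℕ.*-comm (μ _) (L ℕ.* Q)) (ℕ.*-assoc L Q _)) ⟩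
          total (λ t → L ℕ.* (Q ℕ.* μ (Vec.tabulate λ l → b l ⊕ element t ⊗ direction P u l)))
            ∎)
          where
          e+c< : e ℕ.+ c ℕ.< L ℕ.* (q ℕ.* S u)
          e+c< = ℕ.≤-trans (ℕ.+-monoˡ-≤ c e<T)
            (ℕ.≤-reflexive (ℕ.m∸n+n≡m (ℕ.<⇒≤ (ℕ.m∸n≢0⇒n<m {L ℕ.* (q ℕ.* S u)} {c} (ℕ.m<n⇒n≢0 e<T)))))
          e/q< : e / q ℕ.< L ℕ.* S u
          e/q< = m<n*o⇒m/o<n (ℕ.≤-trans (ℕ.s≤s (ℕ.m≤m+n e c)) (ℕ.≤-trans e+c<
            (ℕ.≤-reflexive (solve 3 (λ L q S → L :* (q :* S) := L :* S :* q) ≡.refl L q (S u)))))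

      -- After L^m is cancelled the two sides of `scaled-≤` are multiplied by L while the errors
      -- `K₁` and `K₂` stay fixed.
      maximal-≤ : ∑ points (λ u → (q ℕ.* S u) ℕ.^ n) ℕ.≤ size ℕ.* ∑ V (λ x → (Q ℕ.* μ x) ℕ.^ n)
      maximal-≤ = *-limit (K₁ ℕ.+ size ℕ.* K₂) λ l → ℕ.*-cancelˡ-≤ (suc l ℕ.^ m) {{ℕ.m^n≢0 (suc l) m}} (begin
        suc l ℕ.^ m ℕ.* (suc l ℕ.* Y)
          ≡⟨ solve 3 (λ A L Y → A :* (L :* Y) := L :* A :* Y) ≡.refl (suc l ℕ.^ m) (suc l) Y ⟩
        suc l ℕ.^ n ℕ.* Y
          ≡⟨ ∑-*ˡ points (suc l ℕ.^ n) _ ⟨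
        ∑ points (λ u → suc l ℕ.^ n ℕ.* (q ℕ.* S u) ℕ.^ n)
          ≤⟨ ∑-mono points (λ u → La^n≤ m l (q ℕ.* S u) c) ⟩
        ∑ points (λ u → (suc l ℕ.* (q ℕ.* S u) ℕ.∸ c) ℕ.^ n ℕ.+ suc l ℕ.^ m ℕ.* error c (q ℕ.* S u))
          ≡⟨ ≡.trans (∑-+ points _ _) (≡.cong (∑ points (λ u → (suc l ℕ.* (q ℕ.* S u) ℕ.∸ c) ℕ.^ n) ℕ.+_) (∑-*ˡ points (suc l ℕ.^ m) _)) ⟩
        ∑ points (λ u → (suc l ℕ.* (q ℕ.* S u) ℕ.∸ c) ℕ.^ n) ℕ.+ suc l ℕ.^ m ℕ.* K₁
          ≤⟨ ℕ.+-monoˡ-≤ (suc l ℕ.^ m ℕ.* K₁) (scaled-≤ (suc l)) ⟩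
        size ℕ.* ∑ V (λ x → (suc l ℕ.* (Q ℕ.* μ x) ℕ.+ n) ℕ.^ n) ℕ.+ suc l ℕ.^ m ℕ.* K₁
          ≤⟨ ℕ.+-monoˡ-≤ (suc l ℕ.^ m ℕ.* K₁) (ℕ.*-monoʳ-≤ size (∑-mono V λ x → [La+b]^n≤ m l (Q ℕ.* μ x) n)) ⟩
        size ℕ.* ∑ V (λ x → suc l ℕ.^ n ℕ.* (Q ℕ.* μ x) ℕ.^ n ℕ.+ suc l ℕ.^ m ℕ.* error n (Q ℕ.* μ x)) ℕ.+ suc l ℕ.^ m ℕ.* K₁
          ≡⟨ ≡.cong (λ v → size ℕ.* v ℕ.+ suc l ℕ.^ m ℕ.* K₁)
               (≡.trans (∑-+ V _ _) (≡.cong₂ ℕ._+_ (∑-*ˡ V (suc l ℕ.^ n) _) (∑-*ˡ V (suc l ℕ.^ m) _))) ⟩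
        size ℕ.* (suc l ℕ.^ n ℕ.* X ℕ.+ suc l ℕ.^ m ℕ.* K₂) ℕ.+ suc l ℕ.^ m ℕ.* K₁
          ≡⟨ solve 6 (λ s A L X K₂ K₁ → s :* (L :* A :* X :+ A :* K₂) :+ A :* K₁ := A :* (L :* (s :* X) :+ (K₁ :+ s :* K₂)))
               ≡.refl size (suc l ℕ.^ m) (suc l) X K₂ K₁ ⟩
        suc l ℕ.^ m ℕ.* (suc l ℕ.* (size ℕ.* X) ℕ.+ (K₁ ℕ.+ size ℕ.* K₂))
          ∎)
        where
        open ℕ.≤-Reasoning
        error : ℕ → ℕ → ℕ
        error b a = n ℕ.* b ℕ.* (a ℕ.+ b) ℕ.^ m
        Y  = ∑ points (λ u → (q ℕ.* S u) ℕ.^ n)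
        X  = ∑ V (λ x → (Q ℕ.* μ x) ℕ.^ n)
        K₁ = ∑ points (λ u → error c (q ℕ.* S u))
        K₂ = ∑ V (λ x → error n (Q ℕ.* μ x))

open import Defs
open OverField using (total; total-cong; element; sum-elements; direction; lookup-extensional; ∈-vectors; maximal-≤)
open ≡ using (refl; sym; trans; cong; cong₂; module ≡-Reasoning)

open ℚSolver.+-*-Solver using (solve; _:*_; _:+_; _:-_; _:=_; con)

-- Rational and real functions

fromℕ : ℕ → ℚ
fromℕ zero    = 0ℚ
fromℕ (suc k) = 1ℚ ℚ.+ fromℕ k

fromℕ-ᵘ : ∀ k → ℚ.toℚᵘ (fromℕ k) ℚᵘ.≃ mkℚᵘ (ℤ.+ k) 0
fromℕ-ᵘ zero    = ℚᵘ.≃-refl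
fromℕ-ᵘ (suc k) = ℚᵘ.≃-trans (ℚ.toℚᵘ-homo-+ 1ℚ (fromℕ k))
  (ℚᵘ.≃-trans (ℚᵘ.+-congʳ (ℚ.toℚᵘ 1ℚ) (fromℕ-ᵘ k))
    (*≡* (cong (λ v → (ℤ.1ℤ ℤ.+ v) ℤ.* ℤ.1ℤ) (ℤ.*-identityʳ (ℤ.+ k)))))

fromℕ-+ : ∀ a b → fromℕ (a ℕ.+ b) ≡ fromℕ a ℚ.+ fromℕ b
fromℕ-+ zero    b = sym (ℚ.+-identityˡ _)
fromℕ-+ (suc a) b = trans (cong (1ℚ ℚ.+_) (fromℕ-+ a b)) (sym (ℚ.+-assoc 1ℚ (fromℕ a) (fromℕ b)))

fromℕ-* : ∀ a b → fromℕ (a ℕ.* b) ≡ fromℕ a ℚ.* fromℕ b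
fromℕ-* zero    b = sym (ℚ.*-zeroˡ (fromℕ b))
fromℕ-* (suc a) b = trans (fromℕ-+ b (a ℕ.* b)) (trans (cong (fromℕ b ℚ.+_) (fromℕ-* a b))
  (solve 2 (λ a b → b :+ a :* b := (con 1ℚ :+ a) :* b) refl (fromℕ a) (fromℕ b)))

fromℕ-^ : ∀ a n → fromℕ (a ℕ.^ n) ≡ fromℕ a ^ℚ n
fromℕ-^ a zero    = ℚ.+-identityʳ 1ℚ
fromℕ-^ a (suc n) = trans (fromℕ-* a (a ℕ.^ n)) (cong (fromℕ a ℚ.*_) (fromℕ-^ a n))

fromℕ-nonNeg : ∀ a → 0ℚ ℚ.≤ fromℕ a
fromℕ-nonNeg zero    = ℚ.≤-refl
fromℕ-nonNeg (suc a) = ℚ.+-mono-≤ (ℚ.nonNegative⁻¹ 1ℚ) (fromℕ-nonNeg a)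

fromℕ-mono : ∀ {a b} → a ℕ.≤ b → fromℕ a ℚ.≤ fromℕ b
fromℕ-mono {b = b} ℕ.z≤n = fromℕ-nonNeg b
fromℕ-mono (ℕ.s≤s p)     = ℚ.+-monoʳ-≤ 1ℚ (fromℕ-mono p)

fromℕ-pos : ∀ a .{{_ : NonZero a}} → ℚ.Positive (fromℕ a)
fromℕ-pos (suc a) = ℚ.positive (ℚ.+-mono-<-≤ (ℚ.positive⁻¹ 1ℚ) (fromℕ-nonNeg a))

1/k*k : ∀ k .{{_ : NonZero k}} → (ℤ.+ 1 ℚ./ k) ℚ.* fromℕ k ≡ 1ℚ
1/k*k (suc k) = ℚ.toℚᵘ-injective (ℚᵘ.≃-trans (ℚ.toℚᵘ-homo-* (ℤ.+ 1 ℚ./ suc k) (fromℕ (suc k)))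
  (ℚᵘ.≃-trans (ℚᵘ.*-cong (ℚ.toℚᵘ-fromℚᵘ (mkℚᵘ (ℤ.+ 1) k)) (fromℕ-ᵘ (suc k)))
    (*≡* (cong ℤ.+_ (trans (ℕ.*-identityʳ _) (sym (trans (ℕ.*-identityˡ _) (trans (ℕ.*-identityʳ (suc k)) (sym (ℕ.+-identityʳ _))))))))))

natural-multiple : ∀ p → 0ℚ ℚ.≤ p → ∃[ a ] p ℚ.* fromℕ (ℚ.↧ₙ p) ≡ fromℕ a
natural-multiple p@(mkℚ (ℤ.+ a) d _) _ = a , ℚ.toℚᵘ-injective
  (ℚᵘ.≃-trans (ℚ.toℚᵘ-homo-* p (fromℕ (suc d)))
    (ℚᵘ.≃-trans (ℚᵘ.*-congˡ {ℚ.toℚᵘ p} (fromℕ-ᵘ (suc d)))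
      (ℚᵘ.≃-trans (*≡* (trans (ℤ.*-identityʳ _) (cong (ℤ._*_ (ℤ.+ a)) (cong ℤ.+_ (sym (ℕ.*-identityʳ (suc d)))))))
        (ℚᵘ.≃-sym (fromℕ-ᵘ a)))))
natural-multiple (mkℚ (ℤ.-[1+ a ]) d _) (ℚ.*≤* ())

-- It turns a nonnegative rational weight φ into multiplicities μ = N φ; N is the product of the
-- denominators.
common-denominator : ∀ {A : Set} (φ : A → ℚ) → (∀ x → 0ℚ ℚ.≤ φ x) → (xs : List A) →
  ∃[ N ] NonZero N × (∀ {x} → x ∈ xs → ∃[ a ] φ x ℚ.* fromℕ N ≡ fromℕ a)
common-denominator φ φ≥0 []       = 1 , _ , λ ()
common-denominator φ φ≥0 (x ∷ xs) with common-denominator φ φ≥0 xs | natural-multiple (φ x) (φ≥0 x)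
... | N , N≢0 , h | a , e = d ℕ.* N , ℕ.m*n≢0 d N {{_}} {{N≢0}} , λ
  { (here refl) → a ℕ.* N , (begin
      φ x ℚ.* fromℕ (d ℕ.* N)              ≡⟨ cong (φ x ℚ.*_) (fromℕ-* d N) ⟩
      φ x ℚ.* (fromℕ d ℚ.* fromℕ N)        ≡⟨ ℚ.*-assoc (φ x) (fromℕ d) (fromℕ N) ⟨
      φ x ℚ.* fromℕ d ℚ.* fromℕ N          ≡⟨ cong (ℚ._* fromℕ N) e ⟩
      fromℕ a ℚ.* fromℕ N                  ≡⟨ fromℕ-* a N ⟨
      fromℕ (a ℕ.* N)                      ∎)
  ; {y} (there y∈) → let b , e′ = h y∈ in d ℕ.* b , (begin
      φ y ℚ.* fromℕ (d ℕ.* N)              ≡⟨ cong (φ y ℚ.*_) (fromℕ-* d N) ⟩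
      φ y ℚ.* (fromℕ d ℚ.* fromℕ N)        ≡⟨ solve 3 (λ p d N → p :* (d :* N) := d :* (p :* N)) refl (φ y) (fromℕ d) (fromℕ N) ⟩
      fromℕ d ℚ.* (φ y ℚ.* fromℕ N)        ≡⟨ cong (fromℕ d ℚ.*_) e′ ⟩
      fromℕ d ℚ.* fromℕ b                  ≡⟨ fromℕ-* d b ⟨
      fromℕ (d ℕ.* b)                      ∎)
  }
  where
  open ≡-Reasoning
  d = ℚ.↧ₙ (φ x)

^ℚ-distrib-* : ∀ n x y → (x ℚ.* y) ^ℚ n ≡ x ^ℚ n ℚ.* y ^ℚ n
^ℚ-distrib-* zero    x y = refl
^ℚ-distrib-* (suc n) x y = trans (cong (x ℚ.* y ℚ.*_) (^ℚ-distrib-* n x y))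
  (solve 4 (λ x y X Y → x :* y :* (X :* Y) := x :* X :* (y :* Y)) refl x y (x ^ℚ n) (y ^ℚ n))

^ℚ-pos : ∀ x → ℚ.Positive x → ∀ n → ℚ.Positive (x ^ℚ n)
^ℚ-pos x 0<x zero    = _
^ℚ-pos x 0<x (suc n) = ℚ.pos*pos⇒pos x {{0<x}} (x ^ℚ n) {{^ℚ-pos x 0<x n}}

sumℚ : {A : Set} → List A → (A → ℚ) → ℚ
sumℚ xs g = foldr (λ x s → g x ℚ.+ s) 0ℚ xs

module _ {A : Set} where
  sumℚ-nonNeg : ∀ (xs : List A) {g} → (∀ x → 0ℚ ℚ.≤ g x) → 0ℚ ℚ.≤ sumℚ xs g
  sumℚ-nonNeg []       p = ℚ.≤-refl
  sumℚ-nonNeg (x ∷ xs) p = ℚ.+-mono-≤ (p x) (sumℚ-nonNeg xs p)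

  sumℚ-fromℕ : ∀ (xs : List A) {g : A → ℚ} {k : A → ℕ} c → (∀ x → g x ℚ.* c ≡ fromℕ (k x)) →
               sumℚ xs g ℚ.* c ≡ fromℕ (∑ xs k)
  sumℚ-fromℕ []       c p = ℚ.*-zeroˡ c
  sumℚ-fromℕ (x ∷ xs) {g} {k} c p = trans (ℚ.*-distribʳ-+ c (g x) (sumℚ xs g))
    (trans (cong₂ ℚ._+_ (p x) (sumℚ-fromℕ xs {g} {k} c p)) (sym (fromℕ-+ (k x) (∑ xs k))))

  seq-sumOver : ∀ (xs : List A) g k → seq (sumOver xs g) k ≡ sumℚ xs (λ x → seq (g x) k)
  seq-sumOver []       g k = refl
  seq-sumOver (x ∷ xs) g k = cong (seq (g x) k ℚ.+_) (seq-sumOver xs g k)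

  sumℚ-cong : ∀ (xs : List A) {g h} → (∀ x → g x ≡ h x) → sumℚ xs g ≡ sumℚ xs h
  sumℚ-cong []       p = refl
  sumℚ-cong (x ∷ xs) p = cong₂ ℚ._+_ (p x) (sumℚ-cong xs p)

  -- For reals it cannot be decided which argument reaches the supremum. In each term of the
  -- sequences a rational maximum is reached at some argument, which may change with the index.
  seq-⊔-attained : ∀ (xs : List A) (g : A → ℝ) (p : A → ℚ) a₀ k → (∀ a → seq (g a) k ≡ p a) →
    ∃[ a ] seq (foldr (λ a s → g a ⊔ s) (g a₀) xs) k ≡ p a
  seq-⊔-attained []       g p a₀ k e = a₀ , e a₀
  seq-⊔-attained (x ∷ xs) g p a₀ k e = choose (seq-⊔-attained xs g p a₀ k e) (ℚ.⊔-sel (seq (g x) k) rest)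
    where
    rest = seq (foldr (λ a s → g a ⊔ s) (g a₀) xs) k
    choose : ∃[ a ] rest ≡ p a → seq (g x) k ℚ.⊔ rest ≡ seq (g x) k Sum.⊎ seq (g x) k ℚ.⊔ rest ≡ rest →
             ∃[ a ] seq (g x) k ℚ.⊔ rest ≡ p a
    choose _       (inj₁ left)  = x , trans left (e x)
    choose (a , r) (inj₂ right) = a , trans right r

seq-^ : ∀ x n k → seq (x ^ n) k ≡ seq x k ^ℚ n
seq-^ x zero    k = refl
seq-^ x (suc n) k = cong (seq x k ℚ.*_) (seq-^ x n k)

seq-∣∣^ : ∀ x {p} n k → seq x k ≡ p → 0ℚ ℚ.≤ p → seq (∣ x ∣ ^ n) k ≡ p ^ℚ n
seq-∣∣^ x {p} n k e 0≤p = begin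
  seq (∣ x ∣ ^ n) k     ≡⟨ seq-^ ∣ x ∣ n k ⟩
  ℚ.∣ seq x k ∣ ^ℚ n    ≡⟨ cong (λ v → ℚ.∣ v ∣ ^ℚ n) e ⟩
  ℚ.∣ p ∣ ^ℚ n          ≡⟨ cong (_^ℚ n) (ℚ.0≤p⇒∣p∣≡p {p} 0≤p) ⟩
  p ^ℚ n                ∎
  where open ≡-Reasoning

seq-sumOver-power : ∀ {A : Set} (xs : List A) (g : A → ℝ) r k →
  seq (sumOver xs (λ x → g x ^ r)) k ≡ sumℚ xs (λ x → seq (g x) k ^ℚ r)
seq-sumOver-power xs g r k = trans (seq-sumOver xs (λ x → g x ^ r) k)
  (sumℚ-cong xs {λ x → seq (g x ^ r) k} {λ x → seq (g x) k ^ℚ r} λ x → seq-^ (g x) r k)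

seq-scale : ∀ κ₁ κ₂ y k → seq (fromℚ κ₁ * fromℚ κ₂ * y) k ≡ κ₁ ℚ.* κ₂ ℚ.* seq y k
seq-scale κ₁ κ₂ y k = refl

module _ {X I : Set} (xs : List X) (is : List I) (g : X → ℝ) (M : I → ℝ) (κ₁ κ₂ : ℚ) (r : ℕ) where
  seq-sumOver-∣∣^ : ∀ k (p : I → ℚ) → (∀ i → seq (M i) k ≡ p i) → (∀ i → 0ℚ ℚ.≤ p i) →
    seq (sumOver is (λ i → ∣ M i ∣ ^ r)) k ≡ sumℚ is (λ i → p i ^ℚ r)
  seq-sumOver-∣∣^ k p e p≥0 = trans (seq-sumOver is (λ i → ∣ M i ∣ ^ r) k)
    (sumℚ-cong is {λ i → seq (∣ M i ∣ ^ r) k} {λ i → p i ^ℚ r} λ i → seq-∣∣^ (M i) {p i} r k (e i) (p≥0 i))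

  fromApproximants : (p : ℕ → I → ℚ) → (∀ k i → seq (M i) k ≡ p k i) → (∀ k i → 0ℚ ℚ.≤ p k i) →
    (∀ k → κ₁ ℚ.* κ₂ ℚ.* sumℚ is (λ i → p k i ^ℚ r) ℚ.≤ sumℚ xs (λ x → seq (g x) k ^ℚ r)) →
    sumOver xs (λ x → g x ^ r) ≥ fromℚ κ₁ * fromℚ κ₂ * sumOver is (λ i → ∣ M i ∣ ^ r)
  fromApproximants p e p≥0 le ε 0<ε = 0 , λ k _ → begin
    seq (fromℚ κ₁ * fromℚ κ₂ * sumOver is (λ i → ∣ M i ∣ ^ r)) k
      ≡⟨ seq-scale κ₁ κ₂ (sumOver is (λ i → ∣ M i ∣ ^ r)) k ⟩
    κ₁ ℚ.* κ₂ ℚ.* seq (sumOver is (λ i → ∣ M i ∣ ^ r)) k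
      ≡⟨ cong (κ₁ ℚ.* κ₂ ℚ.*_) (seq-sumOver-∣∣^ k (p k) (e k) (p≥0 k)) ⟩
    κ₁ ℚ.* κ₂ ℚ.* sumℚ is (λ i → p k i ^ℚ r)
      ≤⟨ le k ⟩
    sumℚ xs (λ x → seq (g x) k ^ℚ r)
      ≡⟨ seq-sumOver-power xs g r k ⟨
    seq (sumOver xs (λ x → g x ^ r)) k
      ≡⟨ ℚ.+-identityʳ _ ⟨
    seq (sumOver xs (λ x → g x ^ r)) k ℚ.+ 0ℚ
      ≤⟨ ℚ.+-monoʳ-≤ (seq (sumOver xs (λ x → g x ^ r)) k) (ℚ.<⇒≤ 0<ε) ⟩
    seq (sumOver xs (λ x → g x ^ r)) k ℚ.+ ε
      ∎
    where open ℚ.≤-Reasoning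

-- Nonnegative in every term and not only in the limit, so each term of |f| is an admissible
-- rational weight.
seq-√-nonNeg : ∀ x k → 0ℚ ℚ.≤ seq (√ x) k
seq-√-nonNeg x k = proj₁ (proj₂ (approxSqrt k (seq (x ⊔ 0ℝ) k) (ℚ.p≤q⊔p (seq x k) 0ℚ)))

seq-modulus-nonNeg : ∀ z k → 0ℚ ℚ.≤ seq ∣ z ∣ℂ k
seq-modulus-nonNeg z = seq-√-nonNeg (re z * re z + im z * im z)

-- The inequality for rational weights and the passage to complex functions

module _ {q : ℕ} (F : FiniteField q) {n : ℕ} where
  lineSum : (Vector F n → ℚ) → Vector F n → Vector F n → ℚ
  lineSum φ u a = sumℚ (elements F) λ t → φ (addᵥ F a (scale F t u))

  sup-attained : ∀ (g : Vector F n → ℝ) (p : Vector F n → ℚ) k → (∀ a → seq (g a) k ≡ p a) →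
                 ∃[ a ] seq (sup F g) k ≡ p a
  sup-attained g p = seq-⊔-attained (vectors F n) g p (0ᵥ F)

  maximal-attained : ∀ f u k → ∃[ a ] seq (maximal F f u) k ≡ lineSum (λ x → seq ∣ f x ∣ℂ k) u a
  maximal-attained f u k = attained
    where
    attained : ∃[ a ] seq (sup F λ a → sumOver (elements F) λ t → ∣ f (addᵥ F a (scale F t u)) ∣ℂ) k ≡
                      lineSum (λ x → seq ∣ f x ∣ℂ k) u a
    attained = sup-attained (λ a → sumOver (elements F) λ t → ∣ f (addᵥ F a (scale F t u)) ∣ℂ)
      (lineSum (λ x → seq ∣ f x ∣ℂ k) u) k
      (λ a → seq-sumOver (elements F) (λ t → ∣ f (addᵥ F a (scale F t u)) ∣ℂ) k)

  lineSum-nonNeg : ∀ φ → (∀ x → 0ℚ ℚ.≤ φ x) → ∀ u a → 0ℚ ℚ.≤ lineSum φ u a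
  lineSum-nonNeg φ φ≥0 u a =
    sumℚ-nonNeg (elements F) {λ t → φ (addᵥ F a (scale F t u))} λ t → φ≥0 (addᵥ F a (scale F t u))

module _ {q : ℕ} .{{_ : NonZero q}} (F : FiniteField q) {m : ℕ} .{{n≢0 : NonZero (suc m)}} (P : Representatives F (suc m)) where
  open Representatives P
  private
    n = suc m
    Q = q ℕ.+ (q ℕ.∸ 1)
    V = vectors F n
    points = allFin size
    𝕂 = FiniteField.Carrier F
    w = 2-1/ q

    w*q : w ℚ.* fromℕ q ≡ fromℕ Q
    w*q = begin
      w ℚ.* fromℕ q
        ≡⟨ solve 3 (λ t r q → (t :- r) :* q := t :* q :- r :* q) refl (ℤ.+ 2 ℚ./ 1) (ℤ.+ 1 ℚ./ q) (fromℕ q) ⟩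
      (ℤ.+ 2 ℚ./ 1) ℚ.* fromℕ q ℚ.- (ℤ.+ 1 ℚ./ q) ℚ.* fromℕ q
        ≡⟨ cong (λ v → (ℤ.+ 2 ℚ./ 1) ℚ.* fromℕ q ℚ.- v) (1/k*k q) ⟩
      (ℤ.+ 2 ℚ./ 1) ℚ.* fromℕ q ℚ.- 1ℚ
        ≡⟨ cong (λ v → (ℤ.+ 2 ℚ./ 1) ℚ.* v ℚ.- 1ℚ) q≡ ⟩
      (ℤ.+ 2 ℚ./ 1) ℚ.* (1ℚ ℚ.+ fromℕ (q ℕ.∸ 1)) ℚ.- 1ℚ
        ≡⟨ solve 1 (λ p → con (ℤ.+ 2 ℚ./ 1) :* (con 1ℚ :+ p) :- con 1ℚ := con 1ℚ :+ p :+ p) refl (fromℕ (q ℕ.∸ 1)) ⟩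
      1ℚ ℚ.+ fromℕ (q ℕ.∸ 1) ℚ.+ fromℕ (q ℕ.∸ 1)
        ≡⟨ cong (ℚ._+ fromℕ (q ℕ.∸ 1)) q≡ ⟨
      fromℕ q ℚ.+ fromℕ (q ℕ.∸ 1)
        ≡⟨ fromℕ-+ q (q ℕ.∸ 1) ⟨
      fromℕ Q
        ∎
      where
      open ≡-Reasoning
      q≡ : fromℕ q ≡ 1ℚ ℚ.+ fromℕ (q ℕ.∸ 1)
      q≡ = cong fromℕ (sym (ℕ.suc-pred q))

    w-pos : ℚ.Positive w
    w-pos = ℚ.positive (ℚ.*-cancelʳ-<-nonNeg (fromℕ q) {{ℚ.nonNegative (fromℕ-nonNeg q)}} {0ℚ} {w} (begin-strict
      0ℚ ℚ.* fromℕ q   ≡⟨ ℚ.*-zeroˡ (fromℕ q) ⟩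
      0ℚ               <⟨ ℚ.positive⁻¹ (fromℕ Q) {{fromℕ-pos Q {{Q≢0}}}} ⟩
      fromℕ Q          ≡⟨ w*q ⟨
      w ℚ.* fromℕ q    ∎))
      where
      open ℚ.≤-Reasoning
      Q≢0 : NonZero Q
      Q≢0 = ℕ.>-nonZero (ℕ.≤-trans (ℕ.>-nonZero⁻¹ q) (ℕ.m≤m+n q (q ℕ.∸ 1)))

  module _ (φ : Vector F (suc m) → ℚ) (φ≥0 : ∀ x → 0ℚ ℚ.≤ φ x) where
    -- The base points `a u` are arbitrary, which allows them to be the maximising points of any one
    -- term of the Cauchy sequences.
    rational-maximal-≤ : (a : Fin (Representatives.size P) → Vector F (suc m)) →
      (1/[2-1/ q ]^ suc m) ℚ.* (Representatives.1/size P {{n≢0}}) ℚ.*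
        sumℚ (allFin (Representatives.size P)) (λ u → lineSum F φ (Representatives.rep P u) (a u) ^ℚ suc m) ℚ.≤
      sumℚ (vectors F (suc m)) (λ x → φ x ^ℚ suc m)
    rational-maximal-≤ a = begin
      κ ℚ.* Y
        ≤⟨ ℚ.*-monoˡ-≤-nonNeg κ {{ℚ.pos⇒nonNeg κ {{κ-pos}}}} Y≤ ⟩
      κ ℚ.* (fromℕ size ℚ.* (W ℚ.* X))
        ≡⟨ solve 5 (λ i r s w x → i :* r :* (s :* (w :* x)) := (w :* i) :* (r :* s) :* x) refl i s⁻¹ (fromℕ size) W X ⟩
      (W ℚ.* i) ℚ.* (s⁻¹ ℚ.* fromℕ size) ℚ.* X
        ≡⟨ cong₂ (λ a b → a ℚ.* b ℚ.* X) (ℚ.*-inverseʳ W {{W≢0}}) (1/k*k size {{size-nonZero {{n≢0}}}}) ⟩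
      1ℚ ℚ.* 1ℚ ℚ.* X
        ≡⟨ ℚ.*-identityˡ X ⟩
      X
        ∎
      where
      open ℚ.≤-Reasoning
      s⁻¹ = 1/size {{n≢0}}
      W = w ^ℚ n
      W-pos : ℚ.Positive W
      W-pos = ^ℚ-pos w w-pos n
      W≢0 : ℚ.NonZero W
      W≢0 = ℚ.pos⇒nonZero W {{W-pos}}
      i = 1/[2-1/ q ]^ n
      κ = i ℚ.* s⁻¹
      κ-pos : ℚ.Positive κ
      κ-pos = ℚ.pos*pos⇒pos i {{ℚ.1/pos⇒pos W {{W-pos}}}} s⁻¹ {{ℚ.normalize-pos 1 size {{size-nonZero {{n≢0}}}}}}
      X = sumℚ V (λ x → φ x ^ℚ n)
      Y = sumℚ points (λ u → lineSum F φ (rep u) (a u) ^ℚ n)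
      denominator = common-denominator φ φ≥0 V
      N = proj₁ denominator
      N≢0 = proj₁ (proj₂ denominator)
      μ : Vec 𝕂 n → ℕ
      μ x = proj₁ (proj₂ (proj₂ denominator) (∈-vectors F x))
      φ*N : ∀ x → φ x ℚ.* fromℕ N ≡ fromℕ (μ x)
      φ*N x = proj₂ (proj₂ (proj₂ denominator) (∈-vectors F x))
      S : Fin size → ℕ
      S u = ∑ (elements F) (λ t → μ (addᵥ F (a u) (scale F t (rep u))))
      -- Multiplication by (N q)^n turns the powers of line sums into (q S u)^n. On the other side
      -- (N Q)^n = W (N q)^n turns φ^n into (Q μ)^n, which explains the factor W = (2 - 1/q)^n.
      C = (fromℕ N ℚ.* fromℕ q) ^ℚ n
      C-pos : ℚ.Positive C
      C-pos = ^ℚ-pos (fromℕ N ℚ.* fromℕ q) (ℚ.pos*pos⇒pos (fromℕ N) {{fromℕ-pos N {{N≢0}}}} (fromℕ q) {{fromℕ-pos q}}) n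
      power-fromℕ : ∀ {p k} c → p ℚ.* fromℕ N ≡ fromℕ k → p ^ℚ n ℚ.* (fromℕ N ℚ.* fromℕ c) ^ℚ n ≡ fromℕ ((c ℕ.* k) ℕ.^ n)
      power-fromℕ {p} {k} c e = trans (sym (^ℚ-distrib-* n p (fromℕ N ℚ.* fromℕ c))) (trans
        (cong (_^ℚ n) (trans (sym (ℚ.*-assoc p (fromℕ N) (fromℕ c)))
          (trans (cong (ℚ._* fromℕ c) e) (trans (ℚ.*-comm (fromℕ k) (fromℕ c)) (sym (fromℕ-* c k))))))
        (sym (fromℕ-^ (c ℕ.* k) n)))
      Y*C : Y ℚ.* C ≡ fromℕ (∑ points (λ u → (q ℕ.* S u) ℕ.^ n))
      Y*C = sumℚ-fromℕ points {λ u → lineSum F φ (rep u) (a u) ^ℚ n} C λ u →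
        power-fromℕ {lineSum F φ (rep u) (a u)} q
          (sumℚ-fromℕ (elements F) {λ t → φ (addᵥ F (a u) (scale F t (rep u)))} (fromℕ N) λ t → φ*N _)
      X*D : X ℚ.* (fromℕ N ℚ.* fromℕ Q) ^ℚ n ≡ fromℕ (∑ V (λ x → (Q ℕ.* μ x) ℕ.^ n))
      X*D = sumℚ-fromℕ V {λ x → φ x ^ℚ n} ((fromℕ N ℚ.* fromℕ Q) ^ℚ n) λ x → power-fromℕ {φ x} Q (φ*N x)
      line≡ : ∀ u t → addᵥ F (a u) (scale F t (rep u)) ≡
        Vec.tabulate (λ l → FiniteField._⊕_ F (Vec.lookup (a u) l) (FiniteField._⊗_ F t (Vec.lookup (rep u) l)))
      line≡ u t = lookup-extensional F λ l → trans
        (trans (Vec.lookup-zipWith (FiniteField._⊕_ F) l (a u) (scale F t (rep u)))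
          (cong (FiniteField._⊕_ F (Vec.lookup (a u) l)) (Vec.lookup-map l (FiniteField._⊗_ F t) (rep u))))
        (sym (Vec.lookup∘tabulate (λ l → FiniteField._⊕_ F (Vec.lookup (a u) l) (FiniteField._⊗_ F t (Vec.lookup (rep u) l))) l))
      attained : ∀ u → ∃[ b ] S u ℕ.≤ total F (λ t → μ (Vec.tabulate λ l →
        FiniteField._⊕_ F (b l) (FiniteField._⊗_ F (element F t) (direction F P u l))))
      attained u = Vec.lookup (a u) , ℕ.≤-reflexive (trans (sum-elements F _)
        (total-cong F λ t → cong μ (line≡ u (element F t))))
      Y≤ : Y ℚ.≤ fromℕ size ℚ.* (W ℚ.* X)
      Y≤ = ℚ.*-cancelʳ-≤-pos C {{C-pos}} (begin
        Y ℚ.* C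
          ≡⟨ Y*C ⟩
        fromℕ (∑ points (λ u → (q ℕ.* S u) ℕ.^ n))
          ≤⟨ fromℕ-mono (maximal-≤ F P μ S attained) ⟩
        fromℕ (size ℕ.* ∑ V (λ x → (Q ℕ.* μ x) ℕ.^ n))
          ≡⟨ fromℕ-* size _ ⟩
        fromℕ size ℚ.* fromℕ (∑ V (λ x → (Q ℕ.* μ x) ℕ.^ n))
          ≡⟨ cong (fromℕ size ℚ.*_) X*D ⟨
        fromℕ size ℚ.* (X ℚ.* (fromℕ N ℚ.* fromℕ Q) ^ℚ n)
          ≡⟨ cong (λ v → fromℕ size ℚ.* (X ℚ.* v)) D≡ ⟩
        fromℕ size ℚ.* (X ℚ.* (W ℚ.* C))
          ≡⟨ solve 4 (λ s x w c → s :* (x :* (w :* c)) := s :* (w :* x) :* c) refl (fromℕ size) X W C ⟩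
        fromℕ size ℚ.* (W ℚ.* X) ℚ.* C
          ∎)
        where
        D≡ : (fromℕ N ℚ.* fromℕ Q) ^ℚ n ≡ W ℚ.* C
        D≡ = trans (cong (_^ℚ n) (trans (cong (fromℕ N ℚ.*_) (sym w*q))
          (solve 3 (λ N w q → N :* (w :* q) := w :* (N :* q)) refl (fromℕ N) w (fromℕ q)))) (^ℚ-distrib-* n w _)

-- Reached through the local `open`, rep would be a copy of the field, and comparing
-- the two would unfold the Cauchy sequences under maximal; hence the full name.
theorem1p10 : (n q : ℕ) .{{_ : NonZero n}} .{{_ : NonZero q}} → IsPrimePower q →
    (F : FiniteField q) (P : Representatives F n) →
    let open Representatives P in
    (f : Vector F n → ℂ) →
    sumOver (vectors F n) (λ x → ∣ f x ∣ℂ ^ n)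
      ≥ fromℚ (1/[2-1/ q ]^ n) * fromℚ 1/size
          * sumOver (allFin size) (λ i → ∣ maximal F f (Representatives.rep P i) ∣ ^ n)
theorem1p10 (suc m) q {{n≢0}} {{q≢0}} _ F P f =
  fromApproximants (vectors F (suc m)) (allFin (Representatives.size P)) (λ x → ∣ f x ∣ℂ) (λ i → maximal F f (Representatives.rep P i))
    ((1/[2-1/ q ]^ suc m) {{q≢0}}) (Representatives.1/size P {{n≢0}}) (suc m)
    (λ k i → lineSum F (λ x → seq ∣ f x ∣ℂ k) (Representatives.rep P i) (proj₁ (maximal-attained F f (Representatives.rep P i) k))) attained nonNeg bound
  where
  modulus≥0 : ∀ k x → 0ℚ ℚ.≤ seq ∣ f x ∣ℂ k
  modulus≥0 k x = seq-modulus-nonNeg (f x) k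
  attained : ∀ k i → seq (maximal F f (Representatives.rep P i)) k ≡ lineSum F (λ x → seq ∣ f x ∣ℂ k) (Representatives.rep P i) (proj₁ (maximal-attained F f (Representatives.rep P i) k))
  attained k i = proj₂ (maximal-attained F f (Representatives.rep P i) k)
  nonNeg : ∀ k i → 0ℚ ℚ.≤ lineSum F (λ x → seq ∣ f x ∣ℂ k) (Representatives.rep P i) (proj₁ (maximal-attained F f (Representatives.rep P i) k))
  nonNeg k i = lineSum-nonNeg F (λ x → seq ∣ f x ∣ℂ k) (modulus≥0 k) (Representatives.rep P i)
    (proj₁ (maximal-attained F f (Representatives.rep P i) k))
  bound : ∀ k → (1/[2-1/ q ]^ suc m) {{q≢0}} ℚ.* (Representatives.1/size P {{n≢0}}) ℚ.*
      sumℚ (allFin (Representatives.size P)) (λ i → lineSum F (λ x → seq ∣ f x ∣ℂ k) (Representatives.rep P i) (proj₁ (maximal-attained F f (Representatives.rep P i) k)) ^ℚ suc m) ℚ.≤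
    sumℚ (vectors F (suc m)) (λ x → seq ∣ f x ∣ℂ k ^ℚ suc m)
  bound k = rational-maximal-≤ {{q≢0}} F {{n≢0}} P (λ x → seq ∣ f x ∣ℂ k) (modulus≥0 k)
    (λ i → proj₁ (maximal-attained F f (Representatives.rep P i) k))
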